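{- There is an absolute constant $C$ such that the following holds. Let $x\ge 2$ and let $T_1,\ldots,T_r$ be arbitrary disjoint nonempty subsets of the primes $\le x$. Let $k_1,\ldots,k_r\ge 0$ be integers and $P=\mathbb P_x(\omega(n;T_j)=k_j\ (1\le j\le r))$. Let $\eta=0$ if $T_1\cup\cdots\cup T_r$ contains every prime $\le x$ and $\eta=1$ otherwise; let $\xi=1$ if $\eta=k_1=\cdots=k_r=0$ and $\xi=0$ otherwise. Then \[ P\le C\prod_{j=1}^r\Big(\frac{H'(T_j)^{k_j}}{k_j!}\mathrm{e}^{ -H(T_j)}\Big)\Big(\eta+\frac{k_1}{H'(T_1)}+\cdots+\frac{k_r}{H'(T_r)}\Big)+C\xi, \] and also \[ P\le C\prod_{j=1}^r\Big(\frac{(H(T_j)+2)^{k_j}}{k_j!}\mathrm{e}^{ -H(T_j)}\Big). \]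
   Context: $\mathbb P_x$ denotes probability with respect to an integer $n$ drawn uniformly at random from $[1,x]$. For a finite set $T$ of primes, $\omega(n;T)=\#\{p\mid n:p\in T\}$, $H(T)=\sum_{p\in T}1/p$, $H'(T)=\sum_{p\in T}1/(p-1)$. -}

module Defs where

open import Data.Nat.Base as ℕ using (ℕ; zero; suc; _!)
import Data.Nat.Properties as ℕₚ
import Data.Nat.Coprimality as Coprime
open import Data.Nat.Divisibility using (_∣?_)
open import Data.Nat.Primality using (Prime; prime; prime⇒nonZero)
open import Data.Integer.Base as ℤ using (+_; -[1+_])
import Data.Integer.Properties as ℤₚ
open import Data.Rational.Base hiding (_≥_; _>_)
open import Data.Rational.Properties
open import Data.Rational.Solver using (module +-*-Solver)
import Data.Rational.Unnormalised.Base as ℚᵘ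
import Data.Rational.Unnormalised.Properties as ℚᵘₚ
open import Algebra.Definitions.RawSemiring +-*-rawSemiring using (_^_) public
open import Algebra.Definitions.RawMonoid +-0-rawMonoid using (sum) public
open import Data.Fin.Base using (Fin)
import Data.Fin.Properties as Finₚ
open import Data.List.Base using (List; []; _∷_; length; filter; map; upTo; foldr)
open import Data.List.Membership.Propositional using (_∈_)
open import Data.List.Relation.Unary.All as All using (All; []; _∷_)
open import Data.List.Relation.Unary.Unique.Propositional using (Unique)
import Data.Vec.Functional as Vector
open import Data.Product.Base using (∃; _×_; _,_; proj₁; proj₂)
open import Data.Empty using (⊥-elim)
open import Level using (0ℓ)
open import Relation.Unary using (Pred; Decidable)
open import Relation.Nullary using (¬_)
open import Relation.Binary.PropositionalEquality

open +-*-Solver using (solve; _:=_; _:+_; _:*_; _:-_; :-_; con)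

fromℕ : ℕ → ℚ
fromℕ n = + n / 1

IsCauchy : (ℕ → ℚ) → Set
IsCauchy s = ∀ ε → 0ℚ < ε → ∃ λ N → ∀ m n → N ℕ.≤ m → N ℕ.≤ n → ∣ s m - s n ∣ < ε

record ℝ : Set where
  constructor mkℝ
  field
    seq      : ℕ → ℚ
    isCauchy : IsCauchy seq

open ℝ public

infix 4 _≤ᴿ_ _<ᴿ_

-- lim x ≤ lim y; the slack ε is needed because x and y need not be ordered termwise.
_≤ᴿ_ : ℝ → ℝ → Set
x ≤ᴿ y = ∀ ε → 0ℚ < ε → ∃ λ N → ∀ n → N ℕ.≤ n → seq x n ≤ seq y n + ε

_<ᴿ_ : ℝ → ℝ → Set
x <ᴿ y = ∃ λ ε → 0ℚ < ε × ∃ λ N → ∀ n → N ℕ.≤ n → seq x n + ε ≤ seq y n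

private

  ½-pos : ∀ {ε} → 0ℚ < ε → 0ℚ < ½ * ε
  ½-pos {ε} 0<ε = subst (_< ½ * ε) (*-zeroʳ ½) (*-monoʳ-<-pos ½ 0<ε)

  half+half : ∀ ε → ½ * ε + ½ * ε ≡ ε
  half+half ε = trans (sym (*-distribʳ-+ ε ½ ½)) (*-identityˡ ε)

  triangle : ∀ a b c → ∣ a - c ∣ ≤ ∣ a - b ∣ + ∣ b - c ∣
  triangle a b c = subst (λ z → ∣ z ∣ ≤ ∣ a - b ∣ + ∣ b - c ∣)
    (solve 3 (λ a b c → (a :- b) :+ (b :- c) := a :- c) refl a b c)
    (∣p+q∣≤∣p∣+∣q∣ (a - b) (b - c))

  ∣-∣-sym : ∀ a b → ∣ a - b ∣ ≡ ∣ b - a ∣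
  ∣-∣-sym a b = trans (sym (∣-p∣≡∣p∣ (a - b)))
    (cong ∣_∣ (solve 2 (λ a b → :- (a :- b) := b :- a) refl a b))

  0<a+1 : ∀ {a} → 0ℚ ≤ a → 0ℚ < a + 1ℚ
  0<a+1 0≤a = +-mono-≤-< 0≤a (positive⁻¹ 1ℚ)

  eventuallyBounded : ∀ {s} → IsCauchy s →
    ∃ λ K → 0ℚ < K × ∃ λ N → ∀ n → N ℕ.≤ n → ∣ s n ∣ ≤ K
  eventuallyBounded {s} c with c 1ℚ (positive⁻¹ 1ℚ)
  ... | N , close = ∣ s N ∣ + 1ℚ , 0<a+1 (0≤∣p∣ (s N)) , N , bound
    where
    bound : ∀ n → N ℕ.≤ n → ∣ s n ∣ ≤ ∣ s N ∣ + 1ℚ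
    bound n N≤n = begin
      ∣ s n ∣                  ≡⟨ cong ∣_∣ (solve 2 (λ a b → a := b :+ (a :- b)) refl (s n) (s N)) ⟩
      ∣ s N + (s n - s N) ∣    ≤⟨ ∣p+q∣≤∣p∣+∣q∣ (s N) (s n - s N) ⟩
      ∣ s N ∣ + ∣ s n - s N ∣  ≤⟨ +-monoʳ-≤ ∣ s N ∣ (<⇒≤ (close n N N≤n ℕₚ.≤-refl)) ⟩
      ∣ s N ∣ + 1ℚ             ∎
      where open ≤-Reasoning

  const-cauchy : ∀ q → IsCauchy (λ _ → q)
  const-cauchy q ε 0<ε = 0 , λ _ _ _ _ → subst (_< ε) (sym (cong ∣_∣ (+-inverseʳ q))) 0<ε

  +-cauchy : ∀ {s t} → IsCauchy s → IsCauchy t → IsCauchy (λ n → s n + t n)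
  +-cauchy {s} {t} cs ct ε 0<ε with cs (½ * ε) (½-pos 0<ε) | ct (½ * ε) (½-pos 0<ε)
  ... | M , ps | N , pt = M ℕ.⊔ N , close
    where
    close : ∀ m n → M ℕ.⊔ N ℕ.≤ m → M ℕ.⊔ N ℕ.≤ n → ∣ (s m + t m) - (s n + t n) ∣ < ε
    close m n l≤m l≤n = begin-strict
      ∣ (s m + t m) - (s n + t n) ∣    ≡⟨ cong ∣_∣ (solve 4 (λ a b c d → (a :+ b) :- (c :+ d) := (a :- c) :+ (b :- d)) refl (s m) (t m) (s n) (t n)) ⟩
      ∣ (s m - s n) + (t m - t n) ∣    ≤⟨ ∣p+q∣≤∣p∣+∣q∣ (s m - s n) (t m - t n) ⟩
      ∣ s m - s n ∣ + ∣ t m - t n ∣    <⟨ +-mono-<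
        (ps m n (ℕₚ.m⊔n≤o⇒m≤o M N l≤m) (ℕₚ.m⊔n≤o⇒m≤o M N l≤n))
        (pt m n (ℕₚ.m⊔n≤o⇒n≤o M N l≤m) (ℕₚ.m⊔n≤o⇒n≤o M N l≤n)) ⟩
      ½ * ε + ½ * ε                    ≡⟨ half+half ε ⟩
      ε                                ∎
      where open ≤-Reasoning

  divide : ∀ {ε K} → 0ℚ < ε → 0ℚ < K → ∃ λ δ → 0ℚ < δ × K * δ ≡ ε
  divide {ε} {K} 0<ε 0<K = 1/ K * ε , 0<δ , eq
    where
    instance
      _ : Positive K
      _ = positive 0<K
      _ : NonZero K
      _ = >-nonZero 0<K
      _ : Positive (1/ K)
      _ = 1/pos⇒pos K
    0<δ : 0ℚ < 1/ K * ε
    0<δ = subst (_< 1/ K * ε) (*-zeroʳ (1/ K)) (*-monoʳ-<-pos (1/ K) 0<ε)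
    eq : K * (1/ K * ε) ≡ ε
    eq = trans (sym (*-assoc K (1/ K) ε)) (trans (cong (_* ε) (*-inverseʳ K)) (*-identityˡ ε))

  ∣*∣-bound : ∀ {a b K δ} → 0ℚ < K → ∣ a ∣ ≤ K → ∣ b ∣ < δ → ∣ a * b ∣ < K * δ
  ∣*∣-bound {a} {b} {K} {δ} 0<K a≤K b<δ = begin-strict
    ∣ a * b ∣      ≡⟨ ∣p*q∣≡∣p∣*∣q∣ a b ⟩
    ∣ a ∣ * ∣ b ∣  ≤⟨ *-monoʳ-≤-nonNeg ∣ b ∣ {{∣-∣-nonNeg b}} a≤K ⟩
    K * ∣ b ∣      <⟨ *-monoʳ-<-pos K {{positive 0<K}} b<δ ⟩
    K * δ          ∎
    where open ≤-Reasoning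

  mulDiff : ∀ a b c d → a * b - c * d ≡ a * (b - d) + d * (a - c)
  mulDiff a b c d = sym (begin
    a * (b - d) + d * (a - c)                ≡⟨ cong₂ _+_ (*-distribˡ-+ a b (- d)) (*-distribˡ-+ d a (- c)) ⟩
    (a * b + a * - d) + (d * a + d * - c)    ≡⟨ solve 4 (λ p q r s → (p :+ q) :+ (r :+ s) := (p :+ s) :+ (q :+ r)) refl (a * b) (a * - d) (d * a) (d * - c) ⟩
    (a * b + d * - c) + (a * - d + d * a)    ≡⟨ cong₂ _+_ (cong (λ z → a * b + z) e₁) e₂ ⟩
    (a * b - c * d) + 0ℚ                     ≡⟨ +-identityʳ (a * b - c * d) ⟩
    a * b - c * d                            ∎)
    where
    open ≡-Reasoning
    e₁ : d * - c ≡ - (c * d)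
    e₁ = trans (sym (neg-distribʳ-* d c)) (cong -_ (*-comm d c))
    e₂ : a * - d + d * a ≡ 0ℚ
    e₂ = trans (cong₂ _+_ (sym (neg-distribʳ-* a d)) (*-comm d a)) (+-inverseˡ (a * d))

  *-cauchy : ∀ {s t} → IsCauchy s → IsCauchy t → IsCauchy (λ n → s n * t n)
  *-cauchy {s} {t} cs ct ε 0<ε = A ℕ.⊔ B ℕ.⊔ (M ℕ.⊔ N) , close
    where
    s-bounded = eventuallyBounded {s} cs
    t-bounded = eventuallyBounded {t} ct
    K   = proj₁ s-bounded
    0<K = proj₁ (proj₂ s-bounded)
    A   = proj₁ (proj₂ (proj₂ s-bounded))
    bs  = proj₂ (proj₂ (proj₂ s-bounded))
    L   = proj₁ t-bounded
    0<L = proj₁ (proj₂ t-bounded)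
    B   = proj₁ (proj₂ (proj₂ t-bounded))
    bt  = proj₂ (proj₂ (proj₂ t-bounded))
    δ-data = divide (½-pos 0<ε) 0<K
    γ-data = divide (½-pos 0<ε) 0<L
    δ   = proj₁ δ-data
    γ   = proj₁ γ-data
    s-close = cs γ (proj₁ (proj₂ γ-data))
    t-close = ct δ (proj₁ (proj₂ δ-data))
    M   = proj₁ s-close
    ps  = proj₂ s-close
    N   = proj₁ t-close
    pt  = proj₂ t-close
    lA : ∀ {m} → A ℕ.⊔ B ℕ.⊔ (M ℕ.⊔ N) ℕ.≤ m → A ℕ.≤ m
    lA p = ℕₚ.m⊔n≤o⇒m≤o A B (ℕₚ.m⊔n≤o⇒m≤o (A ℕ.⊔ B) (M ℕ.⊔ N) p)
    lB : ∀ {m} → A ℕ.⊔ B ℕ.⊔ (M ℕ.⊔ N) ℕ.≤ m → B ℕ.≤ m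
    lB p = ℕₚ.m⊔n≤o⇒n≤o A B (ℕₚ.m⊔n≤o⇒m≤o (A ℕ.⊔ B) (M ℕ.⊔ N) p)
    lM : ∀ {m} → A ℕ.⊔ B ℕ.⊔ (M ℕ.⊔ N) ℕ.≤ m → M ℕ.≤ m
    lM p = ℕₚ.m⊔n≤o⇒m≤o M N (ℕₚ.m⊔n≤o⇒n≤o (A ℕ.⊔ B) (M ℕ.⊔ N) p)
    lN : ∀ {m} → A ℕ.⊔ B ℕ.⊔ (M ℕ.⊔ N) ℕ.≤ m → N ℕ.≤ m
    lN p = ℕₚ.m⊔n≤o⇒n≤o M N (ℕₚ.m⊔n≤o⇒n≤o (A ℕ.⊔ B) (M ℕ.⊔ N) p)
    close : ∀ m n → A ℕ.⊔ B ℕ.⊔ (M ℕ.⊔ N) ℕ.≤ m → A ℕ.⊔ B ℕ.⊔ (M ℕ.⊔ N) ℕ.≤ n →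
            ∣ s m * t m - s n * t n ∣ < ε
    close m n p q = begin-strict
      ∣ s m * t m - s n * t n ∣                            ≡⟨ cong ∣_∣ (mulDiff (s m) (t m) (s n) (t n)) ⟩
      ∣ s m * (t m - t n) + t n * (s m - s n) ∣            ≤⟨ ∣p+q∣≤∣p∣+∣q∣ (s m * (t m - t n)) (t n * (s m - s n)) ⟩
      ∣ s m * (t m - t n) ∣ + ∣ t n * (s m - s n) ∣        <⟨ +-mono-<
        (∣*∣-bound {s m} {t m - t n} 0<K (bs m (lA p)) (pt m n (lN p) (lN q)))
        (∣*∣-bound {t n} {s m - s n} 0<L (bt n (lB q)) (ps m n (lM p) (lM q))) ⟩
      K * δ + L * γ                                        ≡⟨ cong₂ _+_ (proj₂ (proj₂ δ-data)) (proj₂ (proj₂ γ-data)) ⟩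
      ½ * ε + ½ * ε                                        ≡⟨ half+half ε ⟩
      ε                                                    ∎
      where open ≤-Reasoning

⟦_⟧ : ℚ → ℝ
⟦ q ⟧ = mkℝ (λ _ → q) (const-cauchy q)

infixl 6 _+ᴿ_
infixl 7 _*ᴿ_

_+ᴿ_ : ℝ → ℝ → ℝ
x +ᴿ y = mkℝ (λ n → seq x n + seq y n) (+-cauchy {seq x} {seq y} (isCauchy x) (isCauchy y))

_*ᴿ_ : ℝ → ℝ → ℝ
x *ᴿ y = mkℝ (λ n → seq x n * seq y n) (*-cauchy {seq x} {seq y} (isCauchy x) (isCauchy y))

∏ : ∀ {r} → (Fin r → ℝ) → ℝ
∏ = Vector.foldr _*ᴿ_ ⟦ 1ℚ ⟧

1/[_]! : ℕ → ℚ
1/[ n ]! = (+ 1 / (n !)) {{n ℕₚ.!≢0}}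

expTerm : ℚ → ℕ → ℚ
expTerm q n = q ^ n * 1/[ n ]!

expSum : ℚ → ℕ → ℚ
expSum q zero    = 0ℚ
expSum q (suc n) = expSum q n + expTerm q n

private

  fromℕ≡mkℚ : ∀ n → fromℕ n ≡ mkℚ (+ n) 0 (Coprime.sym (Coprime.1-coprimeTo n))
  fromℕ≡mkℚ n = normalize-coprime (Coprime.sym (Coprime.1-coprimeTo n))

  toℚᵘ-fromℕ : ∀ n → toℚᵘ (fromℕ n) ≡ ℚᵘ.mkℚᵘ (+ n) 0
  toℚᵘ-fromℕ n = cong toℚᵘ (fromℕ≡mkℚ n)

  fromℕ-mono : ∀ {m n} → m ℕ.≤ n → fromℕ m ≤ fromℕ n
  fromℕ-mono {m} {n} m≤n = subst₂ _≤_ (sym (fromℕ≡mkℚ m)) (sym (fromℕ≡mkℚ n))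
    (*≤* (ℤₚ.*-monoʳ-≤-nonNeg (+ 1) (ℤ.+≤+ m≤n)))

  fromℕ-mono-< : ∀ {m n} → m ℕ.< n → fromℕ m < fromℕ n
  fromℕ-mono-< {m} {n} m<n = subst₂ _<_ (sym (fromℕ≡mkℚ m)) (sym (fromℕ≡mkℚ n))
    (*<* (ℤₚ.*-monoʳ-<-pos (+ 1) (ℤ.+<+ m<n)))

  fromℕ-suc : ∀ n → fromℕ (suc n) ≡ fromℕ n + 1ℚ
  fromℕ-suc n = toℚᵘ-injective (begin
    toℚᵘ (fromℕ (suc n))                 ≡⟨ toℚᵘ-fromℕ (suc n) ⟩
    ℚᵘ.mkℚᵘ (+ suc n) 0                  ≈⟨ ℚᵘ.*≡* (cong (ℤ._* + 1) (trans (cong +_ (ℕₚ.+-comm 1 n)) (cong₂ ℤ._+_ (sym (ℤₚ.*-identityʳ (+ n))) refl))) ⟩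
    ℚᵘ.mkℚᵘ (+ n) 0 ℚᵘ.+ toℚᵘ 1ℚ         ≡⟨ cong (ℚᵘ._+ toℚᵘ 1ℚ) (sym (toℚᵘ-fromℕ n)) ⟩
    toℚᵘ (fromℕ n) ℚᵘ.+ toℚᵘ 1ℚ          ≈⟨ toℚᵘ-homo-+ (fromℕ n) 1ℚ ⟨
    toℚᵘ (fromℕ n + 1ℚ)                  ∎)
    where open ℚᵘₚ.≃-Reasoning

  archimedean : ∀ q → ∃ λ n → q ≤ fromℕ n
  archimedean (mkℚ (+ n) d c) = n , subst (mkℚ (+ n) d c ≤_) (sym (fromℕ≡mkℚ n))
    (*≤* (ℤₚ.*-monoˡ-≤-nonNeg (+ n) (ℤ.+≤+ (ℕ.s≤s ℕ.z≤n))))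
  archimedean (mkℚ -[1+ n ] d c) = 0 , *≤* ℤ.-≤+

  cancel-inv : ∀ m d .{{_ : ℕ.NonZero d}} .{{_ : ℕ.NonZero (suc m ℕ.* d)}} →
    fromℕ (suc m) * (+ 1 / (suc m ℕ.* d)) ≡ + 1 / d
  cancel-inv m (suc d) = toℚᵘ-injective (begin
    toℚᵘ (fromℕ (suc m) * (+ 1 / (suc m ℕ.* suc d)))
      ≈⟨ toℚᵘ-homo-* (fromℕ (suc m)) (+ 1 / (suc m ℕ.* suc d)) ⟩
    toℚᵘ (fromℕ (suc m)) ℚᵘ.* toℚᵘ (+ 1 / (suc m ℕ.* suc d))
      ≈⟨ ℚᵘₚ.*-cong (toℚᵘ-fromℚᵘ (ℚᵘ.mkℚᵘ (+ suc m) 0)) (toℚᵘ-fromℚᵘ (ℚᵘ.mkℚᵘ (+ 1) (d ℕ.+ m ℕ.* suc d))) ⟩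
    ℚᵘ.mkℚᵘ (+ suc m) 0 ℚᵘ.* ℚᵘ.mkℚᵘ (+ 1) (d ℕ.+ m ℕ.* suc d)
      ≈⟨ ℚᵘ.*≡* (cong +_ (trans (cong (ℕ._* suc d) (ℕₚ.*-identityʳ (suc m)))
            (sym (trans (ℕₚ.*-identityˡ _) (ℕₚ.*-identityˡ _))))) ⟩
    ℚᵘ.mkℚᵘ (+ 1) d
      ≈⟨ toℚᵘ-fromℚᵘ (ℚᵘ.mkℚᵘ (+ 1) d) ⟨
    toℚᵘ (+ 1 / suc d) ∎)
    where open ℚᵘₚ.≃-Reasoning

  inv-nonNeg : ∀ n .{{_ : ℕ.NonZero n}} → NonNegative (+ 1 / n)
  inv-nonNeg n = normalize-nonNeg 1 n

  1/!-nonNeg : ∀ n → NonNegative 1/[ n ]!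
  1/!-nonNeg n = inv-nonNeg (n !) {{n ℕₚ.!≢0}}

  1/!-suc : ∀ n → fromℕ (suc n) * 1/[ suc n ]! ≡ 1/[ n ]!
  1/!-suc n = cancel-inv n (n !) {{n ℕₚ.!≢0}} {{suc n ℕₚ.!≢0}}

  module _ (q : ℚ) where

    D : ℕ → ℚ
    D n = ∣ expTerm q n ∣

    two : ℚ
    two = 1ℚ + 1ℚ

    D-halves : ∀ n → two * ∣ q ∣ ≤ fromℕ (suc n) → two * D (suc n) ≤ D n
    D-halves n h = begin
      two * D (suc n)                            ≡⟨ cong (two *_) (D-split (suc n)) ⟩
      two * (∣ q * q ^ n ∣ * c)                  ≡⟨ cong (λ z → two * (z * c)) (∣p*q∣≡∣p∣*∣q∣ q (q ^ n)) ⟩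
      two * (∣ q ∣ * ∣ q ^ n ∣ * c)              ≡⟨ solve 4 (λ t a b c → t :* (a :* b :* c) := (t :* a) :* (b :* c)) refl two (∣ q ∣) (∣ q ^ n ∣) c ⟩
      (two * ∣ q ∣) * (∣ q ^ n ∣ * c)            ≤⟨ *-monoʳ-≤-nonNeg (∣ q ^ n ∣ * c) {{nn}} h ⟩
      fromℕ (suc n) * (∣ q ^ n ∣ * c)            ≡⟨ solve 3 (λ a b c → a :* (b :* c) := b :* (a :* c)) refl (fromℕ (suc n)) (∣ q ^ n ∣) c ⟩
      ∣ q ^ n ∣ * (fromℕ (suc n) * c)            ≡⟨ cong (∣ q ^ n ∣ *_) (1/!-suc n) ⟩
      ∣ q ^ n ∣ * 1/[ n ]!                       ≡⟨ sym (D-split n) ⟩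
      D n                                        ∎
      where
      open ≤-Reasoning
      c = 1/[ suc n ]!
      nn : NonNegative (∣ q ^ n ∣ * c)
      nn = nonNeg*nonNeg⇒nonNeg ∣ q ^ n ∣ {{∣-∣-nonNeg (q ^ n)}} c {{1/!-nonNeg (suc n)}}
      D-split : ∀ m → D m ≡ ∣ q ^ m ∣ * 1/[ m ]!
      D-split m = trans (∣p*q∣≡∣p∣*∣q∣ (q ^ m) 1/[ m ]!)
        (cong (∣ q ^ m ∣ *_) (0≤p⇒∣p∣≡p (nonNegative⁻¹ 1/[ m ]! {{1/!-nonNeg m}})))

    N₀ : ℕ
    N₀ = proj₁ (archimedean (two * ∣ q ∣))

    halves : ∀ n → N₀ ℕ.≤ n → two * D (suc n) ≤ D n
    halves n N₀≤n = D-halves n (≤-trans (proj₂ (archimedean (two * ∣ q ∣)))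
      (fromℕ-mono (ℕₚ.m≤n⇒m≤1+n N₀≤n)))

    tail : ∀ n → N₀ ℕ.≤ n → ∀ k → ∣ expSum q (k ℕ.+ n) - expSum q n ∣ + two * D (k ℕ.+ n) ≤ two * D n
    tail n N₀≤n zero = ≤-reflexive (trans
      (cong (λ z → ∣ z ∣ + two * D n) (+-inverseʳ (expSum q n))) (+-identityˡ (two * D n)))
    tail n N₀≤n (suc k) = begin
      ∣ (a + t) - b ∣ + two * D (suc k ℕ.+ n)   ≡⟨ cong (λ z → ∣ z ∣ + two * D (suc k ℕ.+ n)) (solve 3 (λ a t b → (a :+ t) :- b := (a :- b) :+ t) refl a t b) ⟩
      ∣ (a - b) + t ∣ + two * D (suc k ℕ.+ n)   ≤⟨ +-mono-≤ (∣p+q∣≤∣p∣+∣q∣ (a - b) t) (halves (k ℕ.+ n) (ℕₚ.m≤n⇒m≤o+n k N₀≤n)) ⟩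
      ∣ a - b ∣ + d + d                         ≡⟨ solve 2 (λ x d → x :+ d :+ d := x :+ (con 1ℚ :+ con 1ℚ) :* d) refl (∣ a - b ∣) d ⟩
      ∣ a - b ∣ + two * d                       ≤⟨ tail n N₀≤n k ⟩
      two * D n                                 ∎
      where
      open ≤-Reasoning
      a = expSum q (k ℕ.+ n)
      b = expSum q n
      t = expTerm q (k ℕ.+ n)
      d = D (k ℕ.+ n)

    two*-nonNeg : ∀ n → 0ℚ ≤ two * D n
    two*-nonNeg n = subst (_≤ two * D n) (*-zeroʳ two) (*-monoˡ-≤-nonNeg two (0≤∣p∣ (expTerm q n)))

    tail′ : ∀ n → N₀ ℕ.≤ n → ∀ m → n ℕ.≤ m → ∣ expSum q m - expSum q n ∣ ≤ two * D n
    tail′ n N₀≤n m n≤m = subst (λ z → ∣ expSum q z - expSum q n ∣ ≤ two * D n) (ℕₚ.m∸n+n≡m n≤m)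
      (begin
        e                            ≡⟨ +-identityʳ e ⟨
        e + 0ℚ                       ≤⟨ +-monoʳ-≤ e (two*-nonNeg (k ℕ.+ n)) ⟩
        e + two * D (k ℕ.+ n)        ≤⟨ tail n N₀≤n k ⟩
        two * D n                    ∎)
      where
      open ≤-Reasoning
      k = m ℕ.∸ n
      e = ∣ expSum q (k ℕ.+ n) - expSum q n ∣

    decay : ∀ k → fromℕ (suc k) * D (k ℕ.+ N₀) ≤ D N₀
    decay zero    = ≤-reflexive (*-identityˡ (D N₀))
    decay (suc k) = begin
      fromℕ (suc (suc k)) * d′       ≡⟨ cong (_* d′) (fromℕ-suc (suc k)) ⟩
      (fromℕ (suc k) + 1ℚ) * d′      ≤⟨ *-monoʳ-≤-nonNeg d′ {{∣-∣-nonNeg (expTerm q (suc k ℕ.+ N₀))}}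
                                          (+-monoʳ-≤ (fromℕ (suc k)) (fromℕ-mono {1} {suc k} (ℕ.s≤s ℕ.z≤n))) ⟩
      (f + f) * d′                   ≡⟨ solve 2 (λ f d → (f :+ f) :* d := f :* ((con 1ℚ :+ con 1ℚ) :* d)) refl f d′ ⟩
      f * (two * d′)                 ≤⟨ *-monoˡ-≤-nonNeg f {{normalize-nonNeg (suc k) 1}} (halves (k ℕ.+ N₀) (ℕₚ.m≤n+m N₀ k)) ⟩
      f * D (k ℕ.+ N₀)               ≤⟨ decay k ⟩
      D N₀                           ∎
      where
      open ≤-Reasoning
      f  = fromℕ (suc k)
      d′ = D (suc k ℕ.+ N₀)

    D-small : ∀ δ → 0ℚ < δ → ∃ λ n → N₀ ℕ.≤ n × D n < δ
    D-small δ 0<δ = k ℕ.+ N₀ , ℕₚ.m≤n+m N₀ k ,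
        *-cancelˡ-<-nonNeg f {{normalize-nonNeg (suc k) 1}} (≤-<-trans (decay k) lt)
      where
      open ≤-Reasoning
      instance
        _ : NonZero δ
        _ = >-nonZero 0<δ
        _ : Positive δ
        _ = positive 0<δ
      k = proj₁ (archimedean (D N₀ * 1/ δ))
      k≥ : D N₀ * 1/ δ ≤ fromℕ k
      k≥ = proj₂ (archimedean (D N₀ * 1/ δ))
      f = fromℕ (suc k)
      lt : D N₀ < f * δ
      lt = begin-strict
        D N₀                   ≡⟨ *-identityʳ (D N₀) ⟨
        D N₀ * 1ℚ              ≡⟨ cong (D N₀ *_) (*-inverseˡ δ) ⟨
        D N₀ * (1/ δ * δ)      ≡⟨ *-assoc (D N₀) (1/ δ) δ ⟨
        D N₀ * 1/ δ * δ        <⟨ *-monoˡ-<-pos δ (≤-<-trans k≥ (fromℕ-mono-< (ℕₚ.n<1+n k))) ⟩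
        f * δ                  ∎

    expSum-cauchy : IsCauchy (expSum q)
    expSum-cauchy ε 0<ε = N , close
      where
      open ≤-Reasoning
      small-term = D-small (½ * (½ * ε)) (½-pos (½-pos 0<ε))
      N     = proj₁ small-term
      N₀≤N  = proj₁ (proj₂ small-term)
      small = proj₂ (proj₂ small-term)
      2D<½ε : two * D N < ½ * ε
      2D<½ε = begin-strict
        two * D N                          <⟨ *-monoʳ-<-pos two small ⟩
        two * (½ * (½ * ε))                ≡⟨ *-assoc two ½ (½ * ε) ⟨
        two * ½ * (½ * ε)                  ≡⟨ *-identityˡ (½ * ε) ⟩
        ½ * ε                              ∎
      close : ∀ m n → N ℕ.≤ m → N ℕ.≤ n → ∣ expSum q m - expSum q n ∣ < ε
      close m n N≤m N≤n = begin-strict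
        ∣ S m - S n ∣                      ≤⟨ triangle (S m) (S N) (S n) ⟩
        ∣ S m - S N ∣ + ∣ S N - S n ∣      ≡⟨ cong (λ z → ∣ S m - S N ∣ + z) (∣-∣-sym (S N) (S n)) ⟩
        ∣ S m - S N ∣ + ∣ S n - S N ∣      ≤⟨ +-mono-≤ (tail′ N N₀≤N m N≤m) (tail′ N N₀≤N n N≤n) ⟩
        two * D N + two * D N              <⟨ +-mono-< 2D<½ε 2D<½ε ⟩
        ½ * ε + ½ * ε                      ≡⟨ half+half ε ⟩
        ε                                  ∎
        where S = expSum q

exp : ℚ → ℝ
exp q = mkℝ (expSum q) (expSum-cauchy q)

infix 4 _IsFloorOf_

-- A relation, since ⌊x⌋ is not computable from a Cauchy sequence for x.
_IsFloorOf_ : ℕ → ℝ → Set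
N IsFloorOf x = ⟦ fromℕ N ⟧ ≤ᴿ x × x <ᴿ ⟦ fromℕ (suc N) ⟧

floor-nonZero : ∀ {x N} → ⟦ fromℕ 2 ⟧ ≤ᴿ x → N IsFloorOf x → ℕ.NonZero N
floor-nonZero {N = suc _} _ _ = _
floor-nonZero {x} {zero} 2≤x (_ , ε , 0<ε , M , x+ε≤1) = ⊥-elim (<-irrefl refl (begin-strict
  fromℕ 2              ≤⟨ proj₂ (2≤x 1ℚ (positive⁻¹ 1ℚ)) n (ℕₚ.m≤n⊔m M L) ⟩
  seq x n + 1ℚ         <⟨ +-monoˡ-< 1ℚ (subst (_< seq x n + ε) (+-identityʳ (seq x n)) (+-monoʳ-< (seq x n) 0<ε)) ⟩
  seq x n + ε + 1ℚ     ≤⟨ +-monoˡ-≤ 1ℚ (x+ε≤1 n (ℕₚ.m≤m⊔n M L)) ⟩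
  fromℕ 1 + 1ℚ         ≡⟨⟩
  fromℕ 2              ∎))
  where
  open ≤-Reasoning
  L = proj₁ (2≤x 1ℚ (positive⁻¹ 1ℚ))
  n = M ℕ.⊔ L

ℙ : (N : ℕ) .{{_ : ℕ.NonZero N}} {A : Pred ℕ 0ℓ} → Decidable A → ℚ
ℙ N A? = + length (filter A? (map suc (upTo N))) / N

record PrimeSet : Set where
  field
    elements : List ℕ
    unique   : Unique elements
    primes   : All Prime elements

open PrimeSet public

infix 4 _∈ₚ_

_∈ₚ_ : ℕ → PrimeSet → Set
p ∈ₚ T = p ∈ elements T

NonEmpty : PrimeSet → Set
NonEmpty T = ∃ λ p → p ∈ₚ T

Disjoint : PrimeSet → PrimeSet → Set
Disjoint S T = ∀ p → ¬ (p ∈ₚ S × p ∈ₚ T)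

ω : ℕ → PrimeSet → ℕ
ω n T = length (filter (_∣? n) (elements T))

sumℚ : List ℚ → ℚ
sumℚ = foldr _+_ 0ℚ

1/prime : ∀ {p} → Prime p → ℚ
1/prime {p} pr = (+ 1 / p) {{prime⇒nonZero pr}}

pred-nonZero : ∀ {p} → Prime p → ℕ.NonZero (p ℕ.∸ 1)
pred-nonZero {zero}        (prime {{()}} _)
pred-nonZero {suc zero}    (prime {{()}} _)
pred-nonZero {suc (suc _)} _ = _

1/[prime∸1] : ∀ {p} → Prime p → ℚ
1/[prime∸1] {p} pr = (+ 1 / (p ℕ.∸ 1)) {{pred-nonZero pr}}

H : PrimeSet → ℚ
H T = sumℚ (All.reduce 1/prime (primes T))

H′ : PrimeSet → ℚ
H′ T = sumℚ (All.reduce 1/[prime∸1] (primes T))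

H′-nonZero : ∀ T → NonEmpty T → NonZero (H′ T)
H′-nonZero T (_ , p∈T) = pos⇒nonZero (H′ T) {{go (primes T) p∈T}}
  where
  Σ-nonNeg : ∀ {ps} (prs : All Prime ps) → NonNegative (sumℚ (All.reduce 1/[prime∸1] prs))
  Σ-nonNeg []         = _
  Σ-nonNeg {p ∷ _} (pr ∷ prs) = nonNeg+nonNeg⇒nonNeg (1/[prime∸1] pr) {{inv-nonNeg (p ℕ.∸ 1) {{pred-nonZero pr}}}}
    (sumℚ (All.reduce 1/[prime∸1] prs)) {{Σ-nonNeg prs}}

  go : ∀ {p ps} (prs : All Prime ps) → p ∈ ps → Positive (sumℚ (All.reduce 1/[prime∸1] prs))
  go {ps = p ∷ _} (pr ∷ prs) _ = pos+nonNeg⇒pos (1/[prime∸1] pr) {{normalize-pos 1 (p ℕ.∸ 1) {{pred-nonZero pr}}}}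
    (sumℚ (All.reduce 1/[prime∸1] prs)) {{Σ-nonNeg prs}}

CoversPrimes≤ : ∀ {r} → ℝ → (Fin r → PrimeSet) → Set
CoversPrimes≤ x T = ∀ p → Prime p → ⟦ fromℕ p ⟧ ≤ᴿ x → ∃ λ j → p ∈ₚ T j

ω≡? : ∀ {r} (T : Fin r → PrimeSet) (k : Fin r → ℕ) → Decidable (λ n → ∀ j → ω n (T j) ≡ k j)
ω≡? T k n = Finₚ.all? (λ j → ω n (T j) ℕₚ.≟ k j)

{-# OPTIONS --safe #-}
module Submission where

-- Let L = log₂ N and A k = {n ≤ N : ω(n; Tⱼ) = kⱼ for all j}.  Since log n is the sum of log pᵃ over the
-- exact prime powers pᵃ ∥ n, writing n = m pᵃ and summing over n gives, by Chebyshev's bound,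
--   L |A k| ≪ N (η S(k) + Σⱼ S(k - eⱼ)),   S(k) = Σ_{m ∈ A k} 1/m,
-- because m has lost one prime of some Tⱼ, or a prime outside all of them (possible only if η = 1).
-- To replace Σ log n by L |A k|, the deficit L - log n is charged to the same decomposition: summed over
-- the multiples n ≤ N of m it is O(N/m).  Marking a prime of Tⱼ likewise gives kⱼ S(k) ≤ H′(Tⱼ) S(k - eⱼ),
-- hence S(k) ≤ S(0) ∏ⱼ H′(Tⱼ)^kⱼ / kⱼ!.
--
-- The Mertens-type bound S(0) ≪ L ∏_{p ∈ T} (1 - 1/p) follows from Chebyshev's bound by Rankin's trick:
-- for Q = ∏_{p ∈ T} (1 + 1/p) = Σ_d 1/d, over products d of distinct primes of T, one has
-- Σ_d (log d)/d ≤ Q Σ_p (log p)/p ≪ L Q, so d ≤ N^O(1) carries at least half of Q; and md determines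
-- m ∈ A 0 and d, so S(0) Q is at most twice a harmonic sum up to N^O(1).  Finally
-- exp(-H(T)) ≥ ∏_{p ∈ T} (1 - 1/p), and (1 + Σⱼ kⱼ/xⱼ) ∏ⱼ xⱼ^kⱼ ≤ ∏ⱼ (xⱼ + 1)^kⱼ yields the second bound.
--
-- Logarithms are replaced throughout by lg n = ⌈log₂ n⌉, which is subadditive on products.


open import Level using (0ℓ)
open import Algebra.Core using (Op₂)
open import Algebra.Structures using (IsCommutativeMonoid)
open import Data.Empty using (⊥-elim)
open import Data.List.Base using (List; []; _∷_; _++_; map; filter; length)
open import Data.List.Properties using (length-map; length-++; length-upTo; filter-accept; filter-reject; filter-none)
open import Data.List.Membership.Propositional using (_∈_; _∉_)
open import Data.List.Membership.Propositional.Properties using (∈-∃++; ∈-++⁺ˡ; ∈-++⁺ʳ; ∈-++⁻; ∈-map⁺; ∈-map⁻; ∈-filter⁺; ∈-filter⁻)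
open import Data.List.Relation.Unary.Any using (here; there)
open import Data.List.Relation.Unary.All as All using (All; []; _∷_)
import Data.List.Relation.Unary.AllPairs as AllPairs
open import Data.List.Relation.Unary.Unique.Propositional using (Unique)
import Data.List.Relation.Unary.Unique.Propositional.Properties as Unique
open import Data.Product.Base using (∃; _×_; _,_; proj₁; proj₂)
open import Data.Product.Properties using (,-injectiveʳ)
open import Data.Sum.Base using (_⊎_; inj₁; inj₂; [_,_]′)
open import Function.Base using (_∘_; const)
open import Relation.Binary.Core using (Rel)
open import Relation.Binary.Structures using (IsPreorder)
open import Relation.Binary.PropositionalEquality
open import Relation.Nullary using (¬_; ¬?; Dec; yes; no; contradiction)
open import Relation.Nullary.Decidable using (_×-dec_; toSum)
open import Relation.Unary using (Pred; Decidable)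

-- An exact power p^a is always removed whole, so that ω drops by exactly one; summing 1/p^a over
-- all a ≥ 1 then yields 1/(p - 1), which is why H′ and not H appears in the product. The number n =
-- 1 has no prime power to which its deficit could be charged. If η = 1, its cost lg N ≤ N is
-- absorbed into N S(k), because 1/n = 1 there. If some kⱼ ≥ 1, then 1 is not in A k. The one
-- remaining case, η = 0 and k = 0, is the case ξ = 1, where P ≤ 1 is enough. All estimates are made
-- over the naturals and rationals, with N in place of x. Real numbers enter only through
-- exp(-H(Tⱼ)), a limit of alternating partial sums. These can be compared with ∏ (1 - 1/p) by a
-- factor θ < 1; the choice θ = ½ doubles the constant, which becomes 2 · 27 · 144.

-- Lists of dependent pairs and finite sums

infixr 5 _⋉_

-- Double sums, such as those over n and the prime powers of n, become single sums over pairs, which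
-- `∑-transfer` can reindex.
_⋉_ : ∀ {X Y : Set} → List X → (X → List Y) → List (X × Y)
[]       ⋉ ys = []
(x ∷ xs) ⋉ ys = map (x ,_) (ys x) ++ (xs ⋉ ys)

module _ {X Y : Set} {ys : X → List Y} where

  ∈-⋉⁺ : ∀ {xs x y} → x ∈ xs → y ∈ ys x → (x , y) ∈ xs ⋉ ys
  ∈-⋉⁺ (here refl)               y∈ = ∈-++⁺ˡ (∈-map⁺ _ y∈)
  ∈-⋉⁺ {xs = x ∷ _} (there x∈)   y∈ = ∈-++⁺ʳ (map (x ,_) (ys x)) (∈-⋉⁺ x∈ y∈)

  ∈-⋉⁻ : ∀ xs {x y} → (x , y) ∈ xs ⋉ ys → x ∈ xs × y ∈ ys x
  ∈-⋉⁻ (x ∷ xs) xy∈ with ∈-++⁻ (map (x ,_) (ys x)) xy∈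
  ... | inj₁ in-row with ∈-map⁻ (x ,_) in-row
  ...   | _ , y∈ , refl = here refl , y∈
  ∈-⋉⁻ (x ∷ xs) xy∈ | inj₂ later with ∈-⋉⁻ xs later
  ...   | x∈ , y∈ = there x∈ , y∈

  ⋉-unique : ∀ {xs} → Unique xs → (∀ x → Unique (ys x)) → Unique (xs ⋉ ys)
  ⋉-unique AllPairs.[] uys = AllPairs.[]
  ⋉-unique {x ∷ xs} (x∉ AllPairs.∷ uxs) uys =
    Unique.++⁺ (Unique.map⁺ ,-injectiveʳ (uys x)) (⋉-unique uxs uys) disjoint
    where
    disjoint : ∀ {z} → ¬ (z ∈ map (x ,_) (ys x) × z ∈ xs ⋉ ys)
    disjoint (in-row , later) with ∈-map⁻ (x ,_) in-row
    ... | _ , _ , refl = All.lookup x∉ (proj₁ (∈-⋉⁻ xs later)) refl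

-- Instantiated twice: over ℕ for counts and logarithms, over ℚ for sums of reciprocals.
module OrderedSum
  {A : Set} (_+_ : Op₂ A) (0# : A) (_≤_ : Rel A 0ℓ)
  (isCommutativeMonoid : IsCommutativeMonoid _≡_ _+_ 0#)
  (≤-isPreorder : IsPreorder _≡_ _≤_)
  (+-mono-≤ : ∀ {a b c d} → a ≤ b → c ≤ d → (a + c) ≤ (b + d))
  where

  open IsCommutativeMonoid isCommutativeMonoid using (assoc; comm; identityˡ; identityʳ)
  open IsPreorder ≤-isPreorder using () renaming (refl to ≤-refl; reflexive to ≤-reflexive; trans to ≤-trans)

  ∑ : ∀ {X : Set} → List X → (X → A) → A
  ∑ []       f = 0#
  ∑ (x ∷ xs) f = f x + ∑ xs f

  module _ {X : Set} where

    ∑-mono : ∀ (xs : List X) {f g} → (∀ {x} → x ∈ xs → f x ≤ g x) → ∑ xs f ≤ ∑ xs g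
    ∑-mono []       f≤g = ≤-refl
    ∑-mono (x ∷ xs) f≤g = +-mono-≤ (f≤g (here refl)) (∑-mono xs (λ x∈ → f≤g (there x∈)))

    ∑-cong : ∀ (xs : List X) {f g} → (∀ x → f x ≡ g x) → ∑ xs f ≡ ∑ xs g
    ∑-cong []       f≡g = refl
    ∑-cong (x ∷ xs) f≡g = cong₂ _+_ (f≡g x) (∑-cong xs f≡g)

    ∑-nonNeg : ∀ (xs : List X) {f} → (∀ x → 0# ≤ f x) → 0# ≤ ∑ xs f
    ∑-nonNeg []       0≤f = ≤-refl
    ∑-nonNeg (x ∷ xs) 0≤f = ≤-trans (≤-reflexive (sym (identityˡ 0#))) (+-mono-≤ (0≤f x) (∑-nonNeg xs 0≤f))

    ∑-++ : ∀ (xs ys : List X) f → ∑ (xs ++ ys) f ≡ ∑ xs f + ∑ ys f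
    ∑-++ []       ys f = sym (identityˡ _)
    ∑-++ (x ∷ xs) ys f = trans (cong (f x +_) (∑-++ xs ys f)) (sym (assoc _ _ _))

    ∑-move : ∀ (xs ys : List X) x f → ∑ (xs ++ x ∷ ys) f ≡ f x + ∑ (xs ++ ys) f
    ∑-move []       ys x f = refl
    ∑-move (z ∷ xs) ys x f = begin
      f z + ∑ (xs ++ x ∷ ys) f     ≡⟨ cong (f z +_) (∑-move xs ys x f) ⟩
      f z + (f x + ∑ (xs ++ ys) f) ≡⟨ assoc _ _ _ ⟨
      (f z + f x) + ∑ (xs ++ ys) f ≡⟨ cong (_+ ∑ (xs ++ ys) f) (comm _ _) ⟩
      (f x + f z) + ∑ (xs ++ ys) f ≡⟨ assoc _ _ _ ⟩
      f x + (f z + ∑ (xs ++ ys) f) ∎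
      where open ≡-Reasoning

    ∑-+ : ∀ (xs : List X) f g → ∑ xs (λ x → f x + g x) ≡ ∑ xs f + ∑ xs g
    ∑-+ []       f g = sym (identityˡ 0#)
    ∑-+ (x ∷ xs) f g = begin
      (f x + g x) + ∑ xs (λ x → f x + g x)  ≡⟨ cong ((f x + g x) +_) (∑-+ xs f g) ⟩
      (f x + g x) + (∑ xs f + ∑ xs g)       ≡⟨ assoc _ _ _ ⟩
      f x + (g x + (∑ xs f + ∑ xs g))       ≡⟨ cong (f x +_) (assoc _ _ _) ⟨
      f x + ((g x + ∑ xs f) + ∑ xs g)       ≡⟨ cong (λ z → f x + (z + ∑ xs g)) (comm _ _) ⟩
      f x + ((∑ xs f + g x) + ∑ xs g)       ≡⟨ cong (f x +_) (assoc _ _ _) ⟩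
      f x + (∑ xs f + (g x + ∑ xs g))       ≡⟨ assoc _ _ _ ⟨
      (f x + ∑ xs f) + (g x + ∑ xs g)       ∎
      where open ≡-Reasoning

    ∑-filter-≤ : ∀ {P : Pred X 0ℓ} (P? : Decidable P) (xs : List X) {f} → (∀ x → 0# ≤ f x) → ∑ (filter P? xs) f ≤ ∑ xs f
    ∑-filter-≤ P? []       0≤f = ≤-refl
    ∑-filter-≤ P? (x ∷ xs) 0≤f with P? x
    ... | yes _ = +-mono-≤ ≤-refl (∑-filter-≤ P? xs 0≤f)
    ... | no  _ = ≤-trans (≤-reflexive (sym (identityˡ _))) (+-mono-≤ (0≤f x) (∑-filter-≤ P? xs 0≤f))

  ∑-map : ∀ {X Y : Set} (h : X → Y) xs f → ∑ (map h xs) f ≡ ∑ xs (λ x → f (h x))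
  ∑-map h []       f = refl
  ∑-map h (x ∷ xs) f = cong (f (h x) +_) (∑-map h xs f)

  ∑-⋉ : ∀ {X Y : Set} xs (ys : X → List Y) f → ∑ (xs ⋉ ys) f ≡ ∑ xs (λ x → ∑ (ys x) (λ y → f (x , y)))
  ∑-⋉ []       ys f = refl
  ∑-⋉ (x ∷ xs) ys f = trans (∑-++ (map (x ,_) (ys x)) (xs ⋉ ys) f)
    (cong₂ _+_ (∑-map (x ,_) (ys x) f) (∑-⋉ xs ys f))

  -- Comparison along an injection presented as a relation. Distinct elements of `xs` have distinct
  -- partners by `det`, so a partner can be cut out of `ys` once it is used; what remains of `ys` at
  -- the end contributes nonnegative terms.
  ∑-transfer : ∀ {X Y : Set} (R : X → Y → Set) {xs ys f g} → Unique xs →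
    (∀ y → 0# ≤ g y) →
    (∀ {x} → x ∈ xs → ∃ λ y → y ∈ ys × R x y × (f x ≤ g y)) →
    (∀ {x x′ y} → R x y → R x′ y → x ≡ x′) →
    ∑ xs f ≤ ∑ ys g
  ∑-transfer R {[]} {ys} AllPairs.[] 0≤g partner det = ∑-nonNeg ys 0≤g
  ∑-transfer R {x ∷ xs} {ys} {f} {g} (x∉ AllPairs.∷ uxs) 0≤g partner det with partner (here refl)
  ... | y , y∈ , Rxy , fx≤gy with ∈-∃++ y∈
  ...   | ys₁ , ys₂ , refl = ≤-trans
      (+-mono-≤ fx≤gy (∑-transfer R {xs} {ys₁ ++ ys₂} uxs 0≤g partner′ det))
      (≤-reflexive (sym (∑-move ys₁ ys₂ y g)))
    where
    partner′ : ∀ {x′} → x′ ∈ xs → ∃ λ z → z ∈ ys₁ ++ ys₂ × R x′ z × (f x′ ≤ g z)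
    partner′ {x′} x′∈ with partner (there x′∈)
    ... | z , z∈ , Rx′z , fx′≤gz = z , avoid (∈-++⁻ ys₁ z∈) , Rx′z , fx′≤gz
      where
      avoid : z ∈ ys₁ ⊎ z ∈ y ∷ ys₂ → z ∈ ys₁ ++ ys₂
      avoid (inj₁ z∈₁)         = ∈-++⁺ˡ z∈₁
      avoid (inj₂ (here refl)) = ⊥-elim (All.lookup x∉ x′∈ (det Rxy Rx′z))
      avoid (inj₂ (there z∈₂)) = ∈-++⁺ʳ ys₁ z∈₂

  ∑-⊆ : ∀ {X : Set} {xs ys : List X} {f} → Unique xs → (∀ x → 0# ≤ f x) →
    (∀ {x} → x ∈ xs → x ∈ ys) → ∑ xs f ≤ ∑ ys f
  ∑-⊆ uxs 0≤f xs⊆ys = ∑-transfer _≡_ uxs 0≤f (λ {x} x∈ → x , xs⊆ys x∈ , refl , ≤-refl)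
    (λ p q → trans p (sym q))

module Arithmetic where

  open import Data.Nat.Base
  open import Data.Nat.Properties
  open import Data.Nat.Combinatorics using (_C_; nCk≡n!/k![n-k]!; k>n⇒nCk≡0; nCk≡nC[n∸k]; nCn≡1; nCk+nC[k+1]≡[n+1]C[k+1])
  open import Data.Nat.Combinatorics.Specification using ([n∸k]!k!∣n!)
  open import Data.Nat.Divisibility
  open import Data.Nat.DivMod using (_/_; m/n*n≡m; m/n*n≤m; m*n/n≡m; /-monoˡ-≤)
  open import Data.Nat.Induction using (<-rec)
  open import Data.Nat.ListAction using (product)
  open import Data.Nat.Logarithm using (⌈log₂_⌉; ⌈log₂⌉-mono-≤; ⌈log₂⌈n/2⌉⌉≡⌈log₂n⌉∸1; ⌈log₂2^n⌉≡n)
  open import Data.Nat.Primality using (Prime; ¬prime[0]; ¬prime[1]; prime⇒nonZero; prime⇒nonTrivial; prime⇒irreducible; euclidsLemma)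
  open import Data.Nat.Primality.Factorisation using (factorise; factorisationHasAllPrimeFactors)
  open import Data.Nat.Tactic.RingSolver using (solve-∀)
  open import Data.List.Base using (upTo)
  open import Data.List.Membership.Propositional.Properties using (∈-upTo⁺; ∈-upTo⁻)
  open import Relation.Binary.Definitions using (tri<; tri≈; tri>)

  module ∑ℕ = OrderedSum _+_ 0 _≤_ +-0-isCommutativeMonoid ≤-isPreorder +-mono-≤
  open ∑ℕ

  -- The binary logarithm rounded up

  abstract

    lg : ℕ → ℕ
    lg n = ⌈log₂ n ⌉

    n≤2^lg : ∀ n → n ≤ 2 ^ lg n
    n≤2^lg = <-rec _ step
      where
      step : ∀ n → (∀ {m} → m < n → m ≤ 2 ^ ⌈log₂ m ⌉) → n ≤ 2 ^ ⌈log₂ n ⌉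
      step zero          _   = z≤n
      step (suc zero)    _   = ≤-refl
      step n@(suc (suc n-2)) rec = begin
        n                              ≡⟨ ⌊n/2⌋+⌈n/2⌉≡n n ⟨
        ⌊ n /2⌋ + ⌈ n /2⌉              ≤⟨ +-monoˡ-≤ ⌈ n /2⌉ (⌊n/2⌋≤⌈n/2⌉ n) ⟩
        ⌈ n /2⌉ + ⌈ n /2⌉              ≡⟨ cong (⌈ n /2⌉ +_) (+-identityʳ _) ⟨
        2 * ⌈ n /2⌉                    ≤⟨ *-monoʳ-≤ 2 (rec (⌈n/2⌉<n n-2)) ⟩
        2 ^ suc ⌈log₂ ⌈ n /2⌉ ⌉        ≡⟨ cong (λ e → 2 ^ suc e) (⌈log₂⌈n/2⌉⌉≡⌈log₂n⌉∸1 n) ⟩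
        2 ^ suc (⌈log₂ n ⌉ ∸ 1)        ≡⟨ cong (2 ^_) (m+[n∸m]≡n (⌈log₂⌉-mono-≤ {2} {n} (s≤s (s≤s z≤n)))) ⟩
        2 ^ ⌈log₂ n ⌉                  ∎
        where open ≤-Reasoning

    -- With `n≤2^lg` this says that `lg n` is the least i with n ≤ 2^i; every later fact about `lg`
    -- is derived from these two.
    lg-least : ∀ {n i} → n ≤ 2 ^ i → lg n ≤ i
    lg-least {n} {i} n≤2^i = subst (⌈log₂ n ⌉ ≤_) (⌈log₂2^n⌉≡n i) (⌈log₂⌉-mono-≤ n≤2^i)

  2^-cancel-≤ : ∀ {i j} → 2 ^ i ≤ 2 ^ j → i ≤ j
  2^-cancel-≤ {i} {j} p = subst (_≤ j) (⌈log₂2^n⌉≡n i) (subst (⌈log₂ 2 ^ i ⌉ ≤_) (⌈log₂2^n⌉≡n j) (⌈log₂⌉-mono-≤ p))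

  lg-mono : ∀ {m n} → m ≤ n → lg m ≤ lg n
  lg-mono {n = n} m≤n = lg-least (≤-trans m≤n (n≤2^lg n))

  lg-*-≤ : ∀ m n → lg (m * n) ≤ lg m + lg n
  lg-*-≤ m n = lg-least (begin
    m * n                  ≤⟨ *-mono-≤ (n≤2^lg m) (n≤2^lg n) ⟩
    2 ^ lg m * 2 ^ lg n    ≡⟨ ^-distribˡ-+-* 2 (lg m) (lg n) ⟨
    2 ^ (lg m + lg n)      ∎)
    where open ≤-Reasoning

  2^lg≤2n : ∀ n → 1 ≤ n → 2 ^ lg n ≤ 2 * n
  2^lg≤2n n 1≤n with lg n in eq
  ... | zero  = ≤-trans 1≤n (m≤m+n n _)
  ... | suc i = *-monoʳ-≤ 2 (<⇒≤ (≰⇒> (λ n≤2^i → <-irrefl eq (s≤s (lg-least n≤2^i)))))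

  n<2^n : ∀ n → n < 2 ^ n
  n<2^n zero    = s≤s z≤n
  n<2^n (suc n) = begin-strict
    suc n          ≤⟨ n<2^n n ⟩
    2 ^ n          <⟨ m<m+n (2 ^ n) (m^n>0 2 n) ⟩
    2 ^ n + 2 ^ n  ≡⟨ cong (2 ^ n +_) (+-identityʳ _) ⟨
    2 ^ suc n      ∎
    where open ≤-Reasoning

  lg≤n : ∀ n → lg n ≤ n
  lg≤n n = lg-least (<⇒≤ (n<2^n n))

  1≤lg : ∀ {n} → 2 ≤ n → 1 ≤ lg n
  1≤lg {n} 2≤n with lg n in eq
  ... | zero  = contradiction (≤-trans 2≤n (subst (λ i → n ≤ 2 ^ i) eq (n≤2^lg n))) λ { (s≤s ()) }
  ... | suc _ = s≤s z≤n

  [1⋯_] : ℕ → List ℕ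
  [1⋯ n ] = map suc (upTo n)

  ∈-[1⋯]⁺ : ∀ {n i} → 1 ≤ i → i ≤ n → i ∈ [1⋯ n ]
  ∈-[1⋯]⁺ {i = suc i} _ i<n = ∈-map⁺ suc (∈-upTo⁺ i<n)

  ∈-[1⋯]⁻ : ∀ {n i} → i ∈ [1⋯ n ] → 1 ≤ i × i ≤ n
  ∈-[1⋯]⁻ i∈ with ∈-map⁻ suc i∈
  ... | _ , j∈ , refl = s≤s z≤n , ∈-upTo⁻ j∈

  [1⋯]-unique : ∀ n → Unique [1⋯ n ]
  [1⋯]-unique n = Unique.map⁺ suc-injective (Unique.upTo⁺ n)

  length-[1⋯] : ∀ n → length [1⋯ n ] ≡ n
  length-[1⋯] n = trans (length-map suc (upTo n)) (length-upTo n)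

  ∑-const : ∀ {X : Set} (xs : List X) c → ∑ xs (const c) ≡ length xs * c
  ∑-const []       c = refl
  ∑-const (x ∷ xs) c = cong (c +_) (∑-const xs c)

  length≡∑ : ∀ {X : Set} (xs : List X) → length xs ≡ ∑ xs (const 1)
  length≡∑ xs = sym (trans (∑-const xs 1) (*-identityʳ _))

  module _ {X : Set} where

    length-transfer : ∀ {Y : Set} (R : X → Y → Set) {xs ys} → Unique xs →
      (∀ {x} → x ∈ xs → ∃ λ y → y ∈ ys × R x y) →
      (∀ {x x′ y} → R x y → R x′ y → x ≡ x′) →
      length xs ≤ length ys
    length-transfer R {xs} {ys} uxs partner det = subst₂ _≤_ (sym (length≡∑ xs))
      (sym (length≡∑ ys))
      (∑-transfer R uxs (λ _ → z≤n)
        (λ x∈ → let y , y∈ , Rxy = partner x∈ in y , y∈ , Rxy , ≤-refl) det)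

    length-⊆ : ∀ {xs ys : List X} → Unique xs → (∀ {x} → x ∈ xs → x ∈ ys) → length xs ≤ length ys
    length-⊆ uxs xs⊆ys = length-transfer _≡_ uxs (λ {x} x∈ → x , xs⊆ys x∈ , refl) (λ p q → trans p (sym q))

    length-filter-∁ : ∀ {P : Pred X 0ℓ} (P? : Decidable P) xs →
      length xs ≡ length (filter P? xs) + length (filter (¬? ∘ P?) xs)
    length-filter-∁ P? []       = refl
    length-filter-∁ P? (x ∷ xs) with P? x
    ... | yes _ = cong suc (length-filter-∁ P? xs)
    ... | no  _ = trans (cong suc (length-filter-∁ P? xs)) (sym (+-suc _ _))

  length-bounded : ∀ {xs n} → Unique xs → (∀ {x} → x ∈ xs → 1 ≤ x × x ≤ n) → length xs ≤ n
  length-bounded {xs} {n} uxs bounds = subst (length xs ≤_) (length-[1⋯] n)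
    (length-⊆ uxs (λ x∈ → ∈-[1⋯]⁺ (proj₁ (bounds x∈)) (proj₂ (bounds x∈))))

  -- Chebyshev's upper bound

  prime⇒1< : ∀ {p} → Prime p → 1 < p
  prime⇒1< {zero}        pr = contradiction pr ¬prime[0]
  prime⇒1< {suc zero}    pr = contradiction pr ¬prime[1]
  prime⇒1< {suc (suc _)} _  = s≤s (s≤s z≤n)

  prime∣prime⇒≡ : ∀ {p q} → Prime p → Prime q → p ∣ q → p ≡ q
  prime∣prime⇒≡ pr qr p∣q with prime⇒irreducible qr p∣q
  ... | inj₁ refl = contradiction pr ¬prime[1]
  ... | inj₂ p≡q  = p≡q

  nCk≤2^n : ∀ n k → n C k ≤ 2 ^ n
  nCk≤2^n n       zero    = ≤-trans (≤-reflexive (trans (nCk≡nC[n∸k] {0} {n} z≤n) (nCn≡1 n))) (m^n>0 2 n)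
  nCk≤2^n zero    (suc k) = ≤-trans (≤-reflexive (k>n⇒nCk≡0 {0} {suc k} (s≤s z≤n))) z≤n
  nCk≤2^n (suc n) (suc k) = begin
    suc n C suc k            ≡⟨ nCk+nC[k+1]≡[n+1]C[k+1] n k ⟨
    n C k + n C suc k        ≤⟨ +-mono-≤ (nCk≤2^n n k) (nCk≤2^n n (suc k)) ⟩
    2 ^ n + 2 ^ n            ≡⟨ cong (2 ^ n +_) (+-identityʳ _) ⟨
    2 ^ suc n                ∎
    where open ≤-Reasoning

  [2n]!≡[2n]Cn*n!*n! : ∀ n → (n + n) ! ≡ ((n + n) C n) * (n ! * n !)
  [2n]!≡[2n]Cn*n!*n! n = sym (trans (cong (_* (n ! * n !)) C≡) (m/n*n≡m d∣))
    where
    instance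
      _ : NonZero (n ! * n !)
      _ = n !* n !≢0
    n+n∸n≡n : (n + n) ∸ n ≡ n
    n+n∸n≡n = m+n∸n≡m n n
    C≡ : (n + n) C n ≡ (n + n) ! / (n ! * n !)
    C≡ = trans (nCk≡n!/k![n-k]! (m≤m+n n n)) (helper n+n∸n≡n)
      where
      helper : ∀ {k} → k ≡ n → ((n + n) ! / (n ! * k !)) {{n !* k !≢0}} ≡ (n + n) ! / (n ! * n !)
      helper refl = refl
    d∣ : n ! * n ! ∣ (n + n) !
    d∣ = subst (λ k → k ! * n ! ∣ (n + n) !) n+n∸n≡n ([n∸k]!k!∣n! (m≤m+n n n))

  prime∣n!⇒≤ : ∀ {p} n → Prime p → p ∣ n ! → p ≤ n
  prime∣n!⇒≤ zero    pr p∣1 = ≤-trans (∣⇒≤ p∣1) (contradiction (subst Prime (∣1⇒≡1 p∣1) pr) ¬prime[1])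
  prime∣n!⇒≤ (suc n) pr p∣ with euclidsLemma (suc n) (n !) pr p∣
  ... | inj₁ p∣sn = ∣⇒≤ p∣sn
  ... | inj₂ p∣n! = m≤n⇒m≤1+n (prime∣n!⇒≤ n pr p∣n!)

  p∣p! : ∀ {p} → Prime p → p ∣ p !
  p∣p! {zero}  pr = contradiction pr ¬prime[0]
  p∣p! {suc p} _  = m∣m*n (p !)

  -- Such a p divides (2n)! = C(2n, n) · n! · n! but exceeds n, so it cannot divide n!.
  prime∣[2n]Cn : ∀ {p} n → Prime p → n < p → p ≤ n + n → p ∣ (n + n) C n
  prime∣[2n]Cn {p} n pr n<p p≤2n
    with euclidsLemma ((n + n) C n) (n ! * n !) pr
           (subst (p ∣_) ([2n]!≡[2n]Cn*n!*n! n) (∣-trans (p∣p! pr) (m≤n⇒m!∣n! p≤2n)))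
  ... | inj₁ p∣C = p∣C
  ... | inj₂ p∣n!n! with euclidsLemma (n !) (n !) pr p∣n!n!
  ...   | inj₁ p∣n! = contradiction (prime∣n!⇒≤ n pr p∣n!) (<⇒≱ n<p)
  ...   | inj₂ p∣n! = contradiction (prime∣n!⇒≤ n pr p∣n!) (<⇒≱ n<p)

  product-∣ : ∀ {ps M} → Unique ps → All Prime ps → (∀ {p} → p ∈ ps → p ∣ M) → product ps ∣ M
  product-∣ {[]}     _ _ _ = 1∣ _
  product-∣ {p ∷ ps} {M} (p∉ AllPairs.∷ ups) (pr ∷ prs) ps∣M
    with product-∣ ups prs (λ q∈ → ps∣M (there q∈))
  ... | divides c M≡c*Π with euclidsLemma c (product ps) pr (subst (p ∣_) M≡c*Π (ps∣M (here refl)))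
  ...   | inj₁ p∣c = subst (p * product ps ∣_) (sym M≡c*Π) (*-monoˡ-∣ (product ps) p∣c)
  ...   | inj₂ p∣Π = contradiction refl (All.lookup p∉ (factorisationHasAllPrimeFactors pr p∣Π prs))

  ^-length≤product : ∀ {n} ps → (∀ {p} → p ∈ ps → n ≤ p) → n ^ length ps ≤ product ps
  ^-length≤product []       _    = ≤-refl
  ^-length≤product (p ∷ ps) n≤ps = *-mono-≤ (n≤ps (here refl)) (^-length≤product ps (λ p∈ → n≤ps (there p∈)))

  -- With n = 2^i, n^(number of primes) ≤ product of the primes ≤ C(2n, n) ≤ 2^(2n); comparing
  -- exponents of 2 gives the claim.
  chebyshev-block : ∀ i {ps} → Unique ps → All Prime ps →
    (∀ {p} → p ∈ ps → 2 ^ i < p × p ≤ 2 ^ i + 2 ^ i) → i * length ps ≤ 2 ^ i + 2 ^ i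
  chebyshev-block i {ps} ups prs range = 2^-cancel-≤ (begin
    2 ^ (i * length ps)     ≡⟨ ^-*-assoc 2 i (length ps) ⟨
    n ^ length ps           ≤⟨ ^-length≤product ps (λ p∈ → <⇒≤ (proj₁ (range p∈))) ⟩
    product ps              ≤⟨ ∣⇒≤ (product-∣ ups prs divide) ⟩
    (n + n) C n             ≤⟨ nCk≤2^n (n + n) n ⟩
    2 ^ (n + n)             ∎)
    where
    open ≤-Reasoning
    n = 2 ^ i
    divide : ∀ {p} → p ∈ ps → p ∣ (n + n) C n
    divide p∈ = prime∣[2n]Cn n (All.lookup prs p∈) (proj₁ (range p∈)) (proj₂ (range p∈))
    instance
      C≢0 : NonZero ((n + n) C n)
      C≢0 = ≢-nonZero λ C≡0 → ≢-nonZero⁻¹ ((n + n) !) {{(n + n) !≢0}}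
        (trans ([2n]!≡[2n]Cn*n!*n! n) (cong (_* (n ! * n !)) C≡0))

  All-filter : ∀ {X : Set} {P Q : Pred X 0ℓ} (Q? : Decidable Q) {xs} → All P xs → All P (filter Q? xs)
  All-filter Q? all = All.tabulate (λ x∈ → All.lookup all (proj₁ (∈-filter⁻ Q? x∈)))

  -- For i ≤ 4 counting all integers up to 2^i suffices. Beyond that the primes are split at half
  -- the range; the inequality for `suc i` is multiplied by i so that the induction hypothesis (4x)
  -- and the block bound (2x) both apply, and 6 (i + 1) ≤ 8 i closes the induction.
  chebyshev : ∀ i {ps} → Unique ps → All Prime ps → (∀ {p} → p ∈ ps → p ≤ 2 ^ i) → i * length ps ≤ 4 * 2 ^ i
  chebyshev i {ps} ups prs bound with i ≤? 4
  ... | yes i≤4 = *-mono-≤ i≤4 (length-bounded ups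
    (λ p∈ → <⇒≤ (prime⇒1< (All.lookup prs p∈)) , bound p∈))
  chebyshev zero    ups prs bound | no i≰4 = contradiction z≤n i≰4
  chebyshev (suc i) {ps} ups prs bound | no i≰4 = *-cancelˡ-≤ i {{>-nonZero (≤-trans (s≤s z≤n) 4≤i)}} (begin
    i * (suc i * length ps)                     ≡⟨ cong (λ l → i * (suc i * l)) (length-filter-∁ small? ps) ⟩
    i * (suc i * (length lo + length hi))       ≡⟨ rearrange i (length lo) (length hi) ⟩
    suc i * (i * length lo + i * length hi)     ≤⟨ *-monoʳ-≤ (suc i) (+-mono-≤
        (chebyshev i (Unique.filter⁺ small? ups) (All-filter small? prs) (λ p∈ → proj₂ (∈-filter⁻ small? {xs = ps} p∈)))
        (chebyshev-block i (Unique.filter⁺ large? ups) (All-filter large? prs) hi-range)) ⟩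
    suc i * (4 * x + (x + x))                   ≡⟨ collect i x ⟩
    (6 * i + 6) * x                             ≤⟨ *-monoˡ-≤ x six ⟩
    (i * 8) * x                                 ≡⟨ final i x ⟩
    i * (4 * 2 ^ suc i)                         ∎)
    where
    open ≤-Reasoning
    x = 2 ^ i
    4≤i : 4 ≤ i
    4≤i = s≤s⁻¹ (≰⇒> i≰4)
    small? = λ p → p ≤? x
    large? = ¬? ∘ small?
    lo = filter small? ps
    hi = filter large? ps
    hi-range : ∀ {p} → p ∈ hi → x < p × p ≤ x + x
    hi-range p∈ = let p∈ps , p≰x = ∈-filter⁻ large? {xs = ps} p∈ in
      ≰⇒> p≰x , ≤-trans (bound p∈ps) (≤-reflexive (cong (x +_) (+-identityʳ x)))
    rearrange : ∀ i a b → i * (suc i * (a + b)) ≡ suc i * (i * a + i * b)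
    rearrange = solve-∀
    collect : ∀ i x → suc i * (4 * x + (x + x)) ≡ (6 * i + 6) * x
    collect = solve-∀
    final : ∀ i x → (i * 8) * x ≡ i * (4 * (2 * x))
    final = solve-∀
    six : 6 * i + 6 ≤ i * 8
    six = begin
      6 * i + 6       ≤⟨ +-monoʳ-≤ (6 * i) (*-monoʳ-≤ 2 {3} {i} (≤-trans (s≤s (s≤s (s≤s z≤n))) 4≤i)) ⟩
      6 * i + 2 * i   ≡⟨ eight i ⟩
      i * 8           ∎
      where
      eight : ∀ i → 6 * i + 2 * i ≡ i * 8
      eight = solve-∀

  -- Prime powers

  pow : ℕ × ℕ → ℕ
  pow (p , a) = p ^ a

  -- The cap on the exponent only keeps the list finite: since a < p^a, a cap M ≥ n loses no prime
  -- power up to n.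
  primePowers : List ℕ → ℕ → List (ℕ × ℕ)
  primePowers ps M = ps ⋉ (λ _ → [1⋯ M ])

  primePowers-unique : ∀ {ps} M → Unique ps → Unique (primePowers ps M)
  primePowers-unique M ups = ⋉-unique ups (λ _ → [1⋯]-unique M)

  prime∣^⇒∣ : ∀ {p} q a → Prime p → p ∣ q ^ a → p ∣ q
  prime∣^⇒∣ q zero    pr p∣1 = contradiction (subst Prime (∣1⇒≡1 p∣1) pr) ¬prime[1]
  prime∣^⇒∣ q (suc a) pr p∣ with euclidsLemma q (q ^ a) pr p∣
  ... | inj₁ p∣q   = p∣q
  ... | inj₂ p∣q^a = prime∣^⇒∣ q a pr p∣q^a

  ^-injectiveʳ : ∀ {p} a b → 1 < p → p ^ a ≡ p ^ b → a ≡ b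
  ^-injectiveʳ {p} a b 1<p eq with <-cmp a b
  ... | tri< a<b _ _ = contradiction eq (<⇒≢ (^-monoʳ-< p 1<p a<b))
  ... | tri≈ _ a≡b _ = a≡b
  ... | tri> _ _ b<a = contradiction (sym eq) (<⇒≢ (^-monoʳ-< p 1<p b<a))

  p∣p^a : ∀ {p a} → 1 ≤ a → p ∣ p ^ a
  p∣p^a {p} {suc a} _ = m∣m*n (p ^ a)

  pow-injective : ∀ {p a q b} → Prime p → Prime q → 1 ≤ a → p ^ a ≡ q ^ b → (p , a) ≡ (q , b)
  pow-injective {p} {a} {q} {b} pr qr 1≤a eq
    with prime∣prime⇒≡ pr qr (prime∣^⇒∣ q b pr (subst (p ∣_) eq (p∣p^a 1≤a)))
  ... | refl = cong (p ,_) (^-injectiveʳ a b (prime⇒1< pr) eq)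

  1≤p^a : ∀ {p} a → Prime p → 1 ≤ p ^ a
  1≤p^a {p} a pr = m^n>0 p {{prime⇒nonZero pr}} a

  a<p^a : ∀ {p} a → Prime p → a < p ^ a
  a<p^a a pr = <-≤-trans (n<2^n a) (^-monoˡ-≤ a (prime⇒1< pr))

  -- Taken at h = ⌊i/2⌋, it gives i² ≤ 8 · 2^⌊i/2⌋, which makes the prime powers with exponent at
  -- least 2 as cheap as the primes.
  square≤8*2^ : ∀ h → (1 + h + h) * (1 + h + h) ≤ 8 * 2 ^ h
  square≤8*2^ 0 = s≤s z≤n
  square≤8*2^ 1 = m≤m+n 9 7
  square≤8*2^ 2 = m≤m+n 25 7
  square≤8*2^ (suc (suc (suc h))) = begin
    (4 + h + (3 + h)) * (4 + h + (3 + h))                          ≤⟨ m≤m+n _ (1 + 12 * h + 4 * (h * h)) ⟩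
    (4 + h + (3 + h)) * (4 + h + (3 + h)) + (1 + 12 * h + 4 * (h * h)) ≡⟨ expand h ⟩
    2 * ((3 + h + (2 + h)) * (3 + h + (2 + h)))                    ≤⟨ *-monoʳ-≤ 2 (square≤8*2^ (suc (suc h))) ⟩
    2 * (8 * 2 ^ suc (suc h))                                      ≡⟨ swap (2 ^ suc (suc h)) ⟩
    8 * (2 * 2 ^ suc (suc h))                                      ∎
    where
    open ≤-Reasoning
    expand : ∀ h → (4 + h + (3 + h)) * (4 + h + (3 + h)) + (1 + 12 * h + 4 * (h * h)) ≡
                   2 * ((3 + h + (2 + h)) * (3 + h + (2 + h)))
    expand = solve-∀
    swap : ∀ x → 2 * (8 * x) ≡ 8 * (2 * x)
    swap = solve-∀

  n≤1+2⌊n/2⌋ : ∀ n → n ≤ 1 + ⌊ n /2⌋ + ⌊ n /2⌋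
  n≤1+2⌊n/2⌋ zero          = z≤n
  n≤1+2⌊n/2⌋ (suc zero)    = ≤-refl
  n≤1+2⌊n/2⌋ (suc (suc n)) = ≤-trans (s≤s (s≤s (n≤1+2⌊n/2⌋ n))) (≤-reflexive (cong (2 +_) (sym (+-suc ⌊ n /2⌋ ⌊ n /2⌋))))

  length-⋉ : ∀ {X Y : Set} xs (ys : List Y) → length (xs ⋉ (λ (_ : X) → ys)) ≡ length xs * length ys
  length-⋉ xs ys = begin
    length (xs ⋉ λ _ → ys)                ≡⟨ length≡∑ (xs ⋉ λ _ → ys) ⟩
    ∑ (xs ⋉ λ _ → ys) (const 1)           ≡⟨ ∑-⋉ xs (λ _ → ys) (const 1) ⟩
    ∑ xs (λ _ → ∑ ys (const 1))           ≡⟨ ∑-const xs _ ⟩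
    length xs * ∑ ys (const 1)            ≡⟨ cong (length xs *_) (length≡∑ ys) ⟨
    length xs * length ys                 ∎
    where open ≡-Reasoning

  square-cancel-≤ : ∀ {m n} → m * m ≤ n * n → m ≤ n
  square-cancel-≤ {m} {n} m²≤n² with m ≤? n
  ... | yes m≤n = m≤n
  ... | no  m≰n = contradiction (*-mono-< (≰⇒> m≰n) (≰⇒> m≰n)) (≤⇒≯ m²≤n²)

  module _ {ps : List ℕ} (ups : Unique ps) (prs : All Prime ps) (M : ℕ) where

    -- Besides the primes themselves only O(i 2^(i/2)) pairs (p , a) have a ≥ 2.
    primePowers-count : ∀ i → i * length (filter (λ z → pow z ≤? 2 ^ i) (primePowers ps M)) ≤ 12 * 2 ^ i
    primePowers-count i = begin
      i * length Q                                         ≤⟨ *-monoʳ-≤ i (length-⊆ (Unique.filter⁺ ≤X? (primePowers-unique M ups)) Q⊆) ⟩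
      i * length (map (_, 1) ps′ ++ ([1⋯ 2 ^ ⌈ i /2⌉ ] ⋉ λ _ → [1⋯ i ]))
        ≡⟨ cong (i *_) (trans (length-++ (map (_, 1) ps′)) (cong₂ _+_ (length-map (_, 1) ps′)
             (trans (length-⋉ [1⋯ 2 ^ ⌈ i /2⌉ ] [1⋯ i ]) (cong₂ _*_ (length-[1⋯] (2 ^ ⌈ i /2⌉)) (length-[1⋯] i))))) ⟩
      i * (length ps′ + 2 ^ ⌈ i /2⌉ * i)                   ≡⟨ distribute i (length ps′) (2 ^ ⌈ i /2⌉) ⟩
      i * length ps′ + (i * i) * 2 ^ ⌈ i /2⌉               ≤⟨ +-mono-≤
        (chebyshev i (Unique.filter⁺ p≤X? ups) (All-filter p≤X? prs) (λ p∈ → proj₂ (∈-filter⁻ p≤X? {xs = ps} p∈)))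
        (*-monoˡ-≤ (2 ^ ⌈ i /2⌉) (≤-trans (*-mono-≤ (n≤1+2⌊n/2⌋ i) (n≤1+2⌊n/2⌋ i)) (square≤8*2^ ⌊ i /2⌋))) ⟩
      4 * 2 ^ i + 8 * 2 ^ ⌊ i /2⌋ * 2 ^ ⌈ i /2⌉            ≡⟨ cong (4 * 2 ^ i +_) (trans (*-assoc 8 (2 ^ ⌊ i /2⌋) (2 ^ ⌈ i /2⌉))
        (cong (8 *_) (trans (sym (^-distribˡ-+-* 2 ⌊ i /2⌋ ⌈ i /2⌉)) (cong (2 ^_) (⌊n/2⌋+⌈n/2⌉≡n i))))) ⟩
      4 * 2 ^ i + 8 * 2 ^ i                                ≡⟨ *-distribʳ-+ (2 ^ i) 4 8 ⟨
      12 * 2 ^ i                                           ∎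
      where
      open ≤-Reasoning
      ≤X? : Decidable (λ z → pow z ≤ 2 ^ i)
      ≤X? z = pow z ≤? 2 ^ i
      p≤X? : Decidable (_≤ 2 ^ i)
      p≤X? p = p ≤? 2 ^ i
      Q   = filter ≤X? (primePowers ps M)
      ps′ = filter p≤X? ps
      distribute : ∀ i l x → i * (l + x * i) ≡ i * l + (i * i) * x
      distribute = solve-∀
      -- For a ≥ 2, p² ≤ p^a ≤ 2^i bounds p by 2^⌈i/2⌉, and 2^a ≤ p^a bounds a by i.
      Q⊆ : ∀ {z} → z ∈ Q → z ∈ map (_, 1) ps′ ++ ([1⋯ 2 ^ ⌈ i /2⌉ ] ⋉ λ _ → [1⋯ i ])
      Q⊆ {p , a} z∈ with ∈-filter⁻ ≤X? {xs = primePowers ps M} z∈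
      ... | z∈pp , p^a≤X with ∈-⋉⁻ ps z∈pp
      ...   | p∈ , a∈ with a | ∈-[1⋯]⁻ a∈
      ...     | suc zero | _ = ∈-++⁺ˡ (∈-map⁺ (_, 1) (∈-filter⁺ p≤X? p∈ (subst (_≤ 2 ^ i) (*-identityʳ p) p^a≤X)))
      ...     | a@(suc (suc b)) | _ = ∈-++⁺ʳ (map (_, 1) ps′) (∈-⋉⁺ {ys = λ _ → [1⋯ i ]} {xs = [1⋯ 2 ^ h ]}
                  (∈-[1⋯]⁺ {2 ^ h} (<⇒≤ (prime⇒1< pr)) (square-cancel-≤ p²≤))
                  (∈-[1⋯]⁺ {i} (s≤s z≤n) (2^-cancel-≤ (≤-trans (^-monoˡ-≤ a (prime⇒1< pr)) p^a≤X))))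
        where
        pr = All.lookup prs p∈
        h = ⌈ i /2⌉
        p²≤ : p * p ≤ 2 ^ h * 2 ^ h
        p²≤ = begin
          p * p              ≤⟨ *-monoʳ-≤ p (m≤m*n p (p ^ b) {{>-nonZero (1≤p^a b pr)}}) ⟩
          p ^ a              ≤⟨ p^a≤X ⟩
          2 ^ i              ≤⟨ ^-monoʳ-≤ 2 (≤-trans (≤-reflexive (sym (⌊n/2⌋+⌈n/2⌉≡n i))) (+-monoˡ-≤ h (⌊n/2⌋≤⌈n/2⌉ i))) ⟩
          2 ^ (h + h)        ≡⟨ ^-distribˡ-+-* 2 h h ⟩
          2 ^ h * 2 ^ h      ∎

  m*n≤o⇒n≤o/m : ∀ m .{{_ : NonZero m}} {n o} → m * n ≤ o → n ≤ o / m
  m*n≤o⇒n≤o/m m {n} {o} mn≤o = begin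
    n            ≡⟨ m*n/n≡m n m ⟨
    n * m / m    ≤⟨ /-monoˡ-≤ m (≤-trans (≤-reflexive (*-comm n m)) mn≤o) ⟩
    o / m        ∎
    where open ≤-Reasoning

  -- L ∸ lg (m q) is the number of i < L with m q ≤ 2 ^ i, and each such i admits at most
  -- 2 ^ i / m values of q.
  ∑-∸lg : ∀ {qs} → Unique qs → (∀ {q} → q ∈ qs → 1 ≤ q) → ∀ m → 1 ≤ m → ∀ L →
    m * ∑ qs (λ q → L ∸ lg (m * q)) ≤ 2 ^ L
  ∑-∸lg {qs} uqs 1≤qs m@(suc _) _ zero = ≤-trans (≤-reflexive
    (trans (cong (m *_) (trans (∑-cong qs (λ q → 0∸n≡0 (lg (m * q)))) (trans (∑-const qs 0) (*-zeroʳ (length qs))))) (*-zeroʳ m))) z≤n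
  ∑-∸lg {qs} uqs 1≤qs m@(suc _) 1≤m (suc L) = begin
    m * ∑ qs (λ q → suc L ∸ lg (m * q))                                ≤⟨ *-monoʳ-≤ m (grow qs) ⟩
    m * (∑ qs (λ q → L ∸ lg (m * q)) + length (filter ≤X? qs))         ≡⟨ *-distribˡ-+ m (∑ qs (λ q → L ∸ lg (m * q))) (length (filter ≤X? qs)) ⟩
    m * ∑ qs (λ q → L ∸ lg (m * q)) + m * length (filter ≤X? qs)       ≤⟨ +-mono-≤ (∑-∸lg uqs 1≤qs m 1≤m L) count ⟩
    2 ^ L + 2 ^ L                                                      ≡⟨ cong (2 ^ L +_) (+-identityʳ _) ⟨
    2 ^ suc L                                                          ∎
    where
    open ≤-Reasoning
    ≤X? : Decidable (λ q → m * q ≤ 2 ^ L)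
    ≤X? q = m * q ≤? 2 ^ L
    grow : ∀ xs → ∑ xs (λ q → suc L ∸ lg (m * q)) ≤ ∑ xs (λ q → L ∸ lg (m * q)) + length (filter ≤X? xs)
    grow [] = z≤n
    grow (q ∷ xs) = [ accept , reject ]′ (toSum (≤X? q))
      where
      g  = λ q → L ∸ lg (m * q)
      g′ = λ q → suc L ∸ lg (m * q)
      c  = length (filter ≤X? xs)
      accept : m * q ≤ 2 ^ L → ∑ (q ∷ xs) g′ ≤ ∑ (q ∷ xs) g + length (filter ≤X? (q ∷ xs))
      accept mq≤X = begin
        g′ q + ∑ xs g′                                    ≡⟨ cong (_+ ∑ xs g′) (+-∸-assoc 1 (lg-least {m * q} mq≤X)) ⟩
        suc (g q) + ∑ xs g′                               ≤⟨ +-monoʳ-≤ (suc (g q)) (grow xs) ⟩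
        suc (g q) + (∑ xs g + c)                          ≡⟨ shift (g q) (∑ xs g) c ⟩
        (g q + ∑ xs g) + suc c                            ≡⟨ cong (λ l → g q + ∑ xs g + length l) (filter-accept ≤X? mq≤X) ⟨
        (g q + ∑ xs g) + length (filter ≤X? (q ∷ xs))     ∎
        where
        shift : ∀ a b c → suc a + (b + c) ≡ (a + b) + suc c
        shift = solve-∀
      reject : ¬ m * q ≤ 2 ^ L → ∑ (q ∷ xs) g′ ≤ ∑ (q ∷ xs) g + length (filter ≤X? (q ∷ xs))
      reject mq≰X = begin
        g′ q + ∑ xs g′                                    ≡⟨ cong (_+ ∑ xs g′) (m≤n⇒m∸n≡0 L<lg) ⟩
        ∑ xs g′                                           ≤⟨ grow xs ⟩
        ∑ xs g + c                                        ≤⟨ +-monoˡ-≤ c (m≤n+m _ (g q)) ⟩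
        (g q + ∑ xs g) + c                                ≡⟨ cong (λ l → g q + ∑ xs g + length l) (filter-reject ≤X? mq≰X) ⟨
        (g q + ∑ xs g) + length (filter ≤X? (q ∷ xs))     ∎
        where
        L<lg : suc L ≤ lg (m * q)
        L<lg = ≰⇒> (λ lg≤L → mq≰X (≤-trans (n≤2^lg (m * q)) (^-monoʳ-≤ 2 lg≤L)))
    count : m * length (filter ≤X? qs) ≤ 2 ^ L
    count = begin
      m * length (filter ≤X? qs)   ≤⟨ *-monoʳ-≤ m (length-bounded (Unique.filter⁺ ≤X? uqs) range) ⟩
      m * (2 ^ L / m)              ≡⟨ *-comm m (2 ^ L / m) ⟩
      2 ^ L / m * m                ≤⟨ m/n*n≤m (2 ^ L) m ⟩
      2 ^ L                        ∎
      where
      range : ∀ {q} → q ∈ filter ≤X? qs → 1 ≤ q × q ≤ 2 ^ L / m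
      range {q} q∈ = let q∈qs , mq≤X = ∈-filter⁻ ≤X? {xs = qs} q∈ in
        1≤qs q∈qs , m*n≤o⇒n≤o/m m mq≤X

  -- The possible p^a in n = m p^a ≤ N. Coprimality of p and m is not imposed: sums over this list
  -- serve as upper bounds.
  multiples≤ : List ℕ → ℕ → ℕ → List (ℕ × ℕ)
  multiples≤ ps N m = filter (λ z → m * pow z ≤? N) (primePowers ps N)

  -- The logarithm of the prime power plus the whole deficit of n. The deficit is thus counted once
  -- for every exact prime power of n, an overcount that `∑-logWeight` shows to be affordable.
  logWeight : ℕ → ℕ → ℕ × ℕ → ℕ
  logWeight N n z = lg (pow z) + (lg N ∸ lg n)

  module _ {ps : List ℕ} (ups : Unique ps) (prs : All Prime ps) (N : ℕ) where

    -- Put y = ⌊N/m⌋. Each logarithm is at most `lg y`, and `primePowers-count` bounds their number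
    -- by 12 · 2^(lg y) / lg y, where 2^(lg y) ≤ 2y: total 24 N. For the deficits, prime powers are
    -- replaced by all integers q ≤ y, and `∑-∸lg` gives 2^(lg N) ≤ 2 N.
    ∑-logWeight : ∀ m → 1 ≤ m → m ≤ N → m * ∑ (multiples≤ ps N m) (λ z → logWeight N (m * pow z) z) ≤ 26 * N
    ∑-logWeight m@(suc _) 1≤m m≤N = begin
      m * ∑ F (λ z → logWeight N (m * pow z) z)                                      ≡⟨ cong (m *_) (∑-+ F _ _) ⟩
      m * (∑ F (λ z → lg (pow z)) + ∑ F (λ z → lg N ∸ lg (m * pow z)))             ≡⟨ *-distribˡ-+ m (∑ F (λ z → lg (pow z))) (∑ F (λ z → lg N ∸ lg (m * pow z))) ⟩
      m * ∑ F (λ z → lg (pow z)) + m * ∑ F (λ z → lg N ∸ lg (m * pow z))           ≤⟨ +-mono-≤ logs gaps ⟩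
      24 * N + 2 * N                                                               ≡⟨ *-distribʳ-+ N 24 2 ⟨
      26 * N                                                                       ∎
      where
      open ≤-Reasoning
      ≤N? : Decidable (λ z → m * pow z ≤ N)
      ≤N? z = m * pow z ≤? N
      F = multiples≤ ps N m
      y = N / m
      uF : Unique F
      uF = Unique.filter⁺ ≤N? (primePowers-unique N ups)
      pow≤y : ∀ {z} → z ∈ F → pow z ≤ y
      pow≤y {z} z∈ = m*n≤o⇒n≤o/m m (proj₂ (∈-filter⁻ ≤N? {xs = primePowers ps N} z∈))
      1≤y : 1 ≤ y
      1≤y = m*n≤o⇒n≤o/m m (≤-trans (≤-reflexive (*-identityʳ m)) m≤N)
      my≤N : m * y ≤ N
      my≤N = ≤-trans (≤-reflexive (*-comm m y)) (m/n*n≤m N m)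
      isPrimePower : ∀ {p a} → (p , a) ∈ F → Prime p × 1 ≤ a
      isPrimePower z∈ = let p∈ , a∈ = ∈-⋉⁻ ps (proj₁ (∈-filter⁻ ≤N? {xs = primePowers ps N} z∈)) in
        All.lookup prs p∈ , proj₁ (∈-[1⋯]⁻ a∈)
      ≤X? : Decidable (λ z → pow z ≤ 2 ^ lg y)
      ≤X? z = pow z ≤? 2 ^ lg y
      logs : m * ∑ F (λ z → lg (pow z)) ≤ 24 * N
      logs = begin
        m * ∑ F (λ z → lg (pow z))    ≤⟨ *-monoʳ-≤ m (∑-mono F (λ z∈ → lg-mono (pow≤y z∈))) ⟩
        m * ∑ F (const (lg y))        ≡⟨ cong (m *_) (trans (∑-const F (lg y)) (*-comm (length F) (lg y))) ⟩
        m * (lg y * length F)         ≤⟨ *-monoʳ-≤ m (*-monoʳ-≤ (lg y) (length-⊆ uF (λ {z} z∈ → ∈-filter⁺ ≤X?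
                                           (proj₁ (∈-filter⁻ ≤N? {xs = primePowers ps N} z∈)) (≤-trans (pow≤y z∈) (n≤2^lg y))))) ⟩
        m * (lg y * length (filter ≤X? (primePowers ps N))) ≤⟨ *-monoʳ-≤ m (primePowers-count ups prs N (lg y)) ⟩
        m * (12 * 2 ^ lg y)           ≤⟨ *-monoʳ-≤ m (*-monoʳ-≤ 12 (2^lg≤2n y 1≤y)) ⟩
        m * (12 * (2 * y))            ≡⟨ swap m y ⟩
        24 * (m * y)                  ≤⟨ *-monoʳ-≤ 24 my≤N ⟩
        24 * N                        ∎
        where
        swap : ∀ m y → m * (12 * (2 * y)) ≡ 24 * (m * y)
        swap = solve-∀
      PowerOf : ℕ × ℕ → ℕ → Set
      PowerOf (p , a) q = Prime p × 1 ≤ a × p ^ a ≡ q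
      gaps : m * ∑ F (λ z → lg N ∸ lg (m * pow z)) ≤ 2 * N
      gaps = begin
        m * ∑ F (λ z → lg N ∸ lg (m * pow z))         ≤⟨ *-monoʳ-≤ m (∑-transfer PowerOf uF (λ _ → z≤n) partner
                                                           (λ { (pr , 1≤a , eq) (qr , _ , eq′) → pow-injective pr qr 1≤a (trans eq (sym eq′)) })) ⟩
        m * ∑ [1⋯ y ] (λ q → lg N ∸ lg (m * q))       ≤⟨ ∑-∸lg ([1⋯]-unique y) (λ q∈ → proj₁ (∈-[1⋯]⁻ q∈)) m 1≤m (lg N) ⟩
        2 ^ lg N                                      ≤⟨ 2^lg≤2n N (≤-trans 1≤m m≤N) ⟩
        2 * N                                         ∎
        where
        partner : ∀ {z} → z ∈ F → ∃ λ q → q ∈ [1⋯ y ] × PowerOf z q × lg N ∸ lg (m * pow z) ≤ lg N ∸ lg (m * q)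
        partner {z@(p , a)} z∈ = let pr , 1≤a = isPrimePower z∈ in
          pow z , ∈-[1⋯]⁺ (1≤p^a a pr) (pow≤y z∈) , (pr , 1≤a , refl) , ≤-refl

  -- Exact prime power divisors

  infix 4 _∥_ _∥?_

  _∥_ : ℕ × ℕ → ℕ → Set
  (p , a) ∥ n = p ^ a ∣ n × p ^ suc a ∤ n

  _∥?_ : ∀ z n → Dec (z ∥ n)
  (p , a) ∥? n = (p ^ a ∣? n) ×-dec ¬? (p ^ suc a ∣? n)

  ∥⁺ : ∀ {p} m a → Prime p → p ∤ m → (p , a) ∥ m * p ^ a
  ∥⁺ {p} m a pr p∤m = n∣m*n m , λ p^[1+a]∣ → p∤m (*-cancelʳ-∣ (p ^ a) {{m^n≢0 p a {{prime⇒nonZero pr}}}} p^[1+a]∣)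

  ∥⁻ : ∀ p a {n} → (p , a) ∥ n → ∃ λ m → n ≡ m * p ^ a × p ∤ m
  ∥⁻ p a (divides m n≡ , p^[1+a]∤n) = m , n≡ , λ p∣m →
    p^[1+a]∤n (subst (p ^ suc a ∣_) (sym n≡) (*-monoˡ-∣ (p ^ a) p∣m))

  ∥-exists : ∀ {p} n → Prime p → 1 ≤ n → ∃ λ m → ∃ λ a → n ≡ m * p ^ a × p ∤ m
  ∥-exists {p} n pr = <-rec (λ n → 1 ≤ n → ∃ λ m → ∃ λ a → n ≡ m * p ^ a × p ∤ m) step n
    where
    step : ∀ n → (∀ {k} → k < n → 1 ≤ k → ∃ λ m → ∃ λ a → k ≡ m * p ^ a × p ∤ m) →
           1 ≤ n → ∃ λ m → ∃ λ a → n ≡ m * p ^ a × p ∤ m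
    step n rec 1≤n with p ∣? n
    ... | no p∤n = n , 0 , sym (*-identityʳ n) , p∤n
    ... | yes p∣n@(divides k n≡kp) with rec k<n 1≤k
      where
      instance
        _ = >-nonZero 1≤n
        _ = prime⇒nonTrivial pr
      k<n : k < n
      k<n = quotient-< p∣n
      1≤k : 1 ≤ k
      1≤k = >-nonZero⁻¹ k {{quotient≢0 p∣n}}
    ... | m , a , k≡ , p∤m = m , suc a , trans n≡kp (trans (cong (_* p) k≡) (rearrange m p (p ^ a))) , p∤m
      where
      rearrange : ∀ m p x → m * x * p ≡ m * (p * x)
      rearrange = solve-∀

  ∥-* : ∀ {p q} m a b → Prime p → Prime q → p ≢ q → (q , b) ∥ m → (q , b) ∥ m * p ^ a
  ∥-* {p} {q} m a b pr qr p≢q q^b∥m with ∥⁻ q b q^b∥m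
  ... | c , refl , q∤c = subst ((q , b) ∥_) (rearrange c (p ^ a) (q ^ b)) (∥⁺ (c * p ^ a) b qr q∤)
    where
    rearrange : ∀ c x y → c * x * y ≡ c * y * x
    rearrange = solve-∀
    q∤ : q ∤ c * p ^ a
    q∤ q∣ with euclidsLemma c (p ^ a) qr q∣
    ... | inj₁ q∣c   = q∤c q∣c
    ... | inj₂ q∣p^a = p≢q (sym (prime∣prime⇒≡ qr pr (prime∣^⇒∣ p a qr q∣p^a)))

  primeDivisor : ∀ n → 2 ≤ n → ∃ λ p → Prime p × p ∣ n
  primeDivisor n 2≤n with factorise n {{>-nonZero (<⇒≤ 2≤n)}}
  ... | record { factors = [] ; isFactorisation = n≡1 } = contradiction n≡1 (>⇒≢ 2≤n)
  ... | record { factors = p ∷ ps ; isFactorisation = n≡ ; factorsPrime = pr ∷ _ } =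
    p , pr , subst (p ∣_) (sym n≡) (m∣m*n (product ps))

  -- One full prime power p^a is stripped off at a time: `lg` is subadditive, and the exact prime
  -- powers of the cofactor m stay exact in m p^a because p does not divide m.
  lg≤∑-∥ : ∀ n → 1 ≤ n → ∃ λ zs → Unique zs ×
    (∀ {p a} → (p , a) ∈ zs → Prime p × 1 ≤ a × (p , a) ∥ n) × lg n ≤ ∑ zs (lg ∘ pow)
  lg≤∑-∥ = <-rec _ step
    where
    Goal : ℕ → Set
    Goal n = ∃ λ zs → Unique zs × (∀ {p a} → (p , a) ∈ zs → Prime p × 1 ≤ a × (p , a) ∥ n) × lg n ≤ ∑ zs (lg ∘ pow)
    step : ∀ n → (∀ {m} → m < n → 1 ≤ m → Goal m) → 1 ≤ n → Goal n
    step n rec 1≤n with n ≤? 1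
    ... | yes n≤1 = [] , AllPairs.[] , (λ ()) , lg-least n≤1
    ... | no  n≰1 with primeDivisor n (≰⇒> n≰1)
    ...   | p , pr , p∣n with ∥-exists n pr 1≤n
    ...     | m , zero  , n≡ , p∤m = contradiction (subst (p ∣_) (trans n≡ (*-identityʳ m)) p∣n) p∤m
    ...     | m , suc b , refl , p∤m = extend (rec m<n 1≤m)
      where
      a = suc b
      1≤m : 1 ≤ m
      1≤m = n≢0⇒n>0 λ { refl → n≮0 1≤n }
      m<n : m < m * p ^ a
      m<n = m<m*n m (p ^ a) {{>-nonZero 1≤m}} (<-≤-trans (s≤s (s≤s z≤n)) (a<p^a a pr))
      extend : Goal m → Goal (m * p ^ a)
      extend (zs , uzs , zs-ok , lgm≤) = (p , a) ∷ zs , fresh AllPairs.∷ uzs , ok , (begin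
        lg (m * p ^ a)                  ≤⟨ lg-*-≤ m (p ^ a) ⟩
        lg m + lg (p ^ a)               ≤⟨ +-monoˡ-≤ (lg (p ^ a)) lgm≤ ⟩
        ∑ zs (lg ∘ pow) + lg (p ^ a)    ≡⟨ +-comm _ (lg (p ^ a)) ⟩
        lg (p ^ a) + ∑ zs (lg ∘ pow)    ∎)
        where
        open ≤-Reasoning
        q∣m : ∀ {q c} → (q , c) ∈ zs → q ∣ m
        q∣m z∈ = let _ , 1≤c , q^c∣m , _ = zs-ok z∈ in ∣-trans (p∣p^a 1≤c) q^c∣m
        p≢ : ∀ {q c} → (q , c) ∈ zs → p ≢ q
        p≢ z∈ refl = p∤m (q∣m z∈)
        fresh : All ((p , a) ≢_) zs
        fresh = All.tabulate λ { z∈ refl → p≢ z∈ refl }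
        ok : ∀ {q c} → (q , c) ∈ (p , a) ∷ zs → Prime q × 1 ≤ c × (q , c) ∥ m * p ^ a
        ok (here refl) = pr , s≤s z≤n , ∥⁺ m a pr p∤m
        ok {c = c} (there z∈) = let qr , 1≤c , q^c∥m = zs-ok z∈ in qr , 1≤c , ∥-* m a c pr qr (p≢ z∈) q^c∥m

  ∥-bound : ∀ {p a n} → Prime p → 1 ≤ n → (p , a) ∥ n → a ≤ n
  ∥-bound {p} {a} pr 1≤n (p^a∣n , _) = ≤-trans (<⇒≤ (a<p^a a pr)) (∣⇒≤ {{>-nonZero 1≤n}} p^a∣n)

  exactPowers : List ℕ → ℕ → ℕ → List (ℕ × ℕ)
  exactPowers ps N n = filter (_∥? n) (primePowers ps N)

  ∈-exactPowers⁺ : ∀ {ps N n p a} → Prime p → 1 ≤ n → n ≤ N → p ∈ ps → 1 ≤ a → (p , a) ∥ n → (p , a) ∈ exactPowers ps N n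
  ∈-exactPowers⁺ {n = n} pr 1≤n n≤N p∈ 1≤a p^a∥n = ∈-filter⁺ (_∥? n)
    (∈-⋉⁺ p∈ (∈-[1⋯]⁺ 1≤a (≤-trans (∥-bound pr 1≤n p^a∥n) n≤N))) p^a∥n

  -- Every n ≥ 2 has at least one exact prime power divisor, which pays for the term lg N ∸ lg n.
  lg≤∑-logWeight : ∀ {N n zs} → 2 ≤ n → (∀ {p a} → Prime p → 1 ≤ a → (p , a) ∥ n → (p , a) ∈ zs) →
    lg N ≤ ∑ zs (logWeight N n)
  lg≤∑-logWeight {N} {n} {zs} 2≤n complete with lg≤∑-∥ n (<⇒≤ 2≤n)
  ... | [] , _ , _ , lgn≤0 = contradiction (≤-trans (1≤lg 2≤n) lgn≤0) λ ()
  ... | y ∷ ys , uys , ys-ok , lgn≤ = begin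
    lg N                                                 ≤⟨ m≤n+m∸n (lg N) (lg n) ⟩
    lg n + gap                                           ≤⟨ +-mono-≤ lgn≤ (m≤m+n gap (∑ ys (const gap))) ⟩
    ∑ (y ∷ ys) (lg ∘ pow) + ∑ (y ∷ ys) (const gap)       ≡⟨ ∑-+ (y ∷ ys) (lg ∘ pow) (const gap) ⟨
    ∑ (y ∷ ys) (logWeight N n)                           ≤⟨ ∑-⊆ uys (λ _ → z≤n) (λ z∈ →
                                                              let pr , 1≤a , z∥n = ys-ok z∈ in complete pr 1≤a z∥n) ⟩
    ∑ zs (logWeight N n)                                 ∎
    where
    open ≤-Reasoning
    gap = lg N ∸ lg n

  -- Writing n = m p ^ a with p ∤ m sends a pair (n , p ^ a ∥ n) to the pair (m , p ^ a).
  data Removal : ℕ × (ℕ × ℕ) → ℕ × (ℕ × ℕ) → Set where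
    removal : ∀ {m z} → Removal (m * pow z , z) (m , z)

  Removal-det : ∀ {u u′ v} → Removal u v → Removal u′ v → u ≡ u′
  Removal-det removal removal = refl

  module _ {ps as bs : List ℕ} (N : ℕ)
    (as-bound : ∀ {n} → n ∈ as → 1 ≤ n × n ≤ N)
    (remove : ∀ {m p a} → p ∈ ps → p ∤ m → 1 ≤ a → m * p ^ a ∈ as → m ∈ bs) where

    -- The hypothesis `remove` covers two situations: primes outside all Tⱼ, where m stays in A k,
    -- and primes of one Tⱼ, where m moves to A (k - eⱼ).
    Removal-partner : ∀ {u} → u ∈ as ⋉ exactPowers ps N → ∃ λ v → v ∈ bs ⋉ multiples≤ ps N × Removal u v
    Removal-partner {n , z@(p , a)} u∈ with ∈-⋉⁻ as u∈
    ... | n∈ , z∈ with ∈-filter⁻ (_∥? n) {xs = primePowers ps N} z∈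
    ...   | z∈pp , z∥n with ∥⁻ p a z∥n | ∈-⋉⁻ ps z∈pp
    ...     | m , refl , p∤m | p∈ , a∈ =
      (m , z) , ∈-⋉⁺ (remove p∈ p∤m (proj₁ (∈-[1⋯]⁻ a∈)) n∈)
                     (∈-filter⁺ (λ z → m * pow z ≤? N) z∈pp (proj₂ (as-bound n∈))) , removal

  exactPowers-unique : ∀ {ps} N → Unique ps → ∀ n → Unique (exactPowers ps N n)
  exactPowers-unique N ups n = Unique.filter⁺ (_∥? n) (primePowers-unique N ups)

  ∑-logWeight-removal : ∀ {ps as bs} N → Unique ps → Unique as →
    (∀ {n} → n ∈ as → 1 ≤ n × n ≤ N) →
    (∀ {m p a} → p ∈ ps → p ∤ m → 1 ≤ a → m * p ^ a ∈ as → m ∈ bs) →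
    ∑ as (λ n → ∑ (exactPowers ps N n) (logWeight N n)) ≤
    ∑ bs (λ m → ∑ (multiples≤ ps N m) (λ z → logWeight N (m * pow z) z))
  ∑-logWeight-removal {ps} {as} {bs} N ups uas as-bound remove = begin
    ∑ as (λ n → ∑ (exactPowers ps N n) (logWeight N n))   ≡⟨ ∑-⋉ as (exactPowers ps N) f ⟨
    ∑ (as ⋉ exactPowers ps N) f                          ≤⟨ ∑-transfer Removal
      (⋉-unique uas (exactPowers-unique N ups)) (λ _ → z≤n)
      (λ u∈ → let v , v∈ , R = Removal-partner N as-bound remove u∈ in v , v∈ , R , f≤g R) Removal-det ⟩
    ∑ (bs ⋉ multiples≤ ps N) g                      ≡⟨ ∑-⋉ bs (multiples≤ ps N) g ⟩
    ∑ bs (λ m → ∑ (multiples≤ ps N m) (λ z → logWeight N (m * pow z) z)) ∎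
    where
    open ≤-Reasoning
    f g : ℕ × (ℕ × ℕ) → ℕ
    f (n , z) = logWeight N n z
    g (m , z) = logWeight N (m * pow z) z
    f≤g : ∀ {u v} → Removal u v → f u ≤ g v
    f≤g removal = ≤-refl

  -- Every prime divisor is the base of an exact power, so an n with k prime divisors in `ps` offers
  -- at least k pairs to mark.
  length-∣-≤ : ∀ {ps N n} → Unique ps → All Prime ps → 1 ≤ n → n ≤ N →
    length (filter (_∣? n) ps) ≤ length (exactPowers ps N n)
  length-∣-≤ {ps} {N} {n} ups prs 1≤n n≤N = length-transfer (λ p z → p ≡ proj₁ z) (Unique.filter⁺ (_∣? n) ups) partner
    (λ p≡ q≡ → trans p≡ (sym q≡))
    where
    partner : ∀ {p} → p ∈ filter (_∣? n) ps → ∃ λ z → z ∈ exactPowers ps N n × p ≡ proj₁ z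
    partner {p} p∈f with ∈-filter⁻ (_∣? n) {xs = ps} p∈f
    ... | p∈ , p∣n with ∥-exists n (All.lookup prs p∈) 1≤n
    ...   | m , zero  , n≡   , p∤m = contradiction (subst (p ∣_) (trans n≡ (*-identityʳ m)) p∣n) p∤m
    ...   | m , suc a , refl , p∤m = (p , suc a) ,
            ∈-exactPowers⁺ pr 1≤n n≤N p∈ (s≤s z≤n) (∥⁺ m (suc a) pr p∤m) , refl
      where pr = All.lookup prs p∈

  prime∣m*p^a : ∀ {p q} m a → Prime p → Prime q → q ≢ p → q ∣ m * p ^ a → q ∣ m
  prime∣m*p^a {p} m a pr qr q≢p q∣ with euclidsLemma m (p ^ a) qr q∣
  ... | inj₁ q∣m   = q∣m
  ... | inj₂ q∣p^a = contradiction (prime∣prime⇒≡ qr pr (prime∣^⇒∣ p a qr q∣p^a)) q≢p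

  length-∣-fresh : ∀ {ps p} m a → All Prime ps → Prime p → p ∉ ps →
    length (filter (_∣? (m * p ^ a)) ps) ≡ length (filter (_∣? m) ps)
  length-∣-fresh {[]}     m a _ _ _ = refl
  length-∣-fresh {q ∷ ps} {p} m a (qr ∷ prs) pr p∉ with q ∣? m
  ... | yes q∣m = trans (cong length (filter-accept (_∣? (m * p ^ a)) (∣m⇒∣m*n (p ^ a) q∣m)))
                        (cong suc (length-∣-fresh m a prs pr (p∉ ∘ there)))
  ... | no  q∤m = trans (cong length (filter-reject (_∣? (m * p ^ a)) (q∤m ∘ prime∣m*p^a m a pr qr (λ q≡p → p∉ (here (sym q≡p))))))
                        (length-∣-fresh m a prs pr (p∉ ∘ there))

  length-∣-member : ∀ {ps p} m a → Unique ps → All Prime ps → p ∈ ps → p ∤ m → 1 ≤ a →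
    length (filter (_∣? (m * p ^ a)) ps) ≡ suc (length (filter (_∣? m) ps))
  length-∣-member {p ∷ ps} m a (p∉ AllPairs.∷ _) (pr ∷ prs) (here refl) p∤m 1≤a =
    trans (cong length (filter-accept (_∣? (m * p ^ a)) (∣n⇒∣m*n m (p∣p^a 1≤a))))
      (cong suc (trans (length-∣-fresh m a prs pr (λ p∈ → All.lookup p∉ p∈ refl))
        (sym (cong length (filter-reject (_∣? m) p∤m)))))
  length-∣-member {q ∷ ps} {p} m a (q∉ AllPairs.∷ ups) (qr ∷ prs) (there p∈) p∤m 1≤a with q ∣? m
  ... | yes q∣m = trans (cong length (filter-accept (_∣? (m * p ^ a)) (∣m⇒∣m*n (p ^ a) q∣m)))
                        (cong suc (length-∣-member m a ups prs p∈ p∤m 1≤a))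
  ... | no  q∤m = trans (cong length (filter-reject (_∣? (m * p ^ a)) (q∤m ∘ prime∣m*p^a m a (All.lookup prs p∈) qr (All.lookup q∉ p∈))))
                        (length-∣-member m a ups prs p∈ p∤m 1≤a)

  length-∣≡0⇒∤ : ∀ {ps n p} → length (filter (_∣? n) ps) ≡ 0 → p ∈ ps → p ∤ n
  length-∣≡0⇒∤ {ps} {n} none p∈ p∣n with filter (_∣? n) ps | ∈-filter⁺ (_∣? n) p∈ p∣n
  ... | _ ∷ _ | _ = contradiction none λ ()

  -- Squarefree products of given primes

  -- One entry for each subset of `ps`: the numbers d over which ∏ (1 + 1/p) expands.
  products : List ℕ → List ℕ
  products []       = 1 ∷ []
  products (p ∷ ps) = products ps ++ map (p *_) (products ps)

  products-≥1 : ∀ {ps d} → All Prime ps → d ∈ products ps → 1 ≤ d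
  products-≥1 {[]}     _ (here refl) = ≤-refl
  products-≥1 {p ∷ ps} (pr ∷ prs) d∈ with ∈-++⁻ (products ps) d∈
  ... | inj₁ d∈₁ = products-≥1 prs d∈₁
  ... | inj₂ d∈₂ with ∈-map⁻ (p *_) d∈₂
  ...   | e , e∈ , refl = *-mono-≤ (<⇒≤ (prime⇒1< pr)) (products-≥1 prs e∈)

  products-∤ : ∀ {ps q d} → All Prime ps → Prime q → q ∉ ps → d ∈ products ps → q ∤ d
  products-∤ {[]}     _ qr _ (here refl) q∣1 = contradiction (subst Prime (∣1⇒≡1 q∣1) qr) ¬prime[1]
  products-∤ {p ∷ ps} {q} (pr ∷ prs) qr q∉ d∈ q∣d with ∈-++⁻ (products ps) d∈
  ... | inj₁ d∈₁ = products-∤ prs qr (q∉ ∘ there) d∈₁ q∣d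
  ... | inj₂ d∈₂ with ∈-map⁻ (p *_) d∈₂
  ...   | e , e∈ , refl with euclidsLemma p e qr q∣d
  ...     | inj₁ q∣p = q∉ (here (prime∣prime⇒≡ qr pr q∣p))
  ...     | inj₂ q∣e = products-∤ prs qr (q∉ ∘ there) e∈ q∣e

  products-unique : ∀ {ps} → Unique ps → All Prime ps → Unique (products ps)
  products-unique {[]}     _ _ = [] AllPairs.∷ AllPairs.[]
  products-unique {p ∷ ps} (p∉ AllPairs.∷ ups) (pr ∷ prs) = Unique.++⁺ (products-unique ups prs)
    (Unique.map⁺ (λ {d} {e} → *-cancelˡ-≡ d e p {{prime⇒nonZero pr}}) (products-unique ups prs))
    λ { (d∈₁ , d∈₂) → let e , _ , d≡pe = ∈-map⁻ (p *_) d∈₂ in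
        products-∤ prs pr (λ p∈ → All.lookup p∉ p∈ refl) d∈₁ (subst (p ∣_) (sym d≡pe) (m∣m*n e)) }

  multiples-differ : ∀ {ps p d d′} m m′ → Prime p → p ∤ m → All Prime ps → All (p ≢_) ps →
    d ∈ products ps → d′ ∈ map (p *_) (products ps) → m * d ≢ m′ * d′
  multiples-differ {ps} {p} {d} m m′ pr p∤m prs p∉ d∈₁ d′∈₂ eq with ∈-map⁻ (p *_) d′∈₂
  ... | e , e∈ , refl with euclidsLemma m d pr (subst (p ∣_) (sym eq) (∣n⇒∣m*n m′ (m∣m*n e)))
  ...   | inj₁ p∣m = p∤m p∣m
  ...   | inj₂ p∣d = products-∤ prs pr (λ p∈ → All.lookup p∉ p∈ refl) d∈₁ p∣d

  -- As p divides neither m nor m′, it divides the common value exactly when it was chosen in d, and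
  -- likewise in d′. So the choices for the first prime agree, and p can be cancelled.
  *-products-injective : ∀ {ps m m′ d d′} → Unique ps → All Prime ps →
    (∀ {p} → p ∈ ps → p ∤ m) → (∀ {p} → p ∈ ps → p ∤ m′) →
    d ∈ products ps → d′ ∈ products ps → m * d ≡ m′ * d′ → (m , d) ≡ (m′ , d′)
  *-products-injective {[]} {m} {m′} _ _ _ _ (here refl) (here refl) eq =
    cong (_, 1) (trans (sym (*-identityʳ m)) (trans eq (*-identityʳ m′)))
  *-products-injective {p ∷ ps} {m} {m′} (p∉ AllPairs.∷ ups) (pr ∷ prs) ps∤m ps∤m′ d∈ d′∈ eq
    with ∈-++⁻ (products ps) d∈ | ∈-++⁻ (products ps) d′∈
  ... | inj₁ d∈₁ | inj₁ d′∈₁ = *-products-injective ups prs (ps∤m ∘ there) (ps∤m′ ∘ there) d∈₁ d′∈₁ eq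
  ... | inj₁ d∈₁ | inj₂ d′∈₂ = contradiction eq (multiples-differ m m′ pr (ps∤m (here refl)) prs p∉ d∈₁ d′∈₂)
  ... | inj₂ d∈₂ | inj₁ d′∈₁ = contradiction (sym eq) (multiples-differ m′ m pr (ps∤m′ (here refl)) prs p∉ d′∈₁ d∈₂)
  ... | inj₂ d∈₂ | inj₂ d′∈₂ with ∈-map⁻ (p *_) d∈₂ | ∈-map⁻ (p *_) d′∈₂
  ...   | e , e∈ , refl | e′ , e′∈ , refl
        with *-products-injective ups prs (ps∤m ∘ there) (ps∤m′ ∘ there) e∈ e′∈
               (*-cancelˡ-≡ (m * e) (m′ * e′) p {{prime⇒nonZero pr}}
                 (trans (sym (rearrange m p e)) (trans eq (rearrange m′ p e′))))
    where
    rearrange : ∀ m p e → m * (p * e) ≡ p * (m * e)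
    rearrange = solve-∀
  ...     | refl = refl

open Arithmetic

open import Defs
open import Data.Nat.Base as ℕ using (ℕ; zero; suc; s≤s; z≤n)
import Data.Nat.Properties as ℕₚ
open import Data.Nat.Divisibility using (_∣_; _∤_; _∣?_; ∣⇒≤; ∣-trans)
open import Data.Nat.Primality using (Prime; prime?; prime⇒nonZero)
import Data.Integer.Base as ℤ
import Data.Integer.Properties as ℤₚ
open import Data.Maybe.Base using (Maybe; just; nothing)
open import Data.Rational.Base hiding (_≥_; _>_)
open import Data.Rational.Properties
import Data.Rational.Unnormalised.Base as ℚᵘ
import Data.Rational.Unnormalised.Properties as ℚᵘₚ
open import Tactic.RingSolver using (solve-∀)
open import Tactic.RingSolver.Core.AlmostCommutativeRing using (AlmostCommutativeRing; fromCommutativeRing)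
open import Data.Fin.Base as Fin using (Fin)
import Data.Fin.Properties as Finₚ
open import Data.Vec.Functional using (updateAt)
open import Data.Vec.Functional.Properties using (updateAt-updates; updateAt-minimal)
open import Data.List.Membership.DecPropositional ℕₚ._≟_ using (_∈?_)

-- Rational arithmetic, reciprocals and finite products

ℚ-ring : AlmostCommutativeRing 0ℓ 0ℓ
ℚ-ring = fromCommutativeRing +-*-commutativeRing 0≟
  where
  0≟ : ∀ q → Maybe (0ℚ ≡ q)
  0≟ q with 0ℚ ≟ q
  ... | yes 0≡q = just 0≡q
  ... | no  _   = nothing

module ∑ℚ = OrderedSum _+_ 0ℚ _≤_ +-0-isCommutativeMonoid ≤-isPreorder +-mono-≤
open ∑ℚ

*-mono-≤ˡ : ∀ {a b} c → 0ℚ ≤ c → a ≤ b → c * a ≤ c * b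
*-mono-≤ˡ c 0≤c = *-monoˡ-≤-nonNeg c {{nonNegative 0≤c}}

*-mono-≤ʳ : ∀ {a b} c → 0ℚ ≤ c → a ≤ b → a * c ≤ b * c
*-mono-≤ʳ c 0≤c = *-monoʳ-≤-nonNeg c {{nonNegative 0≤c}}

0≤-* : ∀ {a b} → 0ℚ ≤ a → 0ℚ ≤ b → 0ℚ ≤ a * b
0≤-* {a} {b} 0≤a 0≤b = subst (_≤ a * b) (*-zeroʳ a) (*-mono-≤ˡ a 0≤a 0≤b)

0≤-+ : ∀ {a b} → 0ℚ ≤ a → 0ℚ ≤ b → 0ℚ ≤ a + b
0≤-+ {a} {b} 0≤a 0≤b = +-mono-≤ 0≤a 0≤b

0<-* : ∀ {a b} → 0ℚ < a → 0ℚ < b → 0ℚ < a * b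
0<-* {a} {b} 0<a 0<b = subst (_< a * b) (*-zeroʳ a) (*-monoʳ-<-pos a {{positive 0<a}} 0<b)

*-mono-≤-nonNeg : ∀ {a b c d} → 0ℚ ≤ a → 0ℚ ≤ c → a ≤ b → c ≤ d → a * c ≤ b * d
*-mono-≤-nonNeg {a} {b} {c} {d} 0≤a 0≤c a≤b c≤d =
  ≤-trans (*-mono-≤ʳ c 0≤c a≤b) (*-mono-≤ˡ b (≤-trans 0≤a a≤b) c≤d)

*-cancel-≤ˡ : ∀ {a b} c → 0ℚ < c → c * a ≤ c * b → a ≤ b
*-cancel-≤ˡ c 0<c = *-cancelˡ-≤-pos c {{positive 0<c}}

p≤q⇒0≤q-p : ∀ {p q} → p ≤ q → 0ℚ ≤ q - p
p≤q⇒0≤q-p {p} {q} p≤q = subst (_≤ q - p) (+-inverseʳ p) (+-monoˡ-≤ (- p) p≤q)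

0≤q-p⇒p≤q : ∀ {p q} → 0ℚ ≤ q - p → p ≤ q
0≤q-p⇒p≤q {p} {q} 0≤ = subst₂ _≤_ (+-identityˡ p) (lem p q) (+-monoˡ-≤ p 0≤)
  where
  lem : ∀ p q → q - p + p ≡ q
  lem = solve-∀ ℚ-ring

p≤p+q : ∀ {p q} → 0ℚ ≤ q → p ≤ p + q
p≤p+q {p} {q} 0≤q = subst (_≤ p + q) (+-identityʳ p) (+-monoʳ-≤ p 0≤q)

p≤q+p : ∀ {p q} → 0ℚ ≤ q → p ≤ q + p
p≤q+p {p} {q} 0≤q = subst (_≤ q + p) (+-identityˡ p) (+-monoˡ-≤ p 0≤q)

fromℚᵘ-homo-+ : ∀ p q → fromℚᵘ p + fromℚᵘ q ≡ fromℚᵘ (p ℚᵘ.+ q)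
fromℚᵘ-homo-+ p q = toℚᵘ-injective (begin
  toℚᵘ (fromℚᵘ p + fromℚᵘ q)                ≈⟨ toℚᵘ-homo-+ (fromℚᵘ p) (fromℚᵘ q) ⟩
  toℚᵘ (fromℚᵘ p) ℚᵘ.+ toℚᵘ (fromℚᵘ q)      ≈⟨ ℚᵘₚ.+-cong (toℚᵘ-fromℚᵘ p) (toℚᵘ-fromℚᵘ q) ⟩
  p ℚᵘ.+ q                                  ≈⟨ toℚᵘ-fromℚᵘ (p ℚᵘ.+ q) ⟨
  toℚᵘ (fromℚᵘ (p ℚᵘ.+ q))                  ∎)
  where open ℚᵘₚ.≃-Reasoning

fromℚᵘ-homo-* : ∀ p q → fromℚᵘ p * fromℚᵘ q ≡ fromℚᵘ (p ℚᵘ.* q)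
fromℚᵘ-homo-* p q = toℚᵘ-injective (begin
  toℚᵘ (fromℚᵘ p * fromℚᵘ q)                ≈⟨ toℚᵘ-homo-* (fromℚᵘ p) (fromℚᵘ q) ⟩
  toℚᵘ (fromℚᵘ p) ℚᵘ.* toℚᵘ (fromℚᵘ q)      ≈⟨ ℚᵘₚ.*-cong (toℚᵘ-fromℚᵘ p) (toℚᵘ-fromℚᵘ q) ⟩
  p ℚᵘ.* q                                  ≈⟨ toℚᵘ-fromℚᵘ (p ℚᵘ.* q) ⟨
  toℚᵘ (fromℚᵘ (p ℚᵘ.* q))                  ∎)
  where open ℚᵘₚ.≃-Reasoning

fromℚᵘ-mono-≤ : ∀ {p q} → p ℚᵘ.≤ q → fromℚᵘ p ≤ fromℚᵘ q
fromℚᵘ-mono-≤ {p} {q} p≤q = toℚᵘ-cancel-≤ (begin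
  toℚᵘ (fromℚᵘ p)   ≃⟨ toℚᵘ-fromℚᵘ p ⟩
  p                 ≤⟨ p≤q ⟩
  q                 ≃⟨ toℚᵘ-fromℚᵘ q ⟨
  toℚᵘ (fromℚᵘ q)   ∎)
  where open ℚᵘₚ.≤-Reasoning

abstract

  fromℕ-+ : ∀ m n → fromℕ (m ℕ.+ n) ≡ fromℕ m + fromℕ n
  fromℕ-+ m n = sym (trans (fromℚᵘ-homo-+ (ℚᵘ.mkℚᵘ (ℤ.+ m) 0) (ℚᵘ.mkℚᵘ (ℤ.+ n) 0))
    (fromℚᵘ-cong {ℚᵘ.mkℚᵘ (ℤ.+ m) 0 ℚᵘ.+ ℚᵘ.mkℚᵘ (ℤ.+ n) 0} {ℚᵘ.mkℚᵘ (ℤ.+ (m ℕ.+ n)) 0}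
      (ℚᵘ.*≡* (cong (ℤ._* ℤ.+ 1) (cong₂ ℤ._+_ (ℤₚ.*-identityʳ (ℤ.+ m)) (ℤₚ.*-identityʳ (ℤ.+ n)))))))

  fromℕ-* : ∀ m n → fromℕ (m ℕ.* n) ≡ fromℕ m * fromℕ n
  fromℕ-* m n = sym (trans (fromℚᵘ-homo-* (ℚᵘ.mkℚᵘ (ℤ.+ m) 0) (ℚᵘ.mkℚᵘ (ℤ.+ n) 0))
    (fromℚᵘ-cong {ℚᵘ.mkℚᵘ (ℤ.+ m) 0 ℚᵘ.* ℚᵘ.mkℚᵘ (ℤ.+ n) 0} {ℚᵘ.mkℚᵘ (ℤ.+ (m ℕ.* n)) 0}
      (ℚᵘ.*≡* (cong (ℤ._* ℤ.+ 1) (sym (ℤₚ.pos-* m n))))))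

  fromℕ-mono : ∀ {m n} → m ℕ.≤ n → fromℕ m ≤ fromℕ n
  fromℕ-mono {m} {n} m≤n = fromℚᵘ-mono-≤ {ℚᵘ.mkℚᵘ (ℤ.+ m) 0} {ℚᵘ.mkℚᵘ (ℤ.+ n) 0} (ℚᵘ.*≤* (ℤₚ.*-monoʳ-≤-nonNeg (ℤ.+ 1) (ℤ.+≤+ m≤n)))

  -- Totalised by `inv 0 = 0`, so that reciprocals can be summed over any list without a side
  -- condition on its entries.
  inv : ℕ → ℚ
  inv zero    = 0ℚ
  inv (suc n) = ℤ.+ 1 / suc n

  inv≡ : ∀ n .{{_ : ℕ.NonZero n}} → ℤ.+ 1 / n ≡ inv n
  inv≡ (suc n) = refl

  fromℕ*inv : ∀ n → 1 ℕ.≤ n → fromℕ n * inv n ≡ 1ℚ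
  fromℕ*inv (suc n) _ = trans (fromℚᵘ-homo-* (ℚᵘ.mkℚᵘ (ℤ.+ suc n) 0) (ℚᵘ.mkℚᵘ (ℤ.+ 1) n))
    (fromℚᵘ-cong {ℚᵘ.mkℚᵘ (ℤ.+ suc n) 0 ℚᵘ.* ℚᵘ.mkℚᵘ (ℤ.+ 1) n} {ℚᵘ.1ℚᵘ}
      (ℚᵘ.*≡* (trans (ℤₚ.*-identityʳ _) (trans (ℤₚ.*-identityʳ _)
        (sym (trans (ℤₚ.*-identityˡ _) (cong ℤ.+_ (ℕₚ.*-identityˡ (suc n)))))))))

  m/n≡fromℕ*inv : ∀ m n .{{_ : ℕ.NonZero n}} → ℤ.+ m / n ≡ fromℕ m * inv n
  m/n≡fromℕ*inv m (suc n) = sym (trans (fromℚᵘ-homo-* (ℚᵘ.mkℚᵘ (ℤ.+ m) 0) (ℚᵘ.mkℚᵘ (ℤ.+ 1) n))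
    (fromℚᵘ-cong {ℚᵘ.mkℚᵘ (ℤ.+ m) 0 ℚᵘ.* ℚᵘ.mkℚᵘ (ℤ.+ 1) n} {ℚᵘ.mkℚᵘ (ℤ.+ m) n}
      (ℚᵘ.*≡* (cong₂ ℤ._*_ (ℤₚ.*-identityʳ (ℤ.+ m)) (cong ℤ.+_ (sym (ℕₚ.*-identityˡ (suc n))))))))

  inv-nonNeg : ∀ n → 0ℚ ≤ inv n
  inv-nonNeg zero    = ≤-refl
  inv-nonNeg (suc n) = nonNegative⁻¹ _ {{normalize-nonNeg 1 (suc n)}}

0≤fromℕ : ∀ n → 0ℚ ≤ fromℕ n
0≤fromℕ n = fromℕ-mono {0} {n} z≤n

0<fromℕ : ∀ n → 1 ℕ.≤ n → 0ℚ < fromℕ n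
0<fromℕ n 1≤n = <-≤-trans (positive⁻¹ 1ℚ) (fromℕ-mono {1} {n} 1≤n)

fromℕ-suc : ∀ n → fromℕ (suc n) ≡ 1ℚ + fromℕ n
fromℕ-suc n = fromℕ-+ 1 n

inv-unique : ∀ {n q} → 1 ℕ.≤ n → fromℕ n * q ≡ 1ℚ → q ≡ inv n
inv-unique {n} {q} 1≤n nq≡1 = begin
  q                        ≡⟨ *-identityˡ q ⟨
  1ℚ * q                   ≡⟨ cong (_* q) (fromℕ*inv n 1≤n) ⟨
  fromℕ n * inv n * q      ≡⟨ lem (fromℕ n) (inv n) q ⟩
  inv n * (fromℕ n * q)    ≡⟨ cong (inv n *_) nq≡1 ⟩
  inv n * 1ℚ               ≡⟨ *-identityʳ (inv n) ⟩
  inv n                    ∎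
  where
  open ≡-Reasoning
  lem : ∀ a b c → a * b * c ≡ b * (a * c)
  lem = solve-∀ ℚ-ring

inv-* : ∀ m n → 1 ℕ.≤ m → 1 ℕ.≤ n → inv (m ℕ.* n) ≡ inv m * inv n
inv-* m n 1≤m 1≤n = sym (inv-unique (ℕₚ.*-mono-≤ 1≤m 1≤n) (begin
  fromℕ (m ℕ.* n) * (inv m * inv n)        ≡⟨ cong (_* (inv m * inv n)) (fromℕ-* m n) ⟩
  fromℕ m * fromℕ n * (inv m * inv n)      ≡⟨ lem (fromℕ m) (fromℕ n) (inv m) (inv n) ⟩
  (fromℕ m * inv m) * (fromℕ n * inv n)    ≡⟨ cong₂ _*_ (fromℕ*inv m 1≤m) (fromℕ*inv n 1≤n) ⟩
  1ℚ                                       ∎))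
  where
  open ≡-Reasoning
  lem : ∀ a b c d → a * b * (c * d) ≡ (a * c) * (b * d)
  lem = solve-∀ ℚ-ring

inv-1 : inv 1 ≡ 1ℚ
inv-1 = sym (inv-unique {1} ℕₚ.≤-refl refl)

≤-inv : ∀ {c d} n → 1 ℕ.≤ n → fromℕ n * c ≤ d → c ≤ d * inv n
≤-inv {c} {d} n 1≤n nc≤d = subst (_≤ d * inv n) eq (*-mono-≤ʳ (inv n) (inv-nonNeg n) nc≤d)
  where
  lem : ∀ a b c → a * b * c ≡ (a * c) * b
  lem = solve-∀ ℚ-ring
  eq : fromℕ n * c * inv n ≡ c
  eq = trans (lem (fromℕ n) c (inv n)) (trans (cong (_* c) (fromℕ*inv n 1≤n)) (*-identityˡ c))

inv-antimono : ∀ {m n} → 1 ℕ.≤ m → m ℕ.≤ n → inv n ≤ inv m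
inv-antimono {m} {n} 1≤m m≤n = subst (inv n ≤_) (*-identityˡ (inv m)) (≤-inv m 1≤m (begin
  fromℕ m * inv n   ≤⟨ *-mono-≤ʳ (inv n) (inv-nonNeg n) (fromℕ-mono m≤n) ⟩
  fromℕ n * inv n   ≡⟨ fromℕ*inv n (ℕₚ.≤-trans 1≤m m≤n) ⟩
  1ℚ                ∎))
  where open ≤-Reasoning

inv≤1 : ∀ {n} → 1 ℕ.≤ n → inv n ≤ 1ℚ
inv≤1 {n} 1≤n = subst (inv n ≤_) inv-1 (inv-antimono ℕₚ.≤-refl 1≤n)

fromℕ-∑ : ∀ {X : Set} (xs : List X) f → fromℕ (∑ℕ.∑ xs f) ≡ ∑ xs (λ x → fromℕ (f x))
fromℕ-∑ []       f = refl
fromℕ-∑ (x ∷ xs) f = trans (fromℕ-+ (f x) (∑ℕ.∑ xs f)) (cong (fromℕ (f x) +_) (fromℕ-∑ xs f))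

∑-*ˡ : ∀ {X : Set} (xs : List X) c f → ∑ xs (λ x → c * f x) ≡ c * ∑ xs f
∑-*ˡ []       c f = sym (*-zeroʳ c)
∑-*ˡ (x ∷ xs) c f = trans (cong (c * f x +_) (∑-*ˡ xs c f)) (sym (*-distribˡ-+ c (f x) (∑ xs f)))

∑-*ʳ : ∀ {X : Set} (xs : List X) c f → ∑ xs (λ x → f x * c) ≡ ∑ xs f * c
∑-*ʳ xs c f = trans (∑-cong xs (λ x → *-comm (f x) c)) (trans (∑-*ˡ xs c f) (*-comm c (∑ xs f)))

∑-constℚ : ∀ {X : Set} (xs : List X) c → ∑ xs (const c) ≡ fromℕ (length xs) * c
∑-constℚ []       c = sym (*-zeroˡ c)
∑-constℚ (x ∷ xs) c = begin
  c + ∑ xs (const c)               ≡⟨ cong (_+_ c) (∑-constℚ xs c) ⟩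
  c + fromℕ (length xs) * c        ≡⟨ lem c (fromℕ (length xs)) ⟩
  (1ℚ + fromℕ (length xs)) * c     ≡⟨ cong (_* c) (fromℕ-suc (length xs)) ⟨
  fromℕ (suc (length xs)) * c      ∎
  where
  open ≡-Reasoning
  lem : ∀ c n → c + n * c ≡ (1ℚ + n) * c
  lem = solve-∀ ℚ-ring

Π : ∀ {X : Set} → List X → (X → ℚ) → ℚ
Π []       f = 1ℚ
Π (x ∷ xs) f = f x * Π xs f

module _ {X : Set} where

  Π-++ : ∀ (xs ys : List X) f → Π (xs ++ ys) f ≡ Π xs f * Π ys f
  Π-++ []       ys f = sym (*-identityˡ (Π ys f))
  Π-++ (x ∷ xs) ys f = trans (cong (f x *_) (Π-++ xs ys f)) (sym (*-assoc (f x) (Π xs f) (Π ys f)))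

  Π-* : ∀ (xs : List X) f g → Π xs (λ x → f x * g x) ≡ Π xs f * Π xs g
  Π-* []       f g = refl
  Π-* (x ∷ xs) f g = trans (cong (f x * g x *_) (Π-* xs f g)) (lem (f x) (g x) (Π xs f) (Π xs g))
    where
    lem : ∀ a b c d → a * b * (c * d) ≡ (a * c) * (b * d)
    lem = solve-∀ ℚ-ring

  Π-nonNeg : ∀ (xs : List X) {f} → (∀ {x} → x ∈ xs → 0ℚ ≤ f x) → 0ℚ ≤ Π xs f
  Π-nonNeg []       0≤f = fromℕ-mono {0} {1} z≤n
  Π-nonNeg (x ∷ xs) 0≤f = 0≤-* (0≤f (here refl)) (Π-nonNeg xs (λ x∈ → 0≤f (there x∈)))

  Π-cong : ∀ (xs : List X) {f g} → (∀ x → f x ≡ g x) → Π xs f ≡ Π xs g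
  Π-cong []       f≡g = refl
  Π-cong (x ∷ xs) f≡g = cong₂ _*_ (f≡g x) (Π-cong xs f≡g)

  -- Weierstrass's product inequality; the cross term `f x * ∑ xs f` given away at each step is
  -- nonnegative.
  1-∑≤Π[1-] : ∀ (xs : List X) f → (∀ {x} → x ∈ xs → 0ℚ ≤ f x × f x ≤ 1ℚ) → 1ℚ - ∑ xs f ≤ Π xs (λ x → 1ℚ - f x)
  1-∑≤Π[1-] []       f bounds = ≤-refl
  1-∑≤Π[1-] (x ∷ xs) f bounds = begin
    1ℚ - (f x + ∑ xs f)                        ≤⟨ p≤p+q (0≤-* (proj₁ (bounds (here refl))) 0≤∑) ⟩
    1ℚ - (f x + ∑ xs f) + f x * ∑ xs f         ≡⟨ lem (f x) (∑ xs f) ⟩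
    (1ℚ - f x) * (1ℚ - ∑ xs f)                 ≤⟨ *-mono-≤ˡ (1ℚ - f x) (p≤q⇒0≤q-p (proj₂ (bounds (here refl))))
                                                    (1-∑≤Π[1-] xs f (λ x∈ → bounds (there x∈))) ⟩
    (1ℚ - f x) * Π xs (λ x → 1ℚ - f x)         ∎
    where
    open ≤-Reasoning
    lem : ∀ a b → 1ℚ - (a + b) + a * b ≡ (1ℚ - a) * (1ℚ - b)
    lem = solve-∀ ℚ-ring
    0≤∑ : 0ℚ ≤ ∑ xs f
    0≤∑ = ≤-trans (≤-reflexive (sym (trans (∑-constℚ xs 0ℚ) (*-zeroʳ (fromℕ (length xs))))))
      (∑-mono xs (λ x∈ → proj₁ (bounds (there x∈))))

-- Harmonic and telescoping sums

-- The block from 2^K + 1 to 2^(K+1) has 2^K terms, each at most 1/2^K.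
harmonic≤ : ∀ K → ∑ [1⋯ 2 ℕ.^ K ] inv ≤ 1ℚ + fromℕ K
harmonic≤ zero    = ≤-reflexive (cong (_+ 0ℚ) inv-1)
harmonic≤ (suc K) = begin
  ∑ [1⋯ 2 ℕ.^ suc K ] inv                           ≤⟨ ∑-⊆ ([1⋯]-unique (2 ℕ.^ suc K)) inv-nonNeg split ⟩
  ∑ ([1⋯ x ] ++ map (x ℕ.+_) [1⋯ x ]) inv           ≡⟨ trans (∑-++ [1⋯ x ] (map (x ℕ.+_) [1⋯ x ]) inv) (cong (_+_ (∑ [1⋯ x ] inv)) (∑-map (x ℕ.+_) [1⋯ x ] inv)) ⟩
  ∑ [1⋯ x ] inv + ∑ [1⋯ x ] (λ i → inv (x ℕ.+ i))   ≤⟨ +-mono-≤ (harmonic≤ K) (∑-mono [1⋯ x ] (λ {i} _ → inv-antimono 1≤x (ℕₚ.m≤m+n x i))) ⟩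
  (1ℚ + fromℕ K) + ∑ [1⋯ x ] (const (inv x))        ≡⟨ cong (_+_ (1ℚ + fromℕ K)) (trans (∑-constℚ [1⋯ x ] (inv x))
                                                         (trans (cong (λ l → fromℕ l * inv x) (length-[1⋯] x)) (fromℕ*inv x 1≤x))) ⟩
  (1ℚ + fromℕ K) + 1ℚ                               ≡⟨ cong (_+ 1ℚ) (sym (fromℕ-suc K)) ⟩
  fromℕ (suc K) + 1ℚ                                ≡⟨ +-comm (fromℕ (suc K)) 1ℚ ⟩
  1ℚ + fromℕ (suc K)                                ∎
  where
  open ≤-Reasoning
  x = 2 ℕ.^ K
  1≤x : 1 ℕ.≤ x
  1≤x = ℕₚ.m^n>0 2 K
  split : ∀ {i} → i ∈ [1⋯ 2 ℕ.^ suc K ] → i ∈ [1⋯ x ] ++ map (x ℕ.+_) [1⋯ x ]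
  split {i} i∈ with ∈-[1⋯]⁻ i∈ | i ℕₚ.≤? x
  ... | 1≤i , _   | yes i≤x = ∈-++⁺ˡ (∈-[1⋯]⁺ 1≤i i≤x)
  ... | _ , i≤2x | no i≰x = ∈-++⁺ʳ [1⋯ x ] (subst (_∈ map (x ℕ.+_) [1⋯ x ]) (ℕₚ.m+[n∸m]≡n (ℕₚ.<⇒≤ x<i))
        (∈-map⁺ (x ℕ.+_) (∈-[1⋯]⁺ (ℕₚ.m<n⇒0<n∸m x<i)
          (ℕₚ.≤-trans (ℕₚ.∸-monoˡ-≤ x i≤2x) (ℕₚ.≤-reflexive (trans (ℕₚ.m+n∸m≡n x (x ℕ.+ 0)) (ℕₚ.+-identityʳ x)))))))
    where
    x<i = ℕₚ.≰⇒> i≰x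

∑-[1⋯suc] : ∀ M f → (∀ n → 0ℚ ≤ f n) → ∑ [1⋯ suc M ] f ≤ ∑ [1⋯ M ] f + f (suc M)
∑-[1⋯suc] M f 0≤f = begin
  ∑ [1⋯ suc M ] f                   ≤⟨ ∑-⊆ ([1⋯]-unique (suc M)) 0≤f snoc ⟩
  ∑ ([1⋯ M ] ++ suc M ∷ []) f       ≡⟨ ∑-++ [1⋯ M ] (suc M ∷ []) f ⟩
  ∑ [1⋯ M ] f + (f (suc M) + 0ℚ)    ≡⟨ cong (_+_ (∑ [1⋯ M ] f)) (+-identityʳ (f (suc M))) ⟩
  ∑ [1⋯ M ] f + f (suc M)           ∎
  where
  open ≤-Reasoning
  snoc : ∀ {i} → i ∈ [1⋯ suc M ] → i ∈ [1⋯ M ] ++ suc M ∷ []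
  snoc {i} i∈ with ∈-[1⋯]⁻ i∈
  ... | 1≤i , i≤1+M with ℕₚ.m≤n⇒m<n∨m≡n i≤1+M
  ...   | inj₁ (s≤s i≤M) = ∈-++⁺ˡ (∈-[1⋯]⁺ 1≤i i≤M)
  ...   | inj₂ refl      = ∈-++⁺ʳ [1⋯ M ] (here refl)

-- The differences of `w` dominate f at every integer from 2 on, so the bound holds for any set of
-- such integers, however large.
telescope : ∀ (f w : ℕ → ℚ) → (∀ n → 0ℚ ≤ f n) → (∀ n → 0ℚ ≤ w n) →
  (∀ i → 1 ℕ.≤ i → f (suc i) ≤ w i - w (suc i)) →
  ∀ {ns} → Unique ns → (∀ {n} → n ∈ ns → 2 ℕ.≤ n) → ∑ ns f ≤ w 1
telescope f w 0≤f 0≤w step {ns} uns 2≤ns = begin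
  ∑ ns f                                 ≤⟨ ∑-⊆ uns 0≤f ns⊆ ⟩
  ∑ (map suc [1⋯ M ]) f                  ≡⟨ ∑-map suc [1⋯ M ] f ⟩
  ∑ [1⋯ M ] (f ∘ suc)                    ≤⟨ partial M ⟩
  w 1 - w (suc M)                        ≤⟨ p≤p+q (0≤w (suc M)) ⟩
  w 1 - w (suc M) + w (suc M)            ≡⟨ lem (w 1) (w (suc M)) ⟩
  w 1                                    ∎
  where
  open ≤-Reasoning
  lem : ∀ a b → a - b + b ≡ a
  lem = solve-∀ ℚ-ring
  lem₂ : ∀ a b c → (a - b) + (b - c) ≡ a - c
  lem₂ = solve-∀ ℚ-ring
  -- The sum of the list is a crude bound for each of its members.
  M = ∑ℕ.∑ ns (λ n → n)
  ∈⇒≤∑ : ∀ {n} ns → n ∈ ns → n ℕ.≤ ∑ℕ.∑ ns (λ n → n)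
  ∈⇒≤∑ (n ∷ ns) (here refl) = ℕₚ.m≤m+n n _
  ∈⇒≤∑ (m ∷ ns) (there n∈)  = ℕₚ.≤-trans (∈⇒≤∑ ns n∈) (ℕₚ.m≤n+m _ m)
  ns⊆ : ∀ {n} → n ∈ ns → n ∈ map suc [1⋯ M ]
  ns⊆ {n} n∈ with n | 2≤ns n∈ | ∈⇒≤∑ ns n∈
  ... | suc m | s≤s 1≤m | m<M = ∈-map⁺ suc (∈-[1⋯]⁺ 1≤m (ℕₚ.<⇒≤ m<M))
  partial : ∀ M → ∑ [1⋯ M ] (f ∘ suc) ≤ w 1 - w (suc M)
  partial zero    = ≤-reflexive (sym (+-inverseʳ (w 1)))
  partial (suc M) = begin
    ∑ [1⋯ suc M ] (f ∘ suc)                        ≤⟨ ∑-[1⋯suc] M (f ∘ suc) (λ n → 0≤f (suc n)) ⟩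
    ∑ [1⋯ M ] (f ∘ suc) + f (suc (suc M))          ≤⟨ +-mono-≤ (partial M) (step (suc M) (s≤s z≤n)) ⟩
    (w 1 - w (suc M)) + (w (suc M) - w (suc (suc M))) ≡⟨ lem₂ (w 1) (w (suc M)) (w (suc (suc M))) ⟩
    w 1 - w (suc (suc M))                          ∎

-- The exponential series

psum : (ℕ → ℚ) → ℕ → ℚ
psum f zero    = 0ℚ
psum f (suc n) = psum f n + f n

expSum≡psum : ∀ q n → expSum q n ≡ psum (expTerm q) n
expSum≡psum q zero    = refl
expSum≡psum q (suc n) = cong (_+ expTerm q n) (expSum≡psum q n)

psum-suc : ∀ f n → psum f (suc n) ≡ f 0 + psum (f ∘ suc) n
psum-suc f zero    = +-comm 0ℚ (f 0)
psum-suc f (suc n) = trans (cong (_+ f (suc n)) (psum-suc f n)) (+-assoc (f 0) (psum (f ∘ suc) n) (f (suc n)))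

psum-nonNeg : ∀ {f} → (∀ i → 0ℚ ≤ f i) → ∀ n → 0ℚ ≤ psum f n
psum-nonNeg 0≤f zero    = ≤-refl
psum-nonNeg 0≤f (suc n) = 0≤-+ (psum-nonNeg 0≤f n) (0≤f n)

-- The n-th coefficient of the Cauchy product; shifting f corresponds to splitting its power series
-- as f 0 + X · (shifted series).
conv : (ℕ → ℚ) → (ℕ → ℚ) → ℕ → ℚ
conv f g zero    = f 0 * g 0
conv f g (suc n) = f 0 * g (suc n) + conv (f ∘ suc) g n

conv-cong : ∀ {f f′ g g′} → (∀ i → f i ≡ f′ i) → (∀ i → g i ≡ g′ i) → ∀ n → conv f g n ≡ conv f′ g′ n
conv-cong f≡ g≡ zero    = cong₂ _*_ (f≡ 0) (g≡ 0)
conv-cong f≡ g≡ (suc n) = cong₂ _+_ (cong₂ _*_ (f≡ 0) (g≡ (suc n))) (conv-cong (λ i → f≡ (suc i)) g≡ n)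

conv-+ˡ : ∀ f f′ g n → conv (λ i → f i + f′ i) g n ≡ conv f g n + conv f′ g n
conv-+ˡ f f′ g zero    = *-distribʳ-+ (g 0) (f 0) (f′ 0)
conv-+ˡ f f′ g (suc n) = trans (cong (_+_ ((f 0 + f′ 0) * g (suc n))) (conv-+ˡ (f ∘ suc) (f′ ∘ suc) g n))
  (lem (f 0) (f′ 0) (g (suc n)) (conv (f ∘ suc) g n) (conv (f′ ∘ suc) g n))
  where
  lem : ∀ a b c d e → (a + b) * c + (d + e) ≡ (a * c + d) + (b * c + e)
  lem = solve-∀ ℚ-ring

conv-+ʳ : ∀ f g g′ n → conv f (λ i → g i + g′ i) n ≡ conv f g n + conv f g′ n
conv-+ʳ f g g′ zero    = *-distribˡ-+ (f 0) (g 0) (g′ 0)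
conv-+ʳ f g g′ (suc n) = trans (cong (_+_ (f 0 * (g (suc n) + g′ (suc n)))) (conv-+ʳ (f ∘ suc) g g′ n))
  (lem (f 0) (g (suc n)) (g′ (suc n)) (conv (f ∘ suc) g n) (conv (f ∘ suc) g′ n))
  where
  lem : ∀ a b c d e → a * (b + c) + (d + e) ≡ (a * b + d) + (a * c + e)
  lem = solve-∀ ℚ-ring

conv-*ˡ : ∀ c f g n → conv (λ i → c * f i) g n ≡ c * conv f g n
conv-*ˡ c f g zero    = *-assoc c (f 0) (g 0)
conv-*ˡ c f g (suc n) = trans (cong (_+_ (c * f 0 * g (suc n))) (conv-*ˡ c (f ∘ suc) g n))
  (lem c (f 0) (g (suc n)) (conv (f ∘ suc) g n))
  where
  lem : ∀ c a b d → c * a * b + c * d ≡ c * (a * b + d)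
  lem = solve-∀ ℚ-ring

conv-*ʳ : ∀ c f g n → conv f (λ i → c * g i) n ≡ c * conv f g n
conv-*ʳ c f g zero    = lem c (f 0) (g 0)
  where
  lem : ∀ c a b → a * (c * b) ≡ c * (a * b)
  lem = solve-∀ ℚ-ring
conv-*ʳ c f g (suc n) = trans (cong (_+_ (f 0 * (c * g (suc n)))) (conv-*ʳ c (f ∘ suc) g n))
  (lem c (f 0) (g (suc n)) (conv (f ∘ suc) g n))
  where
  lem : ∀ c a b d → a * (c * b) + c * d ≡ c * (a * b + d)
  lem = solve-∀ ℚ-ring

-- The coefficients of the formal derivative of the generating function of f.
δ : (ℕ → ℚ) → ℕ → ℚ
δ f n = fromℕ (suc n) * f (suc n)

-- The Leibniz rule. With f = f 0 + X f′, the derivative of f g is f 0 times that of g, plus f′ g,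
-- plus X times the derivative of f′ g; the last is the induction hypothesis. Accordingly n + 2 is
-- split as 1 + (n + 1).
δ-conv : ∀ f g n → δ (conv f g) n ≡ conv (δ f) g n + conv f (δ g) n
δ-conv f g zero    = lem (f 0) (f 1) (g 0) (g 1)
  where
  lem : ∀ a b c d → 1ℚ * (a * d + b * c) ≡ 1ℚ * b * c + a * (1ℚ * d)
  lem = solve-∀ ℚ-ring
δ-conv f g (suc n) = begin
  N₂ * (f 0 * g₂ + (f 1 * g₁ + c″))
    ≡⟨ cong (_* (f 0 * g₂ + (f 1 * g₁ + c″))) (fromℕ-suc (suc n)) ⟩
  (1ℚ + N₁) * (f 0 * g₂ + (f 1 * g₁ + c″))
    ≡⟨ expand N₁ (f 0) g₂ (f 1) g₁ c″ ⟩
  (f 1 * g₁ + c″) + f 0 * ((1ℚ + N₁) * g₂) + N₁ * (f 1 * g₁ + c″)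
    ≡⟨ cong₂ _+_ (cong (λ z → (f 1 * g₁ + c″) + f 0 * (z * g₂)) (sym (fromℕ-suc (suc n)))) (δ-conv f′ g n) ⟩
  (f 1 * g₁ + c″) + f 0 * (N₂ * g₂) + (conv (δ f′) g n + conv f′ (δ g) n)
    ≡⟨ regroup (f 1) g₁ c″ (f 0 * (N₂ * g₂)) (conv (δ f′) g n) (conv f′ (δ g) n) ⟩
  (1ℚ * f 1 * g₁ + (c″ + conv (δ f′) g n)) + (f 0 * (N₂ * g₂) + conv f′ (δ g) n)
    ≡⟨ cong (λ z → (1ℚ * f 1 * g₁ + z) + (f 0 * (N₂ * g₂) + conv f′ (δ g) n))
         (trans (sym (conv-+ˡ f″ (δ f′) g n)) (conv-cong shifted (λ _ → refl) n)) ⟩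
  (δ f 0 * g₁ + conv (δ f ∘ suc) g n) + (f 0 * (N₂ * g₂) + conv f′ (δ g) n) ∎
  where
  open ≡-Reasoning
  N₁ = fromℕ (suc n)
  N₂ = fromℕ (suc (suc n))
  g₁ = g (suc n)
  g₂ = g (suc (suc n))
  f′ = f ∘ suc
  f″ = f′ ∘ suc
  c″ = conv f″ g n
  expand : ∀ N a b c d e → (1ℚ + N) * (a * b + (c * d + e)) ≡ (c * d + e) + a * ((1ℚ + N) * b) + N * (c * d + e)
  expand = solve-∀ ℚ-ring
  regroup : ∀ a b c d e f → (a * b + c) + d + (e + f) ≡ (1ℚ * a * b + (c + e)) + (d + f)
  regroup = solve-∀ ℚ-ring
  shifted : ∀ i → f″ i + δ f′ i ≡ δ f (suc i)
  shifted i = trans (lem (f″ i) (fromℕ (suc i))) (cong (_* f″ i) (sym (fromℕ-suc (suc i))))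
    where
    lem : ∀ a n → a + n * a ≡ (1ℚ + n) * a
    lem = solve-∀ ℚ-ring

1/!≡inv : ∀ n → 1/[ n ]! ≡ inv (n ℕ.!)
1/!≡inv n = inv≡ (n ℕ.!) {{n ℕₚ.!≢0}}

1≤n! : ∀ n → 1 ℕ.≤ n ℕ.!
1≤n! n = ℕ.>-nonZero⁻¹ (n ℕ.!) {{n ℕₚ.!≢0}}

1/!-suc : ∀ n → fromℕ (suc n) * 1/[ suc n ]! ≡ 1/[ n ]!
1/!-suc n = begin
  fromℕ (suc n) * 1/[ suc n ]!                  ≡⟨ cong (fromℕ (suc n) *_) (trans (1/!≡inv (suc n)) (inv-* (suc n) (n ℕ.!) (s≤s z≤n) (1≤n! n))) ⟩
  fromℕ (suc n) * (inv (suc n) * inv (n ℕ.!))   ≡⟨ *-assoc (fromℕ (suc n)) (inv (suc n)) (inv (n ℕ.!)) ⟨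
  fromℕ (suc n) * inv (suc n) * inv (n ℕ.!)     ≡⟨ cong (_* inv (n ℕ.!)) (fromℕ*inv (suc n) (s≤s z≤n)) ⟩
  1ℚ * inv (n ℕ.!)                              ≡⟨ *-identityˡ (inv (n ℕ.!)) ⟩
  inv (n ℕ.!)                                   ≡⟨ 1/!≡inv n ⟨
  1/[ n ]!                                      ∎
  where open ≡-Reasoning

δ-expTerm : ∀ q n → δ (expTerm q) n ≡ q * expTerm q n
δ-expTerm q n = begin
  fromℕ (suc n) * (q * q ^ n * 1/[ suc n ]!)     ≡⟨ lem (fromℕ (suc n)) q (q ^ n) 1/[ suc n ]! ⟩
  q * (q ^ n * (fromℕ (suc n) * 1/[ suc n ]!))   ≡⟨ cong (λ z → q * (q ^ n * z)) (1/!-suc n) ⟩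
  q * (q ^ n * 1/[ n ]!)                         ∎
  where
  open ≡-Reasoning
  lem : ∀ m q x c → m * (q * x * c) ≡ q * (x * (m * c))
  lem = solve-∀ ℚ-ring

-- Both sides satisfy (n + 1) u (n + 1) = (a + b) u n.
conv-expTerm : ∀ a b n → conv (expTerm a) (expTerm b) n ≡ expTerm (a + b) n
conv-expTerm a b zero    = refl
conv-expTerm a b (suc n) = *-cancelˡ-≡-pos (fromℕ (suc n)) (0<fromℕ (suc n) (s≤s z≤n)) (begin
  δ (conv e f) n                              ≡⟨ δ-conv e f n ⟩
  conv (δ e) f n + conv e (δ f) n             ≡⟨ cong₂ _+_
    (trans (conv-cong (δ-expTerm a) (λ _ → refl) n) (conv-*ˡ a e f n))
    (trans (conv-cong {e} (λ _ → refl) (δ-expTerm b) n) (conv-*ʳ b e f n)) ⟩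
  a * conv e f n + b * conv e f n             ≡⟨ *-distribʳ-+ (conv e f n) a b ⟨
  (a + b) * conv e f n                        ≡⟨ cong ((a + b) *_) (conv-expTerm a b n) ⟩
  (a + b) * expTerm (a + b) n                 ≡⟨ δ-expTerm (a + b) n ⟨
  δ (expTerm (a + b)) n                       ∎)
  where
  open ≡-Reasoning
  e = expTerm a
  f = expTerm b
  *-cancelˡ-≡-pos : ∀ c {x y} → 0ℚ < c → c * x ≡ c * y → x ≡ y
  *-cancelˡ-≡-pos c 0<c eq = ≤-antisym (*-cancel-≤ˡ c 0<c (≤-reflexive eq)) (*-cancel-≤ˡ c 0<c (≤-reflexive (sym eq)))

-- Both sides sum f i · g j over the triangle i + j ≤ n, by rows on the left and by antidiagonals on
-- the right.
conv-psum : ∀ f g n → conv f (λ i → psum g (suc i)) n ≡ psum (conv f g) (suc n)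
conv-psum f g zero    = lem (f 0) (g 0)
  where
  lem : ∀ a b → a * (0ℚ + b) ≡ 0ℚ + a * b
  lem = solve-∀ ℚ-ring
conv-psum f g (suc n) = trans (step f n) (cong (_+ conv f g (suc n)) (conv-psum f g n))
  where
  G = λ i → psum g (suc i)
  step : ∀ f n → conv f G (suc n) ≡ conv f G n + conv f g (suc n)
  step f zero    = lem (f 0) (g 0) (g 1) (f 1)
    where
    lem : ∀ a b c d → a * (0ℚ + b + c) + d * (0ℚ + b) ≡ a * (0ℚ + b) + (a * c + d * b)
    lem = solve-∀ ℚ-ring
  step f (suc n) = trans (cong (_+_ (f 0 * G (suc (suc n)))) (step (f ∘ suc) n))
    (lem (f 0) (G (suc n)) (g (suc (suc n))) (conv (f ∘ suc) G n) (conv (f ∘ suc) g (suc n)))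
    where
    lem : ∀ a b c d e → a * (b + c) + (d + e) ≡ (a * b + d) + (a * c + e)
    lem = solve-∀ ℚ-ring

conv-expSum : ∀ a b n → conv (expTerm a) (λ i → expSum b (suc i)) n ≡ expSum (a + b) (suc n)
conv-expSum a b n = begin
  conv (expTerm a) (λ i → expSum b (suc i)) n             ≡⟨ conv-cong {expTerm a} (λ _ → refl) (λ i → expSum≡psum b (suc i)) n ⟩
  conv (expTerm a) (λ i → psum (expTerm b) (suc i)) n     ≡⟨ conv-psum (expTerm a) (expTerm b) n ⟩
  psum (conv (expTerm a) (expTerm b)) (suc n)             ≡⟨ psum-cong (conv-expTerm a b) (suc n) ⟩
  psum (expTerm (a + b)) (suc n)                          ≡⟨ expSum≡psum (a + b) (suc n) ⟨
  expSum (a + b) (suc n)                                  ∎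
  where
  open ≡-Reasoning
  psum-cong : ∀ {f g} → (∀ i → f i ≡ g i) → ∀ n → psum f n ≡ psum g n
  psum-cong f≡g zero    = refl
  psum-cong f≡g (suc n) = cong₂ _+_ (psum-cong f≡g n) (f≡g n)

-- The triangle is compared with the square: row i carries M (n - i), which monotonicity raises to M
-- n.
conv≤psum* : ∀ f M → (∀ i → 0ℚ ≤ f i) → (∀ i → M i ≤ M (suc i)) → ∀ n → conv f M n ≤ psum f (suc n) * M n
conv≤psum* f M 0≤f M↑ zero    = ≤-reflexive (cong (_* M 0) (sym (+-identityˡ (f 0))))
conv≤psum* f M 0≤f M↑ (suc n) = begin
  f 0 * M (suc n) + conv (f ∘ suc) M n               ≤⟨ +-monoʳ-≤ (f 0 * M (suc n)) (conv≤psum* (f ∘ suc) M (λ i → 0≤f (suc i)) M↑ n) ⟩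
  f 0 * M (suc n) + P * M n                          ≤⟨ +-monoʳ-≤ (f 0 * M (suc n)) (*-mono-≤ˡ P (psum-nonNeg (λ i → 0≤f (suc i)) (suc n)) (M↑ n)) ⟩
  f 0 * M (suc n) + P * M (suc n)                    ≡⟨ *-distribʳ-+ (M (suc n)) (f 0) P ⟨
  (f 0 + P) * M (suc n)                              ≡⟨ cong (_* M (suc n)) (psum-suc f (suc n)) ⟨
  psum f (suc (suc n)) * M (suc n)                   ∎
  where
  open ≤-Reasoning
  P = psum (f ∘ suc) (suc n)

-- The rectangle i ≤ n, j ≤ m lies inside the triangle i + j ≤ n + m when G consists of partial
-- sums; for general G, monotonicity plays this role.
psum*≤conv : ∀ f G → (∀ i → 0ℚ ≤ f i) → (∀ i → 0ℚ ≤ G i) → (∀ i → G i ≤ G (suc i)) →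
  ∀ n m → psum f (suc n) * G m ≤ conv f G (n ℕ.+ m)
psum*≤conv f G 0≤f 0≤G G↑ zero zero = ≤-reflexive (cong (_* G 0) (+-identityˡ (f 0)))
psum*≤conv f G 0≤f 0≤G G↑ zero (suc m) = begin
  (0ℚ + f 0) * G (suc m)                  ≡⟨ cong (_* G (suc m)) (+-identityˡ (f 0)) ⟩
  f 0 * G (suc m)                         ≤⟨ p≤p+q (conv-nonNeg (f ∘ suc) (λ i → 0≤f (suc i)) m) ⟩
  f 0 * G (suc m) + conv (f ∘ suc) G m    ∎
  where
  open ≤-Reasoning
  conv-nonNeg : ∀ f → (∀ i → 0ℚ ≤ f i) → ∀ n → 0ℚ ≤ conv f G n
  conv-nonNeg f 0≤f zero    = 0≤-* (0≤f 0) (0≤G 0)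
  conv-nonNeg f 0≤f (suc n) = 0≤-+ (0≤-* (0≤f 0) (0≤G (suc n))) (conv-nonNeg (f ∘ suc) (λ i → 0≤f (suc i)) n)
psum*≤conv f G 0≤f 0≤G G↑ (suc n) m = begin
  psum f (suc (suc n)) * G m                        ≡⟨ cong (_* G m) (psum-suc f (suc n)) ⟩
  (f 0 + P) * G m                                   ≡⟨ *-distribʳ-+ (G m) (f 0) P ⟩
  f 0 * G m + P * G m                               ≤⟨ +-mono-≤ (*-mono-≤ˡ (f 0) (0≤f 0) (G-mono (suc n))) (psum*≤conv (f ∘ suc) G (λ i → 0≤f (suc i)) 0≤G G↑ n m) ⟩
  f 0 * G (suc n ℕ.+ m) + conv (f ∘ suc) G (n ℕ.+ m) ∎
  where
  open ≤-Reasoning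
  P = psum (f ∘ suc) (suc n)
  G-mono : ∀ k → G m ≤ G (k ℕ.+ m)
  G-mono zero    = ≤-refl
  G-mono (suc k) = ≤-trans (G-mono k) (G↑ (k ℕ.+ m))

^-nonNeg : ∀ {q} → 0ℚ ≤ q → ∀ n → 0ℚ ≤ q ^ n
^-nonNeg 0≤q zero    = 0≤fromℕ 1
^-nonNeg 0≤q (suc n) = 0≤-* 0≤q (^-nonNeg 0≤q n)

1/!-nonNeg : ∀ n → 0ℚ ≤ 1/[ n ]!
1/!-nonNeg n = subst (0ℚ ≤_) (sym (1/!≡inv n)) (inv-nonNeg (n ℕ.!))

expTerm-nonNeg : ∀ {q} → 0ℚ ≤ q → ∀ n → 0ℚ ≤ expTerm q n
expTerm-nonNeg 0≤q n = 0≤-* (^-nonNeg 0≤q n) (1/!-nonNeg n)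

expSum-nonNeg : ∀ {q} → 0ℚ ≤ q → ∀ n → 0ℚ ≤ expSum q n
expSum-nonNeg {q} 0≤q n = subst (0ℚ ≤_) (sym (expSum≡psum q n)) (psum-nonNeg (expTerm-nonNeg 0≤q) n)

expSum-+-≤ : ∀ {a b} → 0ℚ ≤ a → 0ℚ ≤ b → ∀ n → expSum (a + b) n ≤ expSum a n * expSum b n
expSum-+-≤ {a} {b} 0≤a 0≤b zero    = ≤-reflexive (sym (*-zeroʳ 0ℚ))
expSum-+-≤ {a} {b} 0≤a 0≤b (suc n) = begin
  expSum (a + b) (suc n)                                ≡⟨ conv-expSum a b n ⟨
  conv (expTerm a) (λ i → expSum b (suc i)) n           ≤⟨ conv≤psum* (expTerm a) (λ i → expSum b (suc i)) (expTerm-nonNeg 0≤a)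
                                                             (λ i → p≤p+q (expTerm-nonNeg 0≤b (suc i))) n ⟩
  psum (expTerm a) (suc n) * expSum b (suc n)           ≡⟨ cong (_* expSum b (suc n)) (expSum≡psum a (suc n)) ⟨
  expSum a (suc n) * expSum b (suc n)                   ∎
  where open ≤-Reasoning

-- The square [0, n]² minus the triangle i + j ≤ n lies in the shell n < i + j ≤ 2n, and the
-- terms there are bounded by those of the exponential series at 2h.
expSum*expSum-≥ : ∀ {h} → 0ℚ ≤ h → ∀ n →
  expSum (h - h) (suc n) - (expSum (h + h) (suc (n ℕ.+ n)) - expSum (h + h) (suc n)) ≤ expSum h (suc n) * expSum (- h) (suc n)
expSum*expSum-≥ {h} 0≤h n = begin
  expSum (h - h) (suc n) - (expSum (h + h) (suc (n ℕ.+ n)) - expSum (h + h) (suc n))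
    ≡⟨ cong₂ _-_ (sym (conv-expSum h (- h) n)) (cong₂ _-_ (sym (conv-expSum h h (n ℕ.+ n))) (sym (conv-expSum h h n))) ⟩
  conv f G n - (conv f Ĝ (n ℕ.+ n) - conv f Ĝ n)
    ≤⟨ +-monoʳ-≤ (conv f G n) (neg-antimono-≤ (+-monoˡ-≤ (- conv f Ĝ n) square≤)) ⟩
  conv f G n - (A * Ĝ n - conv f Ĝ n)
    ≡⟨ lem₁ (conv f G n) (A * Ĝ n) (conv f Ĝ n) ⟩
  (conv f G n + conv f Ĝ n) - A * Ĝ n
    ≡⟨ cong (_- A * Ĝ n) (conv-+ʳ f G Ĝ n) ⟨
  conv f M n - A * Ĝ n
    ≤⟨ +-monoˡ-≤ (- (A * Ĝ n)) (conv≤psum* f M 0≤f M↑ n) ⟩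
  A * M n - A * Ĝ n
    ≡⟨ lem₂ A (G n) (Ĝ n) ⟩
  A * G n
    ≡⟨ cong (_* G n) (expSum≡psum h (suc n)) ⟨
  expSum h (suc n) * expSum (- h) (suc n) ∎
  where
  open ≤-Reasoning
  f  = expTerm h
  G  = λ i → expSum (- h) (suc i)
  Ĝ  = λ i → expSum h (suc i)
  -- The partial sums `G` of exp(-h) alternate. Adding `Ĝ` makes them monotone, so that `conv≤psum*`
  -- applies; the added `A * Ĝ n` is subtracted again afterwards.
  M  = λ i → G i + Ĝ i
  A  = psum f (suc n)
  0≤f = expTerm-nonNeg 0≤h
  lem₁ : ∀ a b c → a - (b - c) ≡ (a + c) - b
  lem₁ = solve-∀ ℚ-ring
  lem₂ : ∀ a b c → a * (b + c) - a * c ≡ a * b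
  lem₂ = solve-∀ ℚ-ring
  lem₃ : ∀ a b c d → (a + c) + (b + d) ≡ (a + b) + (c + d)
  lem₃ = solve-∀ ℚ-ring
  square≤ : A * Ĝ n ≤ conv f Ĝ (n ℕ.+ n)
  square≤ = psum*≤conv f Ĝ 0≤f (λ i → expSum-nonNeg 0≤h (suc i)) (λ i → p≤p+q (expTerm-nonNeg 0≤h (suc i))) n n
  -- The two halves of |(-h)^i| ≤ h^i are proved together, since multiplication by h exchanges them.
  ^-alternate : ∀ i → 0ℚ ≤ (- h) ^ i + h ^ i × 0ℚ ≤ h ^ i - (- h) ^ i
  ^-alternate zero    = (0≤fromℕ 2) , ≤-refl
  ^-alternate (suc i) = subst (0ℚ ≤_) (lem₄ h ((- h) ^ i) (h ^ i)) (0≤-* 0≤h (proj₂ (^-alternate i))) ,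
                        subst (0ℚ ≤_) (lem₅ h ((- h) ^ i) (h ^ i)) (0≤-* 0≤h (proj₁ (^-alternate i)))
    where
    lem₄ : ∀ h x y → h * (y - x) ≡ (- h) * x + h * y
    lem₄ = solve-∀ ℚ-ring
    lem₅ : ∀ h x y → h * (x + y) ≡ h * y - (- h) * x
    lem₅ = solve-∀ ℚ-ring
  M↑ : ∀ i → M i ≤ M (suc i)
  M↑ i = begin
    G i + Ĝ i                                                     ≤⟨ p≤p+q (subst (0ℚ ≤_) (*-distribʳ-+ 1/[ suc i ]! ((- h) ^ suc i) (h ^ suc i))
                                                                       (0≤-* (proj₁ (^-alternate (suc i))) (1/!-nonNeg (suc i)))) ⟩
    G i + Ĝ i + (expTerm (- h) (suc i) + expTerm h (suc i))       ≡⟨ lem₃ (G i) (Ĝ i) (expTerm (- h) (suc i)) (expTerm h (suc i)) ⟨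
    M (suc i)                                                     ∎

expSum-0 : ∀ n → expSum 0ℚ (suc n) ≡ 1ℚ
expSum-0 zero    = refl
expSum-0 (suc n) = trans (cong₂ _+_ (expSum-0 n) (lem (0ℚ ^ n) 1/[ suc n ]!)) (+-identityʳ 1ℚ)
  where
  lem : ∀ x y → 0ℚ * x * y ≡ 0ℚ
  lem = solve-∀ ℚ-ring

-- Termwise comparison with the geometric series: exp t ≤ 1/(1 - t), in a form that also allows t =
-- 1.
[1-t]expSum≤1 : ∀ {t} → 0ℚ ≤ t → t ≤ 1ℚ → ∀ n → (1ℚ - t) * expSum t n ≤ 1ℚ
[1-t]expSum≤1 {t} 0≤t t≤1 n = ≤-trans (go n) (≤-trans (p≤p+q (^-nonNeg 0≤t n)) (≤-reflexive (lem₀ (t ^ n))))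
  where
  lem₀ : ∀ x → 1ℚ - x + x ≡ 1ℚ
  lem₀ = solve-∀ ℚ-ring
  lem : ∀ t x → (1ℚ - x) + (1ℚ - t) * x ≡ 1ℚ - t * x
  lem = solve-∀ ℚ-ring
  expTerm≤^ : ∀ n → expTerm t n ≤ t ^ n
  expTerm≤^ n = begin
    t ^ n * 1/[ n ]!   ≤⟨ *-mono-≤ˡ (t ^ n) (^-nonNeg 0≤t n) (subst (_≤ 1ℚ) (sym (1/!≡inv n)) (inv≤1 (1≤n! n))) ⟩
    t ^ n * 1ℚ         ≡⟨ *-identityʳ (t ^ n) ⟩
    t ^ n              ∎
    where open ≤-Reasoning
  go : ∀ n → (1ℚ - t) * expSum t n ≤ 1ℚ - t ^ n
  go zero    = ≤-reflexive (*-zeroʳ (1ℚ - t))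
  go (suc n) = begin
    (1ℚ - t) * (expSum t n + expTerm t n)                ≡⟨ *-distribˡ-+ (1ℚ - t) (expSum t n) (expTerm t n) ⟩
    (1ℚ - t) * expSum t n + (1ℚ - t) * expTerm t n       ≤⟨ +-mono-≤ (go n) (*-mono-≤ˡ (1ℚ - t) (p≤q⇒0≤q-p t≤1) (expTerm≤^ n)) ⟩
    (1ℚ - t ^ n) + (1ℚ - t) * t ^ n                      ≡⟨ lem t (t ^ n) ⟩
    1ℚ - t * t ^ n                                       ∎
    where open ≤-Reasoning

∑-inv-nonNeg : ∀ ps → 0ℚ ≤ ∑ ps inv
∑-inv-nonNeg ps = ∑-nonNeg ps inv-nonNeg

Π[1-inv]-nonNeg : ∀ ps → (∀ {p} → p ∈ ps → 1 ℕ.≤ p) → 0ℚ ≤ Π ps (λ p → 1ℚ - inv p)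
Π[1-inv]-nonNeg ps 1≤ps = Π-nonNeg ps (λ p∈ → p≤q⇒0≤q-p (inv≤1 (1≤ps p∈)))

-- The inequality (1 - 1/p) exp(1/p) ≤ 1 multiplied over all p. It bounds exp(h) from above;
-- `exp[-∑inv]-lower` turns it into a lower bound for exp(-h).
Π*expSum≤1 : ∀ ps → (∀ {p} → p ∈ ps → 1 ℕ.≤ p) → ∀ n → Π ps (λ p → 1ℚ - inv p) * expSum (∑ ps inv) (suc n) ≤ 1ℚ
Π*expSum≤1 []       1≤ps n = ≤-reflexive (trans (*-identityˡ (expSum 0ℚ (suc n))) (expSum-0 n))
Π*expSum≤1 (p ∷ ps) 1≤ps n = begin
  (1ℚ - inv p) * R * expSum (inv p + ∑ ps inv) (suc n)    ≤⟨ *-mono-≤ˡ ((1ℚ - inv p) * R) (0≤-* (p≤q⇒0≤q-p inv≤) 0≤R)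
                                                              (expSum-+-≤ (inv-nonNeg p) (∑-inv-nonNeg ps) (suc n)) ⟩
  (1ℚ - inv p) * R * (E₁ * E₂)                            ≡⟨ lem (1ℚ - inv p) R E₁ E₂ ⟩
  ((1ℚ - inv p) * E₁) * (R * E₂)                          ≤⟨ *-mono-≤-nonNeg
                                                              (0≤-* (p≤q⇒0≤q-p inv≤) (expSum-nonNeg (inv-nonNeg p) (suc n)))
                                                              (0≤-* 0≤R (expSum-nonNeg (∑-inv-nonNeg ps) (suc n)))
                                                              ([1-t]expSum≤1 (inv-nonNeg p) inv≤ (suc n))
                                                              (Π*expSum≤1 ps (λ p∈ → 1≤ps (there p∈)) n) ⟩
  1ℚ                                                      ∎
  where
  open ≤-Reasoning
  inv≤ = inv≤1 (1≤ps (here refl))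
  R  = Π ps (λ p → 1ℚ - inv p)
  0≤R : 0ℚ ≤ R
  0≤R = Π[1-inv]-nonNeg ps (λ p∈ → 1≤ps (there p∈))
  E₁ = expSum (inv p) (suc n)
  E₂ = expSum (∑ ps inv) (suc n)
  lem : ∀ a b c d → a * b * (c * d) ≡ (a * c) * (b * d)
  lem = solve-∀ ℚ-ring

0≤-*-cancel : ∀ {a b c} → 0ℚ ≤ a → 0ℚ < c → c ≤ a * b → 0ℚ ≤ b
0≤-*-cancel {a} {b} {c} 0≤a 0<c c≤ab with ≤-total 0ℚ b
... | inj₁ 0≤b = 0≤b
... | inj₂ b≤0 = contradiction (<-≤-trans 0<c (≤-trans c≤ab (≤-trans (*-mono-≤ˡ a 0≤a b≤0) (≤-reflexive (*-zeroʳ a))))) (<-irrefl refl)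

p≤∣p∣ : ∀ p → p ≤ ∣ p ∣
p≤∣p∣ p with ≤-total 0ℚ p
... | inj₁ 0≤p = ≤-reflexive (sym (0≤p⇒∣p∣≡p 0≤p))
... | inj₂ p≤0 = ≤-trans p≤0 (0≤∣p∣ p)

-- For the partial sums E of exp(h) and F of exp(-h), the product E F is at least 1 minus a
-- difference of partial sums of exp(2h). The Cauchy property makes that difference at most 1 - θ
-- from some n on. Hence θ B ≤ B E F ≤ F, as B E ≤ 1.
exp[-∑inv]-lower : ∀ ps → (∀ {p} → p ∈ ps → 1 ℕ.≤ p) → ∀ θ → 0ℚ < θ → θ < 1ℚ →
  ∃ λ M → ∀ n → M ℕ.≤ n → θ * Π ps (λ p → 1ℚ - inv p) ≤ expSum (- ∑ ps inv) n
exp[-∑inv]-lower ps 1≤ps θ 0<θ θ<1 = suc M , λ { (suc n) (s≤s M≤n) → lower n M≤n }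
  where
  open ≤-Reasoning
  h = ∑ ps inv
  B = Π ps (λ p → 1ℚ - inv p)
  0≤B : 0ℚ ≤ B
  0≤B = Π[1-inv]-nonNeg ps 1≤ps
  0<1-θ : 0ℚ < 1ℚ - θ
  0<1-θ = subst (_< 1ℚ - θ) (+-inverseʳ θ) (+-monoˡ-< (- θ) θ<1)
  cauchy = isCauchy (exp (h + h)) (1ℚ - θ) 0<1-θ
  M = proj₁ cauchy
  lem₁ : ∀ θ → 1ℚ - (1ℚ - θ) ≡ θ
  lem₁ = solve-∀ ℚ-ring
  lem₂ : ∀ b e f → b * (e * f) ≡ (b * e) * f
  lem₂ = solve-∀ ℚ-ring
  module _ (n : ℕ) (M≤n : M ℕ.≤ n) where
    E = expSum h (suc n)
    F = expSum (- h) (suc n)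
    θ≤EF : θ ≤ E * F
    θ≤EF = begin
      θ                                                        ≡⟨ lem₁ θ ⟨
      1ℚ - (1ℚ - θ)                                            ≤⟨ +-monoʳ-≤ 1ℚ (neg-antimono-≤ (≤-trans (p≤∣p∣ _)
                                                                    (<⇒≤ (proj₂ cauchy (suc (n ℕ.+ n)) (suc n)
                                                                      (ℕₚ.m≤n⇒m≤1+n (ℕₚ.≤-trans M≤n (ℕₚ.m≤m+n n n))) (ℕₚ.m≤n⇒m≤1+n M≤n))))) ⟩
      1ℚ - (expSum (h + h) (suc (n ℕ.+ n)) - expSum (h + h) (suc n))
        ≡⟨ cong (_- (expSum (h + h) (suc (n ℕ.+ n)) - expSum (h + h) (suc n))) (trans (cong (λ z → expSum z (suc n)) (+-inverseʳ h)) (expSum-0 n)) ⟨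
      expSum (h - h) (suc n) - (expSum (h + h) (suc (n ℕ.+ n)) - expSum (h + h) (suc n))
        ≤⟨ expSum*expSum-≥ (∑-inv-nonNeg ps) n ⟩
      E * F                                                    ∎
    lower : θ * B ≤ F
    lower = begin
      θ * B            ≡⟨ *-comm θ B ⟩
      B * θ            ≤⟨ *-mono-≤ˡ B 0≤B θ≤EF ⟩
      B * (E * F)      ≡⟨ lem₂ B E F ⟩
      (B * E) * F      ≤⟨ *-mono-≤ʳ F (0≤-*-cancel (expSum-nonNeg (∑-inv-nonNeg ps) (suc n)) 0<θ θ≤EF) (Π*expSum≤1 ps 1≤ps n) ⟩
      1ℚ * F           ≡⟨ *-identityˡ F ⟩
      F                ∎

-- Sums over primes

inv-inv-suc : ∀ i → 1 ℕ.≤ i → inv i ≡ inv (suc i) + inv i * inv (suc i)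
inv-inv-suc i 1≤i = begin
  inv i                                               ≡⟨ *-identityʳ (inv i) ⟨
  inv i * 1ℚ                                          ≡⟨ cong (inv i *_) (fromℕ*inv (suc i) (s≤s z≤n)) ⟨
  inv i * (fromℕ (suc i) * inv (suc i))               ≡⟨ cong (λ z → inv i * (z * inv (suc i))) (fromℕ-suc i) ⟩
  inv i * ((1ℚ + fromℕ i) * inv (suc i))              ≡⟨ lem (inv i) (fromℕ i) (inv (suc i)) ⟩
  (fromℕ i * inv i) * inv (suc i) + inv i * inv (suc i) ≡⟨ cong (λ z → z * inv (suc i) + inv i * inv (suc i)) (fromℕ*inv i 1≤i) ⟩
  1ℚ * inv (suc i) + inv i * inv (suc i)              ≡⟨ cong (_+ inv i * inv (suc i)) (*-identityˡ (inv (suc i))) ⟩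
  inv (suc i) + inv i * inv (suc i)                   ∎
  where
  open ≡-Reasoning
  lem : ∀ a n b → a * ((1ℚ + n) * b) ≡ (n * a) * b + a * b
  lem = solve-∀ ℚ-ring

inv-difference : ∀ i → 1 ℕ.≤ i → inv i * inv (suc i) ≡ inv i - inv (suc i)
inv-difference i 1≤i = trans (lem (inv (suc i)) (inv i * inv (suc i))) (cong (_- inv (suc i)) (sym (inv-inv-suc i 1≤i)))
  where
  lem : ∀ a b → b ≡ (a + b) - a
  lem = solve-∀ ℚ-ring

inv-pred : ∀ {p} → 2 ℕ.≤ p → inv (p ℕ.∸ 1) ≡ inv p + inv (p ℕ.∸ 1) * inv p
inv-pred {suc i} (s≤s 1≤i) = inv-inv-suc i 1≤i

-- 1/(p - 1) = 1/p + 1/(p (p - 1)), and the second terms telescope to at most 1 even over all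
-- integers from 2 on.
∑-inv-pred : ∀ {ps} → Unique ps → (∀ {p} → p ∈ ps → 2 ℕ.≤ p) → ∑ ps (λ p → inv (p ℕ.∸ 1)) ≤ ∑ ps inv + 1ℚ
∑-inv-pred {ps} ups 2≤ps = begin
  ∑ ps (λ p → inv (p ℕ.∸ 1))                           ≤⟨ ∑-mono ps (λ p∈ → ≤-reflexive (inv-pred (2≤ps p∈))) ⟩
  ∑ ps (λ p → inv p + inv (p ℕ.∸ 1) * inv p)           ≡⟨ ∑-+ ps inv (λ p → inv (p ℕ.∸ 1) * inv p) ⟩
  ∑ ps inv + ∑ ps (λ p → inv (p ℕ.∸ 1) * inv p)        ≤⟨ +-monoʳ-≤ (∑ ps inv) (telescope (λ p → inv (p ℕ.∸ 1) * inv p) inv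
                                                            (λ p → 0≤-* (inv-nonNeg (p ℕ.∸ 1)) (inv-nonNeg p)) inv-nonNeg
                                                            (λ i 1≤i → ≤-reflexive (inv-difference i 1≤i)) ups 2≤ps) ⟩
  ∑ ps inv + inv 1                                     ≡⟨ cong (_+_ (∑ ps inv)) inv-1 ⟩
  ∑ ps inv + 1ℚ                                        ∎
  where
  open ≤-Reasoning

inv-2 : inv 2 ≡ ½
inv-2 = sym (inv-unique {2} (s≤s z≤n) refl)

-- Telescoping with 1/(n (n - 1)) throughout would only give 1, and then nothing would remain of 1 -
-- ∑ 1/p². Using the exact value 1/4 at n = 2 and telescoping from n = 3 gives 1/4 + 1/2.
∑-inv² : ∀ {ps} → Unique ps → (∀ {p} → p ∈ ps → 2 ℕ.≤ p) → ∑ ps (λ p → inv p * inv p) ≤ ℤ.+ 3 / 4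
∑-inv² = telescope (λ p → inv p * inv p) w (λ p → 0≤-* (inv-nonNeg p) (inv-nonNeg p)) 0≤w step
  where
  w : ℕ → ℚ
  w 0             = 0ℚ
  w 1             = ℤ.+ 3 / 4
  w (suc (suc i)) = inv (suc (suc i))
  0≤w : ∀ n → 0ℚ ≤ w n
  0≤w 0             = ≤-refl
  0≤w 1             = nonNegative⁻¹ (ℤ.+ 3 / 4)
  0≤w (suc (suc i)) = inv-nonNeg (suc (suc i))
  step : ∀ i → 1 ℕ.≤ i → inv (suc i) * inv (suc i) ≤ w i - w (suc i)
  step 1 _ = ≤-reflexive (trans (cong₂ _*_ inv-2 inv-2) (cong (λ z → (ℤ.+ 3 / 4) - z) (sym inv-2)))
  step (suc (suc i)) 1≤i = ≤-trans (*-mono-≤ʳ (inv (3 ℕ.+ i)) (inv-nonNeg (3 ℕ.+ i)) (inv-antimono 1≤i (ℕₚ.n≤1+n _)))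
    (≤-reflexive (inv-difference (suc (suc i)) 1≤i))

-- (1 - 1/p)(1 + 1/p) = 1 - 1/p²
¼≤Π*Π : ∀ {ps} → Unique ps → (∀ {p} → p ∈ ps → 2 ℕ.≤ p) →
  ℤ.+ 1 / 4 ≤ Π ps (λ p → 1ℚ + inv p) * Π ps (λ p → 1ℚ - inv p)
¼≤Π*Π {ps} ups 2≤ps = begin
  1ℚ - (ℤ.+ 3 / 4)                                         ≤⟨ +-monoʳ-≤ 1ℚ (neg-antimono-≤ (∑-inv² ups 2≤ps)) ⟩
  1ℚ - ∑ ps (λ p → inv p * inv p)                          ≤⟨ 1-∑≤Π[1-] ps (λ p → inv p * inv p) (λ {p} p∈ → 0≤-* (inv-nonNeg p) (inv-nonNeg p) ,
                                                               *-mono-≤-nonNeg (inv-nonNeg p) (inv-nonNeg p) (inv≤1 (ℕₚ.<⇒≤ (2≤ps p∈))) (inv≤1 (ℕₚ.<⇒≤ (2≤ps p∈)))) ⟩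
  Π ps (λ p → 1ℚ - inv p * inv p)                          ≡⟨ Π-cong ps (λ p → factor (inv p)) ⟩
  Π ps (λ p → (1ℚ + inv p) * (1ℚ - inv p))                 ≡⟨ Π-* ps (λ p → 1ℚ + inv p) (λ p → 1ℚ - inv p) ⟩
  Π ps (λ p → 1ℚ + inv p) * Π ps (λ p → 1ℚ - inv p)        ∎
  where
  open ≤-Reasoning
  factor : ∀ t → 1ℚ - t * t ≡ (1ℚ + t) * (1ℚ - t)
  factor = solve-∀ ℚ-ring

-- Rankin's trick and the Mertens-type bound

lgOver : ℕ → ℚ
lgOver n = fromℕ (lg n) * inv n

lgOver-nonNeg : ∀ n → 0ℚ ≤ lgOver n
lgOver-nonNeg n = 0≤-* (0≤fromℕ (lg n)) (inv-nonNeg n)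

-- Each dyadic block contributes at most 8: for 2^L < p ≤ 2^(L+1) a term is at most (L + 1)/2^L, and
-- Chebyshev's bound allows 4 · 2^(L+1)/(L + 1) primes.
∑-lgOver-primes : ∀ L {ps} → Unique ps → All Prime ps → (∀ {p} → p ∈ ps → p ℕ.≤ 2 ℕ.^ L) → ∑ ps lgOver ≤ fromℕ (8 ℕ.* L)
∑-lgOver-primes zero {[]}     _ _ _ = ≤-refl
∑-lgOver-primes zero {p ∷ ps} _ (pr ∷ _) ps≤1 = contradiction (ps≤1 (here refl)) (ℕₚ.<⇒≱ (prime⇒1< pr))
∑-lgOver-primes (suc L) {ps} ups prs ps≤ = begin
  ∑ ps lgOver                            ≤⟨ ∑-⊆ ups lgOver-nonNeg split ⟩
  ∑ (lo ++ hi) lgOver                    ≡⟨ ∑-++ lo hi lgOver ⟩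
  ∑ lo lgOver + ∑ hi lgOver              ≤⟨ +-mono-≤ (∑-lgOver-primes L (Unique.filter⁺ small? ups) (All-filter small? prs)
                                              (λ p∈ → proj₂ (∈-filter⁻ small? {xs = ps} p∈))) hi≤ ⟩
  fromℕ (8 ℕ.* L) + fromℕ 8              ≡⟨ fromℕ-+ (8 ℕ.* L) 8 ⟨
  fromℕ (8 ℕ.* L ℕ.+ 8)                  ≡⟨ cong fromℕ (trans (ℕₚ.+-comm (8 ℕ.* L) 8) (sym (ℕₚ.*-suc 8 L))) ⟩
  fromℕ (8 ℕ.* suc L)                    ∎
  where
  open ≤-Reasoning
  x = 2 ℕ.^ L
  1≤x : 1 ℕ.≤ x
  1≤x = ℕₚ.m^n>0 2 L
  small? : Decidable (ℕ._≤ x)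
  small? p = p ℕₚ.≤? x
  large? : Decidable (λ p → ¬ p ℕ.≤ x)
  large? = ¬? ∘ small?
  lo = filter small? ps
  hi = filter large? ps
  split : ∀ {p} → p ∈ ps → p ∈ lo ++ hi
  split {p} p∈ = [ (λ p≤x → ∈-++⁺ˡ (∈-filter⁺ small? p∈ p≤x)) , (λ p≰x → ∈-++⁺ʳ lo (∈-filter⁺ large? p∈ p≰x)) ]′ (toSum (small? p))
  term≤ : ∀ {p} → p ∈ hi → lgOver p ≤ fromℕ (suc L) * inv x
  term≤ {p} p∈ = let p∈ps , p≰x = ∈-filter⁻ large? {xs = ps} p∈ in
    *-mono-≤-nonNeg (0≤fromℕ (lg p)) (inv-nonNeg p) (fromℕ-mono {lg p} {suc L} (lg-least (ps≤ p∈ps)))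
      (inv-antimono 1≤x (ℕₚ.<⇒≤ (ℕₚ.≰⇒> p≰x)))
  rearrange : ∀ a b c → a * (b * c) ≡ (b * a) * c
  rearrange = solve-∀ ℚ-ring
  hi≤ : ∑ hi lgOver ≤ fromℕ 8
  hi≤ = begin
    ∑ hi lgOver                                       ≤⟨ ∑-mono hi term≤ ⟩
    ∑ hi (const (fromℕ (suc L) * inv x))              ≡⟨ ∑-constℚ hi (fromℕ (suc L) * inv x) ⟩
    fromℕ (length hi) * (fromℕ (suc L) * inv x)       ≡⟨ rearrange (fromℕ (length hi)) (fromℕ (suc L)) (inv x) ⟩
    fromℕ (suc L) * fromℕ (length hi) * inv x         ≡⟨ cong (_* inv x) (fromℕ-* (suc L) (length hi)) ⟨
    fromℕ (suc L ℕ.* length hi) * inv x               ≤⟨ *-mono-≤ʳ (inv x) (inv-nonNeg x) (fromℕ-mono {suc L ℕ.* length hi} {4 ℕ.* (2 ℕ.* x)}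
                                                          (chebyshev (suc L) (Unique.filter⁺ large? ups) (All-filter large? prs)
                                                            (λ p∈ → ps≤ (proj₁ (∈-filter⁻ large? {xs = ps} p∈))))) ⟩
    fromℕ (4 ℕ.* (2 ℕ.* x)) * inv x                   ≡⟨ cong (λ z → fromℕ z * inv x) (ℕₚ.*-assoc 4 2 x) ⟨
    fromℕ (8 ℕ.* x) * inv x                           ≡⟨ cong (_* inv x) (fromℕ-* 8 x) ⟩
    fromℕ 8 * fromℕ x * inv x                         ≡⟨ *-assoc (fromℕ 8) (fromℕ x) (inv x) ⟩
    fromℕ 8 * (fromℕ x * inv x)                       ≡⟨ trans (cong (fromℕ 8 *_) (fromℕ*inv x 1≤x)) (*-identityʳ (fromℕ 8)) ⟩
    fromℕ 8                                           ∎

∑-products-inv : ∀ {ps} → All Prime ps → ∑ (products ps) inv ≡ Π ps (λ p → 1ℚ + inv p)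
∑-products-inv {[]}     _ = trans (+-identityʳ (inv 1)) inv-1
∑-products-inv {p ∷ ps} (pr ∷ prs) = begin
  ∑ (products ps ++ map (p ℕ.*_) (products ps)) inv              ≡⟨ trans (∑-++ (products ps) _ inv) (cong (_+_ Q) (∑-map (p ℕ.*_) (products ps) inv)) ⟩
  Q + ∑ (products ps) (λ d → inv (p ℕ.* d))                      ≡⟨ cong (_+_ Q) (≤-antisym
      (∑-mono (products ps) (λ {d} d∈ → ≤-reflexive (inv-*′ d∈))) (∑-mono (products ps) (λ {d} d∈ → ≤-reflexive (sym (inv-*′ d∈))))) ⟩
  Q + ∑ (products ps) (λ d → inv p * inv d)                      ≡⟨ cong (_+_ Q) (∑-*ˡ (products ps) (inv p) inv) ⟩
  Q + inv p * Q                                                  ≡⟨ lem (inv p) Q ⟩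
  (1ℚ + inv p) * Q                                               ≡⟨ cong ((1ℚ + inv p) *_) (∑-products-inv prs) ⟩
  (1ℚ + inv p) * Π ps (λ p → 1ℚ + inv p)                         ∎
  where
  open ≡-Reasoning
  Q = ∑ (products ps) inv
  inv-*′ : ∀ {d} → d ∈ products ps → inv (p ℕ.* d) ≡ inv p * inv d
  inv-*′ {d} d∈ = inv-* p d (ℕₚ.<⇒≤ (prime⇒1< pr)) (products-≥1 prs d∈)
  lem : ∀ t q → q + t * q ≡ (1ℚ + t) * q
  lem = solve-∀ ℚ-ring

-- By subadditivity lg d is at most the sum of lg p over the primes chosen in d, and the d in which
-- a given p is chosen have reciprocals adding up to at most Q/p, where Q is the sum over all d.
∑-products-lgOver : ∀ {ps} → All Prime ps → ∑ (products ps) lgOver ≤ ∑ (products ps) inv * ∑ ps lgOver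
∑-products-lgOver {[]} _ = ≤-reflexive (begin
  fromℕ (lg 1) * inv 1 + 0ℚ       ≡⟨ cong (λ z → fromℕ z * inv 1 + 0ℚ) (ℕₚ.n≤0⇒n≡0 (lg-least {1} {0} ℕₚ.≤-refl)) ⟩
  0ℚ * inv 1 + 0ℚ                 ≡⟨ cong (_+ 0ℚ) (*-zeroˡ (inv 1)) ⟩
  0ℚ                              ≡⟨ *-zeroʳ (inv 1 + 0ℚ) ⟨
  (inv 1 + 0ℚ) * 0ℚ               ∎)
  where open ≡-Reasoning
∑-products-lgOver {p ∷ ps} (pr ∷ prs) = begin
  ∑ (D ++ map (p ℕ.*_) D) lgOver                          ≡⟨ trans (∑-++ D (map (p ℕ.*_) D) lgOver) (cong (_+_ W) (∑-map (p ℕ.*_) D lgOver)) ⟩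
  W + ∑ D (λ d → lgOver (p ℕ.* d))                        ≤⟨ +-monoʳ-≤ W (∑-mono D term≤) ⟩
  W + ∑ D (λ d → lgOver p * inv d + inv p * lgOver d)     ≡⟨ cong (_+_ W) (trans (∑-+ D (λ d → lgOver p * inv d) (λ d → inv p * lgOver d))
                                                              (cong₂ _+_ (∑-*ˡ D (lgOver p) inv) (∑-*ˡ D (inv p) lgOver))) ⟩
  W + (lgOver p * Q + inv p * W)                          ≡⟨ lem₁ W (lgOver p * Q) (inv p) ⟩
  (1ℚ + inv p) * W + lgOver p * Q                         ≤⟨ +-mono-≤ (*-mono-≤ˡ (1ℚ + inv p) 0≤1+inv (∑-products-lgOver prs))
                                                              (p≤p+q (0≤-* (inv-nonNeg p) (0≤-* (lgOver-nonNeg p) 0≤Q))) ⟩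
  (1ℚ + inv p) * (Q * ∑ ps lgOver) + (lgOver p * Q + inv p * (lgOver p * Q)) ≡⟨ lem₂ (inv p) Q (∑ ps lgOver) (lgOver p) ⟩
  ((1ℚ + inv p) * Q) * (lgOver p + ∑ ps lgOver)           ≡⟨ cong (_* (lgOver p + ∑ ps lgOver))
                                                              (trans (cong ((1ℚ + inv p) *_) (∑-products-inv prs)) (sym (∑-products-inv (pr ∷ prs)))) ⟩
  ∑ (products (p ∷ ps)) inv * (lgOver p + ∑ ps lgOver)    ∎
  where
  open ≤-Reasoning
  D = products ps
  W = ∑ D lgOver
  Q = ∑ D inv
  0≤Q : 0ℚ ≤ Q
  0≤Q = ∑-nonNeg D inv-nonNeg
  0≤1+inv : 0ℚ ≤ 1ℚ + inv p
  0≤1+inv = 0≤-+ (0≤fromℕ 1) (inv-nonNeg p)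
  lem₁ : ∀ w a t → w + (a + t * w) ≡ (1ℚ + t) * w + a
  lem₁ = solve-∀ ℚ-ring
  lem₂ : ∀ t q s l → (1ℚ + t) * (q * s) + (l * q + t * (l * q)) ≡ ((1ℚ + t) * q) * (l + s)
  lem₂ = solve-∀ ℚ-ring
  lem₃ : ∀ a b c d → (a + b) * (c * d) ≡ a * c * d + c * (b * d)
  lem₃ = solve-∀ ℚ-ring
  term≤ : ∀ {d} → d ∈ D → lgOver (p ℕ.* d) ≤ lgOver p * inv d + inv p * lgOver d
  term≤ {d} d∈ = begin
    fromℕ (lg (p ℕ.* d)) * inv (p ℕ.* d)             ≤⟨ *-mono-≤ʳ (inv (p ℕ.* d)) (inv-nonNeg (p ℕ.* d)) (fromℕ-mono {lg (p ℕ.* d)} {lg p ℕ.+ lg d} (lg-*-≤ p d)) ⟩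
    fromℕ (lg p ℕ.+ lg d) * inv (p ℕ.* d)            ≡⟨ cong₂ _*_ (fromℕ-+ (lg p) (lg d)) (inv-* p d (ℕₚ.<⇒≤ (prime⇒1< pr)) (products-≥1 prs d∈)) ⟩
    (fromℕ (lg p) + fromℕ (lg d)) * (inv p * inv d)  ≡⟨ lem₃ (fromℕ (lg p)) (fromℕ (lg d)) (inv p) (inv d) ⟩
    lgOver p * inv d + inv p * lgOver d              ∎

module _ {ps ms : List ℕ} {N : ℕ} (ups : Unique ps) (prs : All Prime ps) (ums : Unique ms)
  (ps≤N : ∀ {p} → p ∈ ps → p ℕ.≤ N) (ms≤N : ∀ {m} → m ∈ ms → 1 ℕ.≤ m × m ℕ.≤ N)
  (ps∤ms : ∀ {p m} → p ∈ ps → m ∈ ms → p ∤ m) (2≤N : 2 ℕ.≤ N) where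

  private
    open ≤-Reasoning
    L = lg N
    1≤L : 1 ℕ.≤ L
    1≤L = 1≤lg 2≤N
    D = products ps
    S = ∑ ms inv
    Q = ∑ D inv
    0≤S : 0ℚ ≤ S
    0≤S = ∑-nonNeg ms inv-nonNeg
    -- `8L` bounds the mean of lg d under the weights 1/d. By Markov's inequality, which `rankin`
    -- states, the d beyond twice that mean carry at most half of the total weight Q.
    8L 16L : ℕ
    8L  = 8 ℕ.* L
    16L = 2 ℕ.* 8L
    1≤8L : 1 ℕ.≤ 8L
    1≤8L = ℕₚ.≤-trans 1≤L (ℕₚ.m≤n*m L 8)
    1≤16L : 1 ℕ.≤ 16L
    1≤16L = ℕₚ.≤-trans 1≤8L (ℕₚ.m≤n*m 8L 2)
    small? : Decidable (λ d → lg d ℕ.≤ 16L)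
    small? d = lg d ℕₚ.≤? 16L
    D′ = filter small? D

    Q≤ : Q ≤ ∑ D′ inv + inv 2 * Q
    Q≤ = begin
      ∑ D inv                                              ≤⟨ rankin D ⟩
      ∑ D′ inv + inv 16L * ∑ D lgOver                      ≤⟨ +-monoʳ-≤ (∑ D′ inv) (*-mono-≤ˡ (inv 16L) (inv-nonNeg 16L) W≤) ⟩
      ∑ D′ inv + inv 16L * (Q * fromℕ 8L)                  ≡⟨ cong (λ z → ∑ D′ inv + z * (Q * fromℕ 8L)) (inv-* 2 8L (s≤s z≤n) 1≤8L) ⟩
      ∑ D′ inv + inv 2 * inv 8L * (Q * fromℕ 8L)           ≡⟨ cong (_+_ (∑ D′ inv)) (lem (inv 2) (inv 8L) Q (fromℕ 8L)) ⟩
      ∑ D′ inv + (fromℕ 8L * inv 8L) * (inv 2 * Q)         ≡⟨ cong (_+_ (∑ D′ inv)) (trans (cong (_* (inv 2 * Q)) (fromℕ*inv 8L 1≤8L)) (*-identityˡ (inv 2 * Q))) ⟩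
      ∑ D′ inv + inv 2 * Q                                 ∎
      where
      lem : ∀ a b c d → a * b * (c * d) ≡ (d * b) * (a * c)
      lem = solve-∀ ℚ-ring
      W≤ : ∑ D lgOver ≤ Q * fromℕ 8L
      W≤ = ≤-trans (∑-products-lgOver prs) (*-mono-≤ˡ Q (∑-nonNeg D inv-nonNeg)
        (∑-lgOver-primes L ups prs (λ p∈ → ℕₚ.≤-trans (ps≤N p∈) (n≤2^lg N))))
      rankin : ∀ ds → ∑ ds inv ≤ ∑ (filter small? ds) inv + inv 16L * ∑ ds lgOver
      rankin []       = ≤-reflexive (sym (trans (+-identityˡ (inv 16L * 0ℚ)) (*-zeroʳ (inv 16L))))
      rankin (d ∷ ds) = [ accept , reject ]′ (toSum (small? d))
        where
        Small = ∑ (filter small? ds) inv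
        V = ∑ ds lgOver
        c = inv 16L
        0≤c = inv-nonNeg 16L
        lem₁ : ∀ a b c l v → a + (b + c * v) + c * l ≡ (a + b) + c * (l + v)
        lem₁ = solve-∀ ℚ-ring
        lem₂ : ∀ b c l v → c * l + (b + c * v) ≡ b + c * (l + v)
        lem₂ = solve-∀ ℚ-ring
        accept : lg d ℕ.≤ 16L → ∑ (d ∷ ds) inv ≤ ∑ (filter small? (d ∷ ds)) inv + c * ∑ (d ∷ ds) lgOver
        accept lgd≤ = begin
          inv d + ∑ ds inv                                           ≤⟨ +-monoʳ-≤ (inv d) (rankin ds) ⟩
          inv d + (Small + c * V)                                    ≤⟨ p≤p+q (0≤-* 0≤c (lgOver-nonNeg d)) ⟩
          inv d + (Small + c * V) + c * lgOver d                     ≡⟨ lem₁ (inv d) Small c (lgOver d) V ⟩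
          (inv d + Small) + c * (lgOver d + V)                       ≡⟨ cong (λ xs → ∑ xs inv + c * (lgOver d + V)) (filter-accept small? lgd≤) ⟨
          ∑ (filter small? (d ∷ ds)) inv + c * (lgOver d + V)        ∎
        reject : ¬ lg d ℕ.≤ 16L → ∑ (d ∷ ds) inv ≤ ∑ (filter small? (d ∷ ds)) inv + c * ∑ (d ∷ ds) lgOver
        reject lgd≰ = begin
          inv d + ∑ ds inv                                           ≤⟨ +-mono-≤ inv≤ (rankin ds) ⟩
          c * lgOver d + (Small + c * V)                             ≡⟨ lem₂ Small c (lgOver d) V ⟩
          Small + c * (lgOver d + V)                                 ≡⟨ cong (λ xs → ∑ xs inv + c * (lgOver d + V)) (filter-reject small? lgd≰) ⟨
          ∑ (filter small? (d ∷ ds)) inv + c * (lgOver d + V)        ∎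
          where
          inv≤ : inv d ≤ c * lgOver d
          inv≤ = subst (inv d ≤_) (*-comm (lgOver d) c) (≤-inv 16L 1≤16L (*-mono-≤ʳ (inv d) (inv-nonNeg d)
            (fromℕ-mono {16L} {lg d} (ℕₚ.<⇒≤ (ℕₚ.≰⇒> lgd≰)))))

    -- m ≤ 2^L and d ≤ 2^(16 L) give m d ≤ 2^K. The harmonic sum up to there is at most 1 + 17 L,
    -- hence at most 18 L because L ≥ 1.
    K : ℕ
    K = L ℕ.+ 16L

    MultipleOf : ℕ × ℕ → ℕ → Set
    MultipleOf (m , d) n = m ∈ ms × d ∈ D × m ℕ.* d ≡ n

    S*D′≤ : S * ∑ D′ inv ≤ 1ℚ + fromℕ K
    S*D′≤ = begin
      S * ∑ D′ inv                                          ≡⟨ ∑-*ʳ ms (∑ D′ inv) inv ⟨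
      ∑ ms (λ m → inv m * ∑ D′ inv)                         ≡⟨ ∑-cong ms (λ m → sym (∑-*ˡ D′ (inv m) inv)) ⟩
      ∑ ms (λ m → ∑ D′ (λ d → inv m * inv d))               ≡⟨ ∑-⋉ ms (λ _ → D′) (λ u → inv (proj₁ u) * inv (proj₂ u)) ⟨
      ∑ (ms ⋉ λ _ → D′) (λ u → inv (proj₁ u) * inv (proj₂ u)) ≤⟨ ∑-transfer MultipleOf
        (⋉-unique ums (λ _ → Unique.filter⁺ small? (products-unique ups prs))) inv-nonNeg partner det ⟩
      ∑ [1⋯ 2 ℕ.^ K ] inv                                   ≤⟨ harmonic≤ K ⟩
      1ℚ + fromℕ K                                          ∎
      where
      det : ∀ {u u′ n} → MultipleOf u n → MultipleOf u′ n → u ≡ u′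
      det (m∈ , d∈ , md≡n) (m′∈ , d′∈ , m′d′≡n) = *-products-injective ups prs
        (λ p∈ → ps∤ms p∈ m∈) (λ p∈ → ps∤ms p∈ m′∈) d∈ d′∈ (trans md≡n (sym m′d′≡n))
      partner : ∀ {u} → u ∈ ms ⋉ (λ _ → D′) → ∃ λ n → n ∈ [1⋯ 2 ℕ.^ K ] × MultipleOf u n × inv (proj₁ u) * inv (proj₂ u) ≤ inv n
      partner {m , d} u∈ =
        let m∈ , d∈′ = ∈-⋉⁻ ms u∈
            d∈ , lgd≤ = ∈-filter⁻ small? {xs = D} d∈′
            1≤m , m≤N = ms≤N m∈
            1≤d = products-≥1 prs d∈
            md≤ : m ℕ.* d ℕ.≤ 2 ℕ.^ K
            md≤ = ℕₚ.≤-trans (ℕₚ.*-mono-≤ (ℕₚ.≤-trans m≤N (n≤2^lg N)) (ℕₚ.≤-trans (n≤2^lg d) (ℕₚ.^-monoʳ-≤ 2 lgd≤)))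
                    (ℕₚ.≤-reflexive (sym (ℕₚ.^-distribˡ-+-* 2 L 16L)))
        in m ℕ.* d , ∈-[1⋯]⁺ {2 ℕ.^ K} (ℕₚ.*-mono-≤ 1≤m 1≤d) md≤ , (m∈ , d∈ , refl) , ≤-reflexive (sym (inv-* m d 1≤m 1≤d))

    1+K≤ : 1ℚ + fromℕ K ≤ fromℕ (18 ℕ.* L)
    1+K≤ = subst (_≤ fromℕ (18 ℕ.* L)) (fromℕ-suc K) (fromℕ-mono {suc K} {18 ℕ.* L}
      (ℕₚ.≤-trans (ℕₚ.+-monoˡ-≤ K 1≤L) (ℕₚ.≤-reflexive (cong (λ z → L ℕ.+ (L ℕ.+ z)) (sym (ℕₚ.*-assoc 2 8 L))))))

    half : ∀ X Y → X ≤ Y + inv 2 * X → X ≤ Y + Y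
    half X Y X≤ = 0≤q-p⇒p≤q (subst (0ℚ ≤_) eq (0≤-+ (p≤q⇒0≤q-p X≤) (p≤q⇒0≤q-p X≤)))
      where
      lem : ∀ x y h → (y + h * x - x) + (y + h * x - x) ≡ (y + y) + (h + h) * x - (x + x)
      lem = solve-∀ ℚ-ring
      lem₂ : ∀ x y → (y + y) + 1ℚ * x - (x + x) ≡ (y + y) - x
      lem₂ = solve-∀ ℚ-ring
      eq : (Y + inv 2 * X - X) + (Y + inv 2 * X - X) ≡ (Y + Y) - X
      eq = trans (lem X Y (inv 2)) (trans (cong (λ z → (Y + Y) + z * X - (X + X)) (cong₂ _+_ inv-2 inv-2)) (lem₂ X Y))

  -- Rankin's trick: the d with lg d > 16 lg N account for at most half of Q.
  ∑inv*Π≤ : ∑ ms inv * Π ps (λ p → 1ℚ + inv p) ≤ fromℕ (18 ℕ.* lg N) + fromℕ (18 ℕ.* lg N)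
  ∑inv*Π≤ = subst (λ z → S * z ≤ fromℕ (18 ℕ.* L) + fromℕ (18 ℕ.* L)) (∑-products-inv prs) (half (S * Q) (fromℕ (18 ℕ.* L)) (begin
    S * Q                                       ≤⟨ *-mono-≤ˡ S 0≤S Q≤ ⟩
    S * (∑ D′ inv + inv 2 * Q)                  ≡⟨ lem S (∑ D′ inv) (inv 2) Q ⟩
    S * ∑ D′ inv + inv 2 * (S * Q)              ≤⟨ +-monoˡ-≤ (inv 2 * (S * Q)) (≤-trans S*D′≤ 1+K≤) ⟩
    fromℕ (18 ℕ.* L) + inv 2 * (S * Q)          ∎))
    where
    lem : ∀ s d h q → s * (d + h * q) ≡ s * d + h * (s * q)
    lem = solve-∀ ℚ-ring

  -- Since 4 ∏ (1 + 1/p) ∏ (1 - 1/p) ≥ 1, the bound for S ∏ (1 + 1/p) passes to one for S itself;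
  -- 144 = 4 · (18 + 18).
  ∑inv≤lg*Π : ∑ ms inv ≤ fromℕ 144 * fromℕ (lg N) * Π ps (λ p → 1ℚ - inv p)
  ∑inv≤lg*Π = begin
    S                                              ≡⟨ lem₁ S ⟩
    fromℕ 4 * (S * (ℤ.+ 1 / 4))                    ≤⟨ *-mono-≤ˡ (fromℕ 4) (0≤fromℕ 4) (*-mono-≤ˡ S 0≤S (¼≤Π*Π ups 2≤ps)) ⟩
    fromℕ 4 * (S * (P * B))                        ≡⟨ cong (fromℕ 4 *_) (sym (*-assoc S P B)) ⟩
    fromℕ 4 * (S * P * B)                          ≤⟨ *-mono-≤ˡ (fromℕ 4) (0≤fromℕ 4) (*-mono-≤ʳ B 0≤B ∑inv*Π≤) ⟩
    fromℕ 4 * ((fromℕ (18 ℕ.* L) + fromℕ (18 ℕ.* L)) * B) ≡⟨ cong (λ z → fromℕ 4 * ((z + z) * B)) (fromℕ-* 18 L) ⟩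
    fromℕ 4 * ((fromℕ 18 * fromℕ L + fromℕ 18 * fromℕ L) * B) ≡⟨ lem₂ (fromℕ 4) (fromℕ 18) (fromℕ L) B ⟩
    fromℕ 4 * (fromℕ 18 + fromℕ 18) * fromℕ L * B  ∎
    where
    P = Π ps (λ p → 1ℚ + inv p)
    B = Π ps (λ p → 1ℚ - inv p)
    2≤ps : ∀ {p} → p ∈ ps → 2 ℕ.≤ p
    2≤ps p∈ = prime⇒1< (All.lookup prs p∈)
    0≤B : 0ℚ ≤ B
    0≤B = Π[1-inv]-nonNeg ps (λ p∈ → ℕₚ.<⇒≤ (2≤ps p∈))
    lem₁ : ∀ s → s ≡ fromℕ 4 * (s * (ℤ.+ 1 / 4))
    lem₁ s = sym (trans (lem₃ (fromℕ 4) s (ℤ.+ 1 / 4)) (*-identityˡ s))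
      where
      lem₃ : ∀ a b c → a * (b * c) ≡ (a * c) * b
      lem₃ = solve-∀ ℚ-ring
    lem₂ : ∀ a b l x → a * ((b * l + b * l) * x) ≡ a * (b + b) * l * x
    lem₂ = solve-∀ ℚ-ring

-- Products, sums and disjoint unions over the indices of the Tⱼ

ΠF : ∀ {r} → (Fin r → ℚ) → ℚ
ΠF {zero}  f = 1ℚ
ΠF {suc r} f = f Fin.zero * ΠF (f ∘ Fin.suc)

ΠF-cong : ∀ {r} {f g : Fin r → ℚ} → (∀ j → f j ≡ g j) → ΠF f ≡ ΠF g
ΠF-cong {zero}  f≡g = refl
ΠF-cong {suc r} f≡g = cong₂ _*_ (f≡g Fin.zero) (ΠF-cong (f≡g ∘ Fin.suc))

ΠF-1 : ∀ {r} {f : Fin r → ℚ} → (∀ j → f j ≡ 1ℚ) → ΠF f ≡ 1ℚ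
ΠF-1 {zero}  f≡1 = refl
ΠF-1 {suc r} f≡1 = cong₂ _*_ (f≡1 Fin.zero) (ΠF-1 (f≡1 ∘ Fin.suc))

ΠF-nonNeg : ∀ {r} {f : Fin r → ℚ} → (∀ j → 0ℚ ≤ f j) → 0ℚ ≤ ΠF f
ΠF-nonNeg {zero}  0≤f = 0≤fromℕ 1
ΠF-nonNeg {suc r} 0≤f = 0≤-* (0≤f Fin.zero) (ΠF-nonNeg (0≤f ∘ Fin.suc))

-- For two products that differ in factor j alone; the multipliers c and d express their ratio
-- without a division.
ΠF-exchange : ∀ {r} {f g : Fin r → ℚ} c d j → (∀ i → i ≢ j → f i ≡ g i) → c * f j ≡ d * g j → c * ΠF f ≡ d * ΠF g
ΠF-exchange {suc r} {f} {g} c d Fin.zero same eq = begin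
  c * (f Fin.zero * ΠF (f ∘ Fin.suc))   ≡⟨ *-assoc c (f Fin.zero) (ΠF (f ∘ Fin.suc)) ⟨
  c * f Fin.zero * ΠF (f ∘ Fin.suc)     ≡⟨ cong₂ _*_ eq (ΠF-cong (λ i → same (Fin.suc i) (λ ()))) ⟩
  d * g Fin.zero * ΠF (g ∘ Fin.suc)     ≡⟨ *-assoc d (g Fin.zero) (ΠF (g ∘ Fin.suc)) ⟩
  d * (g Fin.zero * ΠF (g ∘ Fin.suc))   ∎
  where open ≡-Reasoning
ΠF-exchange {suc r} {f} {g} c d (Fin.suc j) same eq = begin
  c * (f Fin.zero * ΠF (f ∘ Fin.suc))   ≡⟨ lem c (f Fin.zero) (ΠF (f ∘ Fin.suc)) ⟩
  f Fin.zero * (c * ΠF (f ∘ Fin.suc))   ≡⟨ cong₂ _*_ (same Fin.zero (λ ()))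
                                            (ΠF-exchange c d j (λ i i≢j → same (Fin.suc i) (i≢j ∘ Finₚ.suc-injective)) eq) ⟩
  g Fin.zero * (d * ΠF (g ∘ Fin.suc))   ≡⟨ lem d (g Fin.zero) (ΠF (g ∘ Fin.suc)) ⟨
  d * (g Fin.zero * ΠF (g ∘ Fin.suc))   ∎
  where
  open ≡-Reasoning
  lem : ∀ a b c → a * (b * c) ≡ b * (a * c)
  lem = solve-∀ ℚ-ring

sum-mono : ∀ {r} {f g : Fin r → ℚ} → (∀ j → f j ≤ g j) → sum f ≤ sum g
sum-mono {zero}  f≤g = ≤-refl
sum-mono {suc r} f≤g = +-mono-≤ (f≤g Fin.zero) (sum-mono (f≤g ∘ Fin.suc))

sum-*ˡ : ∀ {r} c (f : Fin r → ℚ) → sum (λ j → c * f j) ≡ c * sum f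
sum-*ˡ {zero}  c f = sym (*-zeroʳ c)
sum-*ˡ {suc r} c f = trans (cong (_+_ (c * f Fin.zero)) (sum-*ˡ c (f ∘ Fin.suc))) (sym (*-distribˡ-+ c (f Fin.zero) (sum (f ∘ Fin.suc))))

sum-nonNeg : ∀ {r} {f : Fin r → ℚ} → (∀ j → 0ℚ ≤ f j) → 0ℚ ≤ sum f
sum-nonNeg {zero}  0≤f = ≤-refl
sum-nonNeg {suc r} 0≤f = 0≤-+ (0≤f Fin.zero) (sum-nonNeg (0≤f ∘ Fin.suc))

∑-sum : ∀ {X : Set} {r} (xs : List X) (f : Fin r → X → ℚ) → ∑ xs (λ x → sum (λ j → f j x)) ≡ sum (λ j → ∑ xs (f j))
∑-sum {r = zero}  xs f = trans (∑-constℚ xs 0ℚ) (*-zeroʳ (fromℕ (length xs)))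
∑-sum {r = suc r} xs f = trans (∑-+ xs (f Fin.zero) (λ x → sum (λ j → f (Fin.suc j) x))) (cong (_+_ (∑ xs (f Fin.zero))) (∑-sum xs (f ∘ Fin.suc)))

join : ∀ {X : Set} {r} → (Fin r → List X) → List X
join {r = zero}  f = []
join {r = suc r} f = f Fin.zero ++ join (f ∘ Fin.suc)

module _ {X : Set} where

  ∈-join⁺ : ∀ {r} {f : Fin r → List X} {x} j → x ∈ f j → x ∈ join f
  ∈-join⁺ Fin.zero            x∈ = ∈-++⁺ˡ x∈
  ∈-join⁺ {f = f} (Fin.suc j) x∈ = ∈-++⁺ʳ (f Fin.zero) (∈-join⁺ j x∈)

  ∈-join⁻ : ∀ {r} (f : Fin r → List X) {x} → x ∈ join f → ∃ λ j → x ∈ f j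
  ∈-join⁻ {suc r} f x∈ with ∈-++⁻ (f Fin.zero) x∈
  ... | inj₁ x∈₀ = Fin.zero , x∈₀
  ... | inj₂ x∈′ = let j , x∈ⱼ = ∈-join⁻ (f ∘ Fin.suc) x∈′ in Fin.suc j , x∈ⱼ

  join-unique : ∀ {r} (f : Fin r → List X) → (∀ j → Unique (f j)) → (∀ i j → i ≢ j → ∀ x → ¬ (x ∈ f i × x ∈ f j)) → Unique (join f)
  join-unique {zero}  f uf disj = AllPairs.[]
  join-unique {suc r} f uf disj = Unique.++⁺ (uf Fin.zero)
    (join-unique (f ∘ Fin.suc) (uf ∘ Fin.suc) (λ i j i≢j → disj (Fin.suc i) (Fin.suc j) (i≢j ∘ Finₚ.suc-injective)))
    (λ { {x} (x∈₀ , x∈′) → let j , x∈ⱼ = ∈-join⁻ (f ∘ Fin.suc) x∈′ in disj Fin.zero (Fin.suc j) (λ ()) x (x∈₀ , x∈ⱼ) })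

  ∑-join : ∀ {r} (f : Fin r → List X) g → ∑ (join f) g ≡ sum (λ j → ∑ (f j) g)
  ∑-join {zero}  f g = refl
  ∑-join {suc r} f g = trans (∑-++ (f Fin.zero) (join (f ∘ Fin.suc)) g) (cong (_+_ (∑ (f Fin.zero) g)) (∑-join (f ∘ Fin.suc) g))

  Π-join : ∀ {r} (f : Fin r → List X) g → Π (join f) g ≡ ΠF (λ j → Π (f j) g)
  Π-join {zero}  f g = refl
  Π-join {suc r} f g = trans (Π-++ (f Fin.zero) (join (f ∘ Fin.suc)) g) (cong (Π (f Fin.zero) g *_) (Π-join (f ∘ Fin.suc) g))

-- Removing an exact prime power from every element of a set

-- The geometric series behind H′. The induction carries the remainder `c * inv (p ^ M)`, with which
-- the partial sum would be exactly 1/(p - 1).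
∑-inv-pow : ∀ {p} M → Prime p → ∑ [1⋯ M ] (λ a → inv (p ℕ.^ a)) ≤ inv (p ℕ.∸ 1)
∑-inv-pow {p} M pr = ≤-trans (p≤p+q (0≤-* (inv-nonNeg (p ℕ.∸ 1)) (inv-nonNeg (p ℕ.^ M)))) (go M)
  where
  open ≤-Reasoning
  c = inv (p ℕ.∸ 1)
  1<p = prime⇒1< pr
  1≤p = ℕₚ.<⇒≤ 1<p
  c≡ : c ≡ inv p + c * inv p
  c≡ = inv-pred 1<p
  lem : ∀ s x y c → s + x * y + c * (x * y) ≡ s + (x + c * x) * y
  lem = solve-∀ ℚ-ring
  go : ∀ M → ∑ [1⋯ M ] (λ a → inv (p ℕ.^ a)) + c * inv (p ℕ.^ M) ≤ c
  go zero    = ≤-reflexive (trans (+-identityˡ (c * inv 1)) (trans (cong (c *_) inv-1) (*-identityʳ c)))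
  go (suc M) = begin
    ∑ [1⋯ suc M ] (λ a → inv (p ℕ.^ a)) + c * inv (p ℕ.^ suc M)   ≤⟨ +-monoˡ-≤ (c * inv (p ℕ.^ suc M)) (∑-[1⋯suc] M (λ a → inv (p ℕ.^ a)) (λ a → inv-nonNeg (p ℕ.^ a))) ⟩
    Σ′ + inv (p ℕ.^ suc M) + c * inv (p ℕ.^ suc M)                ≡⟨ cong (λ z → Σ′ + z + c * z) (inv-* p (p ℕ.^ M) 1≤p (1≤p^a M pr)) ⟩
    Σ′ + inv p * inv (p ℕ.^ M) + c * (inv p * inv (p ℕ.^ M))      ≡⟨ lem Σ′ (inv p) (inv (p ℕ.^ M)) c ⟩
    Σ′ + (inv p + c * inv p) * inv (p ℕ.^ M)                      ≡⟨ cong (λ z → Σ′ + z * inv (p ℕ.^ M)) c≡ ⟨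
    Σ′ + c * inv (p ℕ.^ M)                                        ≤⟨ go M ⟩
    c                                                             ∎
    where Σ′ = ∑ [1⋯ M ] (λ a → inv (p ℕ.^ a))

∑-inv-primePowers : ∀ {ps} M → All Prime ps → ∑ (primePowers ps M) (inv ∘ pow) ≤ ∑ ps (λ p → inv (p ℕ.∸ 1))
∑-inv-primePowers {ps} M prs = ≤-trans (≤-reflexive (∑-⋉ ps (λ _ → [1⋯ M ]) (inv ∘ pow)))
  (∑-mono ps (λ p∈ → ∑-inv-pow M (All.lookup prs p∈)))

module _ {ps as bs : List ℕ} (N : ℕ) (ups : Unique ps) (prs : All Prime ps) (uas : Unique as)
  (as-bound : ∀ {n} → n ∈ as → 1 ℕ.≤ n × n ℕ.≤ N) (bs-bound : ∀ {m} → m ∈ bs → 1 ℕ.≤ m × m ℕ.≤ N)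
  (remove : ∀ {m p a} → p ∈ ps → p ∤ m → 1 ℕ.≤ a → m ℕ.* p ℕ.^ a ∈ as → m ∈ bs) where

  open ≤-Reasoning

  -- Double counting of the pairs (n, p^a ∥ n) with weight 1/n: each n has at least k of them, while
  -- n = m p^a factors the weight as 1/m · 1/p^a, and the second factors sum to at most H′.
  ∑-inv-removal : ∀ k → (∀ {n} → n ∈ as → k ℕ.≤ length (filter (_∣? n) ps)) →
    fromℕ k * ∑ as inv ≤ ∑ ps (λ p → inv (p ℕ.∸ 1)) * ∑ bs inv
  ∑-inv-removal k k≤ = begin
    fromℕ k * ∑ as inv                                                  ≡⟨ ∑-*ˡ as (fromℕ k) inv ⟨
    ∑ as (λ n → fromℕ k * inv n)                                        ≤⟨ ∑-mono as count ⟩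
    ∑ as (λ n → ∑ (exactPowers ps N n) (const (inv n)))                 ≡⟨ ∑-⋉ as (exactPowers ps N) (inv ∘ proj₁) ⟨
    ∑ (as ⋉ exactPowers ps N) (inv ∘ proj₁)                             ≤⟨ ∑-transfer Removal (⋉-unique uas (exactPowers-unique N ups)) g-nonNeg partner Removal-det ⟩
    ∑ (bs ⋉ multiples≤ ps N) g                                          ≡⟨ ∑-⋉ bs (multiples≤ ps N) g ⟩
    ∑ bs (λ m → ∑ (multiples≤ ps N m) (λ z → inv m * inv (pow z)))      ≡⟨ ∑-cong bs (λ m → ∑-*ˡ (multiples≤ ps N m) (inv m) (inv ∘ pow)) ⟩
    ∑ bs (λ m → inv m * ∑ (multiples≤ ps N m) (inv ∘ pow))              ≤⟨ ∑-mono bs (λ {m} _ → *-mono-≤ˡ (inv m) (inv-nonNeg m)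
                                                                             (≤-trans (∑-filter-≤ (λ z → m ℕ.* pow z ℕₚ.≤? N) (primePowers ps N) (λ z → inv-nonNeg (pow z)))
                                                                               (∑-inv-primePowers N prs))) ⟩
    ∑ bs (λ m → inv m * h)                                              ≡⟨ ∑-*ʳ bs h inv ⟩
    ∑ bs inv * h                                                        ≡⟨ *-comm (∑ bs inv) h ⟩
    h * ∑ bs inv                                                        ∎
    where
    h = ∑ ps (λ p → inv (p ℕ.∸ 1))
    g : ℕ × (ℕ × ℕ) → ℚ
    g (m , z) = inv m * inv (pow z)
    g-nonNeg : ∀ v → 0ℚ ≤ g v
    g-nonNeg (m , z) = 0≤-* (inv-nonNeg m) (inv-nonNeg (pow z))
    count : ∀ {n} → n ∈ as → fromℕ k * inv n ≤ ∑ (exactPowers ps N n) (const (inv n))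
    count {n} n∈ = ≤-trans (*-mono-≤ʳ (inv n) (inv-nonNeg n) (fromℕ-mono {k} {length (exactPowers ps N n)}
        (ℕₚ.≤-trans (k≤ n∈) (length-∣-≤ ups prs (proj₁ (as-bound n∈)) (proj₂ (as-bound n∈))))))
      (≤-reflexive (sym (∑-constℚ (exactPowers ps N n) (inv n))))
    partner : ∀ {u} → u ∈ as ⋉ exactPowers ps N → ∃ λ v → v ∈ bs ⋉ multiples≤ ps N × Removal u v × inv (proj₁ u) ≤ g v
    partner u∈ with Removal-partner N as-bound remove u∈
    ... | (m , (p , a)) , v∈ , removal = let m∈ , z∈ = ∈-⋉⁻ bs v∈
                                             p∈ , _ = ∈-⋉⁻ ps (proj₁ (∈-filter⁻ (λ z → m ℕ.* pow z ℕₚ.≤? N) {xs = primePowers ps N} z∈))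
                                         in (m , (p , a)) , v∈ , removal ,
                                            ≤-reflexive (inv-* m (p ℕ.^ a) (proj₁ (bs-bound m∈)) (1≤p^a a (All.lookup prs p∈)))

  ∑-logWeight≤ : ∑ as (λ n → ∑ (exactPowers ps N n) (fromℕ ∘ logWeight N n)) ≤ fromℕ (26 ℕ.* N) * ∑ bs inv
  ∑-logWeight≤ = begin
    ∑ as (λ n → ∑ (exactPowers ps N n) (fromℕ ∘ logWeight N n))          ≡⟨ trans (fromℕ-∑ as _) (∑-cong as (λ n → fromℕ-∑ (exactPowers ps N n) (logWeight N n))) ⟨
    fromℕ lhs                                                           ≤⟨ fromℕ-mono {lhs} {rhs} (∑-logWeight-removal N ups uas as-bound remove) ⟩
    fromℕ rhs                                                           ≡⟨ fromℕ-∑ bs inner ⟩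
    ∑ bs (λ m → fromℕ (inner m))                                        ≤⟨ ∑-mono bs bound ⟩
    ∑ bs (λ m → fromℕ (26 ℕ.* N) * inv m)                               ≡⟨ ∑-*ˡ bs (fromℕ (26 ℕ.* N)) inv ⟩
    fromℕ (26 ℕ.* N) * ∑ bs inv                                         ∎
    where
    inner : ℕ → ℕ
    inner m = ∑ℕ.∑ (multiples≤ ps N m) (λ z → logWeight N (m ℕ.* pow z) z)
    lhs = ∑ℕ.∑ as (λ n → ∑ℕ.∑ (exactPowers ps N n) (logWeight N n))
    rhs = ∑ℕ.∑ bs inner
    bound : ∀ {m} → m ∈ bs → fromℕ (inner m) ≤ fromℕ (26 ℕ.* N) * inv m
    bound {m} m∈ = let 1≤m , m≤N = bs-bound m∈ in ≤-inv m 1≤m (subst (_≤ fromℕ (26 ℕ.* N)) (fromℕ-* m (inner m))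
      (fromℕ-mono {m ℕ.* inner m} {26 ℕ.* N} (∑-logWeight ups prs N m 1≤m m≤N)))

-- The sets A k = {n ≤ N : ω (n ; Tⱼ) = kⱼ for all j}

sumℚ-reduce : ∀ {ps} (f : ∀ {p} → Prime p → ℚ) (g : ℕ → ℚ) → (∀ {p} (pr : Prime p) → f pr ≡ g p) →
  (prs : All Prime ps) → sumℚ (All.reduce f prs) ≡ ∑ ps g
sumℚ-reduce f g f≡g []         = refl
sumℚ-reduce f g f≡g (pr ∷ prs) = cong₂ _+_ (f≡g pr) (sumℚ-reduce f g f≡g prs)

H≡∑ : ∀ T → H T ≡ ∑ (elements T) inv
H≡∑ T = sumℚ-reduce 1/prime inv (λ {p} pr → inv≡ p {{prime⇒nonZero pr}}) (primes T)

H′≡∑ : ∀ T → H′ T ≡ ∑ (elements T) (λ p → inv (p ℕ.∸ 1))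
H′≡∑ T = sumℚ-reduce 1/[prime∸1] (λ p → inv (p ℕ.∸ 1)) (λ {p} pr → inv≡ (p ℕ.∸ 1) {{pred-nonZero pr}}) (primes T)

H′-nonNeg : ∀ T → 0ℚ ≤ H′ T
H′-nonNeg T = subst (0ℚ ≤_) (sym (H′≡∑ T)) (∑-nonNeg (elements T) (λ p → inv-nonNeg (p ℕ.∸ 1)))

T≥2 : ∀ T {p} → p ∈ₚ T → 2 ℕ.≤ p
T≥2 T p∈ = prime⇒1< (All.lookup (primes T) p∈)

H′≤H+1 : ∀ T → H′ T ≤ H T + 1ℚ
H′≤H+1 T = subst₂ _≤_ (sym (H′≡∑ T)) (cong (_+ 1ℚ) (sym (H≡∑ T))) (∑-inv-pred (unique T) (T≥2 T))

abstract

  -- 27 comes from `count≤` and 144 from `∑inv≤lg*Π`.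
  K : ℕ
  K = 27 ℕ.* 144

  fromℕ-K : fromℕ 27 * fromℕ 144 ≡ fromℕ K
  fromℕ-K = sym (fromℕ-* 27 144)

  1≤K : 1 ℕ.≤ K
  1≤K = s≤s z≤n

module Counting {r : ℕ} (T : Fin r → PrimeSet) (disjoint : ∀ i j → i ≢ j → Disjoint (T i) (T j))
  (y : Fin r → ℚ) (H′*y : ∀ j → H′ (T j) * y j ≡ 1ℚ) (N : ℕ) (2≤N : 2 ℕ.≤ N) (T≤N : ∀ j {p} → p ∈ₚ T j → p ℕ.≤ N) where

  A : (Fin r → ℕ) → List ℕ
  A k = filter (ω≡? T k) [1⋯ N ]

  A-unique : ∀ k → Unique (A k)
  A-unique k = Unique.filter⁺ (ω≡? T k) ([1⋯]-unique N)

  ∈-A⁻ : ∀ k {n} → n ∈ A k → (1 ℕ.≤ n × n ℕ.≤ N) × (∀ j → ω n (T j) ≡ k j)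
  ∈-A⁻ k n∈ = let n∈₁ , ω≡ = ∈-filter⁻ (ω≡? T k) {xs = [1⋯ N ]} n∈ in ∈-[1⋯]⁻ n∈₁ , ω≡

  A-bound : ∀ k {n} → n ∈ A k → 1 ℕ.≤ n × n ℕ.≤ N
  A-bound k n∈ = proj₁ (∈-A⁻ k n∈)

  S : (Fin r → ℕ) → ℚ
  S k = ∑ (A k) inv

  S-nonNeg : ∀ k → 0ℚ ≤ S k
  S-nonNeg k = ∑-nonNeg (A k) inv-nonNeg

  S₀ : ℚ
  S₀ = S (λ _ → 0)

  -- The vector k - eⱼ, truncated at zero: if `k j` is 0, nothing changes. Facts that rely on a real
  -- decrease therefore carry `1 ≤ k j`.
  _⊖_ : (Fin r → ℕ) → Fin r → Fin r → ℕ
  k ⊖ j = updateAt k j ℕ.pred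

  factor-bound : ∀ {m n} → 1 ℕ.≤ m ℕ.* n → m ℕ.* n ℕ.≤ N → 1 ℕ.≤ m × m ℕ.≤ N
  factor-bound {suc m} {zero}  1≤0  _    = contradiction (ℕₚ.≤-trans 1≤0 (ℕₚ.≤-reflexive (ℕₚ.*-zeroʳ m))) λ ()
  factor-bound {suc m} {suc n} 1≤mn mn≤N = s≤s z≤n , ℕₚ.≤-trans (ℕₚ.m≤m*n (suc m) (suc n)) mn≤N

  remove-outside : ∀ k {m p} a → Prime p → (∀ j → ¬ p ∈ₚ T j) → m ℕ.* p ℕ.^ a ∈ A k → m ∈ A k
  remove-outside k {m} {p} a pr p∉T mp^a∈ =
    let (1≤ , ≤N) , ω≡ = ∈-A⁻ k mp^a∈
        1≤m , m≤N = factor-bound 1≤ ≤N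
    in ∈-filter⁺ (ω≡? T k) (∈-[1⋯]⁺ 1≤m m≤N)
         (λ j → trans (sym (length-∣-fresh m a (primes (T j)) pr (p∉T j))) (ω≡ j))

  remove-inside : ∀ k j {m p} a → p ∈ₚ T j → p ∤ m → 1 ℕ.≤ a → m ℕ.* p ℕ.^ a ∈ A k → 1 ℕ.≤ k j × m ∈ A (k ⊖ j)
  remove-inside k j {m} {p} a p∈ p∤m 1≤a mp^a∈ =
    let (1≤ , ≤N) , ω≡ = ∈-A⁻ k mp^a∈
        1≤m , m≤N = factor-bound 1≤ ≤N
        kj≡ : suc (ω m (T j)) ≡ k j
        kj≡ = trans (sym (length-∣-member m a (unique (T j)) (primes (T j)) p∈ p∤m 1≤a)) (ω≡ j)
        ω≡′ : ∀ i → ω m (T i) ≡ (k ⊖ j) i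
        ω≡′ i = [ (λ { refl → trans (cong ℕ.pred kj≡) (sym (updateAt-updates j k)) })
                , (λ i≢j → trans (trans (sym (length-∣-fresh m a (primes (T i)) (All.lookup (primes (T j)) p∈)
                                              (λ p∈ᵢ → disjoint i j i≢j p (p∈ᵢ , p∈)))) (ω≡ i))
                            (sym (updateAt-minimal i j k i≢j))) ]′ (toSum (i Finₚ.≟ j))
    in subst (1 ℕ.≤_) kj≡ (s≤s z≤n) , ∈-filter⁺ (ω≡? T (k ⊖ j)) (∈-[1⋯]⁺ 1≤m m≤N) ω≡′

  S-step : ∀ k j → fromℕ (k j) * S k ≤ H′ (T j) * S (k ⊖ j)
  S-step k j = subst (λ h → fromℕ (k j) * S k ≤ h * S (k ⊖ j)) (sym (H′≡∑ (T j)))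
    (∑-inv-removal N (unique (T j)) (primes (T j)) (A-unique k) (A-bound k) (A-bound (k ⊖ j))
      (λ {m} {p} {a} p∈ p∤m 1≤a n∈ → proj₂ (remove-inside k j a p∈ p∤m 1≤a n∈)) (k j)
      (λ n∈ → ℕₚ.≤-reflexive (sym (proj₂ (∈-A⁻ k n∈) j))))

  G : (Fin r → ℕ) → ℚ
  G k = ΠF (λ j → expTerm (H′ (T j)) (k j))

  G-nonNeg : ∀ k → 0ℚ ≤ G k
  G-nonNeg k = ΠF-nonNeg (λ j → expTerm-nonNeg (H′-nonNeg (T j)) (k j))

  -- `G` satisfies with equality the recursion that `S-step` gives for `S` as an inequality.
  G-step : ∀ k j → 1 ℕ.≤ k j → fromℕ (k j) * G k ≡ H′ (T j) * G (k ⊖ j)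
  G-step k j 1≤kj = ΠF-exchange (fromℕ (k j)) (H′ (T j)) j
    (λ i i≢j → cong (expTerm (H′ (T i))) (sym (updateAt-minimal i j k i≢j)))
    (trans (term (k j) 1≤kj) (cong (λ c → H′ (T j) * expTerm (H′ (T j)) c) (sym (updateAt-updates j k))))
    where
    term : ∀ c → 1 ℕ.≤ c → fromℕ c * expTerm (H′ (T j)) c ≡ H′ (T j) * expTerm (H′ (T j)) (ℕ.pred c)
    term (suc c) _ = δ-expTerm (H′ (T j)) c

  -- Induction on the sum of the kⱼ: any j with kⱼ ≥ 1 may be lowered, and comparing `S-step` with
  -- `G-step` keeps the ratio S/G from growing.
  S≤G*S₀ : ∀ k → S k ≤ G k * S₀
  S≤G*S₀ k = go (total k) k ℕₚ.≤-refl
    where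
    total : ∀ {r} → (Fin r → ℕ) → ℕ
    total {zero}  k = 0
    total {suc r} k = k Fin.zero ℕ.+ total (k ∘ Fin.suc)
    total-⊖ : ∀ {r} (k : Fin r → ℕ) j → 1 ℕ.≤ k j → total (updateAt k j ℕ.pred) ℕ.< total k
    total-⊖ k Fin.zero    1≤kj with k Fin.zero
    ... | suc c = ℕₚ.≤-refl
    total-⊖ k (Fin.suc j) 1≤kj = ℕₚ.+-monoʳ-< (k Fin.zero) (total-⊖ (k ∘ Fin.suc) j 1≤kj)
    go : ∀ s k → total k ℕ.≤ s → S k ≤ G k * S₀
    go s k total≤s with Finₚ.any? (λ j → 1 ℕₚ.≤? k j)
    go s k total≤s | no k≡0 = begin
      S k          ≤⟨ ∑-⊆ (A-unique k) inv-nonNeg (λ n∈ → let (1≤n , n≤N) , ω≡ = ∈-A⁻ k n∈ in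
                        ∈-filter⁺ (ω≡? T (λ _ → 0)) (∈-[1⋯]⁺ 1≤n n≤N) (λ j → trans (ω≡ j) (kj≡0 j))) ⟩
      S₀           ≡⟨ *-identityˡ S₀ ⟨
      1ℚ * S₀      ≡⟨ cong (_* S₀) (ΠF-1 (λ j → cong (expTerm (H′ (T j))) (kj≡0 j))) ⟨
      G k * S₀     ∎
      where
      open ≤-Reasoning
      kj≡0 : ∀ j → k j ≡ 0
      kj≡0 j = ℕₚ.n≤0⇒n≡0 (ℕ.s≤s⁻¹ (ℕₚ.≰⇒> (λ 1≤kj → k≡0 (j , 1≤kj))))
    go zero k total≤s | yes (j , 1≤kj) = contradiction (ℕₚ.<-≤-trans (total-⊖ k j 1≤kj) total≤s) λ ()
    go (suc s) k total≤s | yes (j , 1≤kj) = *-cancel-≤ˡ (fromℕ (k j)) (0<fromℕ (k j) 1≤kj) (begin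
      fromℕ (k j) * S k                  ≤⟨ S-step k j ⟩
      H′ (T j) * S (k ⊖ j)               ≤⟨ *-mono-≤ˡ (H′ (T j)) (H′-nonNeg (T j)) (go s (k ⊖ j) (ℕ.s≤s⁻¹ (ℕₚ.<-≤-trans (total-⊖ k j 1≤kj) total≤s))) ⟩
      H′ (T j) * (G (k ⊖ j) * S₀)        ≡⟨ *-assoc (H′ (T j)) (G (k ⊖ j)) S₀ ⟨
      H′ (T j) * G (k ⊖ j) * S₀          ≡⟨ cong (_* S₀) (G-step k j 1≤kj) ⟨
      fromℕ (k j) * G k * S₀             ≡⟨ *-assoc (fromℕ (k j)) (G k) S₀ ⟩
      fromℕ (k j) * (G k * S₀)           ∎)
      where open ≤-Reasoning

  B : ℚ
  B = ΠF (λ j → Π (elements (T j)) (λ p → 1ℚ - inv p))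

  S₀≤ : S₀ ≤ fromℕ 144 * fromℕ (lg N) * B
  S₀≤ = subst (λ z → S₀ ≤ fromℕ 144 * fromℕ (lg N) * z) (Π-join (elements ∘ T) (λ p → 1ℚ - inv p))
    (∑inv≤lg*Π {ps = join (elements ∘ T)} {ms = A (λ _ → 0)} (join-unique (elements ∘ T) (unique ∘ T) disjoint)
      (All.tabulate (λ p∈ → let j , p∈ⱼ = ∈-join⁻ (elements ∘ T) p∈ in All.lookup (primes (T j)) p∈ⱼ))
      (A-unique _) (λ p∈ → let j , p∈ⱼ = ∈-join⁻ (elements ∘ T) p∈ in T≤N j p∈ⱼ) (A-bound _)
      (λ p∈ m∈ → let j , p∈ⱼ = ∈-join⁻ (elements ∘ T) p∈ in length-∣≡0⇒∤ (proj₂ (∈-A⁻ (λ _ → 0) m∈) j) p∈ⱼ) 2≤N)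

  y-nonNeg : ∀ j → 0ℚ ≤ y j
  y-nonNeg j = 0≤-*-cancel (H′-nonNeg (T j)) (positive⁻¹ 1ℚ) (≤-reflexive (sym (H′*y j)))

  G-⊖ : ∀ k j → 1 ℕ.≤ k j → G (k ⊖ j) ≡ fromℕ (k j) * y j * G k
  G-⊖ k j 1≤kj = begin
    G (k ⊖ j)                                   ≡⟨ *-identityˡ (G (k ⊖ j)) ⟨
    1ℚ * G (k ⊖ j)                              ≡⟨ cong (_* G (k ⊖ j)) (H′*y j) ⟨
    H′ (T j) * y j * G (k ⊖ j)               ≡⟨ lem (H′ (T j)) (y j) (G (k ⊖ j)) ⟩
    y j * (H′ (T j) * G (k ⊖ j))             ≡⟨ cong (y j *_) (G-step k j 1≤kj) ⟨
    y j * (fromℕ (k j) * G k)                ≡⟨ lem₂ (y j) (fromℕ (k j)) (G k) ⟩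
    fromℕ (k j) * y j * G k                  ∎
    where
    open ≡-Reasoning
    lem : ∀ a b c → a * b * c ≡ b * (a * c)
    lem = solve-∀ ℚ-ring
    lem₂ : ∀ a b c → a * (b * c) ≡ b * a * c
    lem₂ = solve-∀ ℚ-ring

  -- `ps₀` consists of primes outside all Tⱼ, and `e` stands in for η. The choice e = 1 is always
  -- allowed; otherwise `e-spec` guarantees that there are no outside primes and that 1 is not in A
  -- k. The first bound takes e = η, the second e = 1.
  module _ (k : Fin r → ℕ) (ps₀ : List ℕ) (ups₀ : Unique ps₀) (prs₀ : All Prime ps₀)
    (ps₀∉T : ∀ {p} → p ∈ ps₀ → ∀ j → ¬ p ∈ₚ T j)
    (covered : ∀ {p} → Prime p → p ℕ.≤ N → p ∈ ps₀ ⊎ ∃ λ j → p ∈ₚ T j)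
    (e : ℕ) (e-spec : e ≡ 1 ⊎ (ps₀ ≡ [] × ∃ λ j → 1 ℕ.≤ k j))
    (ρ : Fin r → ℚ) (ρ≡ : ∀ j → ρ j ≡ fromℕ (k j) * y j) where

    private
      L = lg N

      ρ-nonNeg : ∀ j → 0ℚ ≤ ρ j
      ρ-nonNeg j = subst (0ℚ ≤_) (sym (ρ≡ j)) (0≤-* (0≤fromℕ (k j)) (y-nonNeg j))

      weight : List ℕ → ℕ → ℚ
      weight ps n = ∑ (exactPowers ps N n) (fromℕ ∘ logWeight N n)

      weight-nonNeg : ∀ ps n → 0ℚ ≤ weight ps n
      weight-nonNeg ps n = ∑-nonNeg (exactPowers ps N n) (λ z → 0≤fromℕ (logWeight N n z))

      -- Pays for n = 1, which has no prime power: with e = 1 its value there is N ≥ lg N. Dividing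
      -- by n makes the total e N S(k), of the same shape as the contribution of the outside primes.
      E : ℕ → ℚ
      E n = fromℕ e * fromℕ N * inv n

      E-nonNeg : ∀ n → 0ℚ ≤ E n
      E-nonNeg n = 0≤-* (0≤-* (0≤fromℕ e) (0≤fromℕ N)) (inv-nonNeg n)

      1∉A : ∀ {n} → n ℕ.≤ 1 → n ∈ A k → ¬ (∃ λ j → 1 ℕ.≤ k j)
      1∉A {n} n≤1 n∈ (j , 1≤kj) = ℕₚ.<-irrefl (trans (sym ω≡0) (proj₂ (∈-A⁻ k n∈) j)) 1≤kj
        where
        ω≡0 : ω n (T j) ≡ 0
        ω≡0 = cong length (filter-none (_∣? n) (All.tabulate (λ p∈ p∣n →
          ℕₚ.<⇒≱ (T≥2 (T j) p∈) (ℕₚ.≤-trans (∣⇒≤ {{ℕ.>-nonZero (proj₁ (A-bound k n∈))}} p∣n) n≤1))))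

      pointwise : ∀ {n} → n ∈ A k → fromℕ L ≤ E n + (weight ps₀ n + sum (λ j → weight (elements (T j)) n))
      pointwise {n} n∈ = [ unit , large ]′ (toSum (n ℕₚ.≤? 1))
        where
        open ≤-Reasoning
        1≤n = proj₁ (A-bound k n∈)
        n≤N = proj₂ (A-bound k n∈)
        W = weight ps₀ n + sum (λ j → weight (elements (T j)) n)
        0≤W : 0ℚ ≤ W
        0≤W = 0≤-+ (weight-nonNeg ps₀ n) (sum-nonNeg (λ j → weight-nonNeg (elements (T j)) n))
        unit : n ℕ.≤ 1 → fromℕ L ≤ E n + W
        unit n≤1 = [ (λ { refl → begin
            fromℕ L                       ≤⟨ fromℕ-mono {L} {N} (lg≤n N) ⟩
            fromℕ N                       ≡⟨ trans (*-identityʳ (1ℚ * fromℕ N)) (*-identityˡ (fromℕ N)) ⟨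
            1ℚ * fromℕ N * 1ℚ             ≡⟨ cong (1ℚ * fromℕ N *_) (trans (cong inv (ℕₚ.≤-antisym n≤1 1≤n)) inv-1) ⟨
            fromℕ 1 * fromℕ N * inv n     ≤⟨ p≤p+q 0≤W ⟩
            E n + W                       ∎ })
          , (λ { (_ , k≢0) → contradiction k≢0 (1∉A n≤1 n∈) }) ]′ e-spec
        zs = exactPowers ps₀ N n ++ join (λ j → exactPowers (elements (T j)) N n)
        complete : ∀ {p a} → Prime p → 1 ℕ.≤ a → (p , a) ∥ n → (p , a) ∈ zs
        complete {p} {a} pr 1≤a z∥n@(p^a∣n , _) = [ (λ p∈ → ∈-++⁺ˡ (∈-exactPowers⁺ pr 1≤n n≤N p∈ 1≤a z∥n))
            , (λ { (j , p∈) → ∈-++⁺ʳ (exactPowers ps₀ N n) (∈-join⁺ j (∈-exactPowers⁺ pr 1≤n n≤N p∈ 1≤a z∥n)) }) ]′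
            (covered pr (ℕₚ.≤-trans (∣⇒≤ {{ℕ.>-nonZero 1≤n}} (∣-trans (p∣p^a 1≤a) p^a∣n)) n≤N))
        large : ¬ n ℕ.≤ 1 → fromℕ L ≤ E n + W
        large n≰1 = begin
          fromℕ L                                        ≤⟨ fromℕ-mono {L} {∑ℕ.∑ zs (logWeight N n)} (lg≤∑-logWeight (ℕₚ.≰⇒> n≰1) complete) ⟩
          fromℕ (∑ℕ.∑ zs (logWeight N n))                ≡⟨ fromℕ-∑ zs (logWeight N n) ⟩
          ∑ zs (fromℕ ∘ logWeight N n)                   ≡⟨ trans (∑-++ (exactPowers ps₀ N n) _ _)
                                                              (cong (_+_ (weight ps₀ n)) (∑-join (λ j → exactPowers (elements (T j)) N n) (fromℕ ∘ logWeight N n))) ⟩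
          W                                              ≤⟨ p≤q+p (E-nonNeg n) ⟩
          E n + W                                        ∎

      -- For kⱼ = 0 no element of A k has a prime divisor in Tⱼ, so the target of the removal is
      -- empty, whereas the truncated `k ⊖ j` would wrongly return A k.
      Aⱼ : ℕ → Fin r → List ℕ
      Aⱼ zero    j = []
      Aⱼ (suc _) j = A (k ⊖ j)

      ∈-Aⱼ⁺ : ∀ c j {m} → 1 ℕ.≤ c → m ∈ A (k ⊖ j) → m ∈ Aⱼ c j
      ∈-Aⱼ⁺ (suc _) j _ m∈ = m∈

      Aⱼ-bound : ∀ c j {m} → m ∈ Aⱼ c j → 1 ℕ.≤ m × m ℕ.≤ N
      Aⱼ-bound (suc _) j m∈ = A-bound (k ⊖ j) m∈

      26N : ℚ
      26N = fromℕ (26 ℕ.* N)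

      outside≤ : ∑ (A k) (weight ps₀) ≤ fromℕ e * (26N * S k)
      outside≤ = [ (λ { refl → ≤-trans (∑-logWeight≤ N ups₀ prs₀ (A-unique k) (A-bound k) (A-bound k)
                        (λ {m} {p} {a} p∈ _ _ n∈ → remove-outside k a (All.lookup prs₀ p∈) (ps₀∉T p∈) n∈))
                        (≤-reflexive (sym (*-identityˡ (26N * S k)))) })
                 , (λ { (refl , _) → ≤-trans (≤-reflexive (trans (∑-constℚ (A k) 0ℚ) (*-zeroʳ (fromℕ (length (A k))))))
                        (0≤-* (0≤fromℕ e) (0≤-* (0≤fromℕ (26 ℕ.* N)) (S-nonNeg k))) }) ]′ e-spec

      inside≤ : ∀ j → ∑ (A k) (weight (elements (T j))) ≤ 26N * (ρ j * (G k * S₀))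
      inside≤ j = ≤-trans (∑-logWeight≤ {bs = Aⱼ (k j) j} N (unique (T j)) (primes (T j)) (A-unique k) (A-bound k) (Aⱼ-bound (k j) j)
          (λ {m} {p} {a} p∈ p∤m 1≤a n∈ → let 1≤kj , m∈ = remove-inside k j a p∈ p∤m 1≤a n∈ in ∈-Aⱼ⁺ (k j) j 1≤kj m∈))
        (*-mono-≤ˡ 26N (0≤fromℕ (26 ℕ.* N)) (Aⱼ≤ (k j) refl))
        where
        Aⱼ≤ : ∀ c → c ≡ k j → ∑ (Aⱼ c j) inv ≤ ρ j * (G k * S₀)
        Aⱼ≤ zero    _   = 0≤-* (ρ-nonNeg j) (0≤-* (G-nonNeg k) (S-nonNeg (λ _ → 0)))
        Aⱼ≤ (suc c) c≡k = ≤-trans (S≤G*S₀ (k ⊖ j)) (≤-reflexive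
          (trans (cong (_* S₀) (trans (G-⊖ k j (subst (1 ℕ.≤_) c≡k (s≤s z≤n))) (cong (_* G k) (sym (ρ≡ j))))) (*-assoc (ρ j) (G k) S₀)))

    count≤ : fromℕ (lg N) * fromℕ (length (A k)) ≤ fromℕ (27 ℕ.* N) * ((fromℕ e + sum ρ) * (G k * S₀))
    count≤ = begin
      fromℕ L * fromℕ (length (A k))                          ≡⟨ trans (*-comm (fromℕ L) (fromℕ (length (A k)))) (sym (∑-constℚ (A k) (fromℕ L))) ⟩
      ∑ (A k) (const (fromℕ L))                               ≤⟨ ∑-mono (A k) pointwise ⟩
      ∑ (A k) (λ n → E n + (weight ps₀ n + sum (λ j → weight (elements (T j)) n)))
        ≡⟨ trans (∑-+ (A k) E _) (cong₂ _+_ (∑-*ˡ (A k) (fromℕ e * fromℕ N) inv)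
             (trans (∑-+ (A k) (weight ps₀) _) (cong (_+_ (∑ (A k) (weight ps₀))) (∑-sum (A k) (λ j → weight (elements (T j))))))) ⟩
      fromℕ e * fromℕ N * S k + (∑ (A k) (weight ps₀) + sum (λ j → ∑ (A k) (weight (elements (T j)))))
        ≤⟨ +-monoʳ-≤ (fromℕ e * fromℕ N * S k) (+-mono-≤ outside≤ (sum-mono inside≤)) ⟩
      fromℕ e * fromℕ N * S k + (fromℕ e * (26N * S k) + sum (λ j → 26N * (ρ j * X)))
        ≡⟨ cong (λ z → fromℕ e * fromℕ N * S k + (fromℕ e * (26N * S k) + z)) (trans (sum-*ˡ 26N (λ j → ρ j * X)) (cong (26N *_) sum-*X)) ⟩
      fromℕ e * fromℕ N * S k + (fromℕ e * (26N * S k) + 26N * (sum ρ * X))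
        -- The sum over j needs only the factor 26 N. It is raised to N + 26 N, the factor of the
        -- e-term, so that both share it.
        ≤⟨ p≤p+q (0≤-* (0≤fromℕ N) (0≤-* (sum-nonNeg (ρ-nonNeg)) 0≤X)) ⟩
      fromℕ e * fromℕ N * S k + (fromℕ e * (26N * S k) + 26N * (sum ρ * X)) + fromℕ N * (sum ρ * X)
        ≡⟨ lem (fromℕ e) (fromℕ N) (S k) 26N (sum ρ) X ⟩
      (fromℕ N + 26N) * (fromℕ e * S k + sum ρ * X)
        ≡⟨ cong (_* (fromℕ e * S k + sum ρ * X)) (fromℕ-+ N (26 ℕ.* N)) ⟨
      fromℕ (27 ℕ.* N) * (fromℕ e * S k + sum ρ * X)
        ≤⟨ *-mono-≤ˡ (fromℕ (27 ℕ.* N)) (0≤fromℕ (27 ℕ.* N)) (+-monoˡ-≤ (sum ρ * X) (*-mono-≤ˡ (fromℕ e) (0≤fromℕ e) (S≤G*S₀ k))) ⟩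
      fromℕ (27 ℕ.* N) * (fromℕ e * X + sum ρ * X)
        ≡⟨ cong (fromℕ (27 ℕ.* N) *_) (*-distribʳ-+ X (fromℕ e) (sum ρ)) ⟨
      fromℕ (27 ℕ.* N) * ((fromℕ e + sum ρ) * X) ∎
      where
      open ≤-Reasoning
      X = G k * S₀
      0≤X : 0ℚ ≤ X
      0≤X = 0≤-* (G-nonNeg k) (S-nonNeg (λ _ → 0))
      sum-*X : sum (λ j → ρ j * X) ≡ sum ρ * X
      sum-*X = trans (sum-cong (λ j → *-comm (ρ j) X)) (trans (sum-*ˡ X ρ) (*-comm X (sum ρ)))
        where
        sum-cong : ∀ {r} {f g : Fin r → ℚ} → (∀ j → f j ≡ g j) → sum f ≡ sum g
        sum-cong {zero}  f≡g = refl
        sum-cong {suc r} f≡g = cong₂ _+_ (f≡g Fin.zero) (sum-cong (f≡g ∘ Fin.suc))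
      lem : ∀ e n s c t x → e * n * s + (e * (c * s) + c * (t * x)) + n * (t * x) ≡ (n + c) * (e * s + t * x)
      lem = solve-∀ ℚ-ring

    -- The lg N on the left of `count≤` cancels the one that `S₀≤` brings in on the right.
    ℙ≤ : fromℕ (length (A k)) * inv N ≤ fromℕ K * (B * (G k * (fromℕ e + sum ρ)))
    ℙ≤ = begin
      fromℕ (length (A k)) * inv N                            ≤⟨ *-mono-≤ʳ (inv N) (inv-nonNeg N) (*-cancel-≤ˡ (fromℕ L) (0<fromℕ L (1≤lg 2≤N)) (begin
        fromℕ L * fromℕ (length (A k))                        ≤⟨ count≤ ⟩
        fromℕ (27 ℕ.* N) * (F * (G k * S₀))                   ≤⟨ *-mono-≤ˡ (fromℕ (27 ℕ.* N)) (0≤fromℕ (27 ℕ.* N)) (*-mono-≤ˡ F 0≤F (*-mono-≤ˡ (G k) (G-nonNeg k) S₀≤)) ⟩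
        fromℕ (27 ℕ.* N) * (F * (G k * (fromℕ 144 * fromℕ L * B)))
          ≡⟨ cong (_* (F * (G k * (fromℕ 144 * fromℕ L * B)))) (fromℕ-* 27 N) ⟩
        fromℕ 27 * fromℕ N * (F * (G k * (fromℕ 144 * fromℕ L * B)))
          ≡⟨ lem (fromℕ 27) (fromℕ N) F (G k) (fromℕ 144) (fromℕ L) B ⟩
        fromℕ L * (fromℕ N * (fromℕ 27 * fromℕ 144 * (B * (G k * F)))) ∎)) ⟩
      fromℕ N * (fromℕ 27 * fromℕ 144 * (B * (G k * F))) * inv N ≡⟨ lem₂ (fromℕ N) (fromℕ 27 * fromℕ 144 * (B * (G k * F))) (inv N) ⟩
      (fromℕ N * inv N) * (fromℕ 27 * fromℕ 144 * (B * (G k * F))) ≡⟨ cong (_* (fromℕ 27 * fromℕ 144 * (B * (G k * F)))) (fromℕ*inv N (ℕₚ.<⇒≤ 2≤N)) ⟩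
      1ℚ * (fromℕ 27 * fromℕ 144 * (B * (G k * F)))           ≡⟨ *-identityˡ _ ⟩
      fromℕ 27 * fromℕ 144 * (B * (G k * F))                  ≡⟨ cong (_* (B * (G k * F))) fromℕ-K ⟩
      fromℕ K * (B * (G k * F))                            ∎
      where
      open ≤-Reasoning
      F = fromℕ e + sum ρ
      0≤F : 0ℚ ≤ F
      0≤F = 0≤-+ (0≤fromℕ e) (sum-nonNeg (ρ-nonNeg))
      lem : ∀ c n f g d l b → c * n * (f * (g * (d * l * b))) ≡ l * (n * (c * d * (b * (g * f))))
      lem = solve-∀ ℚ-ring
      lem₂ : ∀ a b c → a * b * c ≡ (a * c) * b
      lem₂ = solve-∀ ℚ-ring

-- Passing to the limit

-- A loss of any factor θ < 1 can be afforded in the product because it can be shared out among the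
-- factors.
ΠF-lower : ∀ {r} (b : Fin r → ℚ) (s : Fin r → ℕ → ℚ) → (∀ j → 0ℚ ≤ b j) →
  (∀ j θ → 0ℚ < θ → θ < 1ℚ → ∃ λ M → ∀ n → M ℕ.≤ n → θ * b j ≤ s j n) →
  ∀ θ → 0ℚ < θ → θ < 1ℚ → ∃ λ M → ∀ n → M ℕ.≤ n → θ * ΠF b ≤ ΠF (λ j → s j n)
ΠF-lower {zero}  b s 0≤b lower θ 0<θ θ<1 = 0 , λ _ _ → ≤-trans (≤-reflexive (*-identityʳ θ)) (<⇒≤ θ<1)
ΠF-lower {suc r} b s 0≤b lower θ 0<θ θ<1 = M₁ ℕ.⊔ M₂ , λ n M≤n → begin
  θ * (b₀ * ΠF b′)                 ≤⟨ *-mono-≤ʳ (b₀ * ΠF b′) (0≤-* (0≤b Fin.zero) 0≤Πb′) θ≤φ² ⟩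
  φ * φ * (b₀ * ΠF b′)             ≡⟨ lem φ b₀ (ΠF b′) ⟩
  (φ * b₀) * (φ * ΠF b′)           ≤⟨ *-mono-≤-nonNeg (0≤-* 0≤φ (0≤b Fin.zero)) (0≤-* 0≤φ 0≤Πb′)
                                       (proj₂ first n (ℕₚ.m⊔n≤o⇒m≤o M₁ M₂ M≤n)) (proj₂ rest n (ℕₚ.m⊔n≤o⇒n≤o M₁ M₂ M≤n)) ⟩
  s Fin.zero n * ΠF (λ j → s (Fin.suc j) n) ∎
  where
  open ≤-Reasoning
  b₀ = b Fin.zero
  b′ = b ∘ Fin.suc
  0≤Πb′ : 0ℚ ≤ ΠF b′
  0≤Πb′ = ΠF-nonNeg (0≤b ∘ Fin.suc)
  -- The mean of 1 and θ: below 1, and φ² ≥ θ by the inequality of arithmetic and geometric means.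
  -- One φ goes to the first factor, the other to the rest.
  φ = ½ * (1ℚ + θ)
  0<φ : 0ℚ < φ
  0<φ = 0<-* (positive⁻¹ ½) (+-mono-< (positive⁻¹ 1ℚ) 0<θ)
  0≤φ = <⇒≤ 0<φ
  φ<1 : φ < 1ℚ
  φ<1 = *-monoʳ-<-pos ½ (+-monoʳ-< 1ℚ θ<1)
  first = lower Fin.zero φ 0<φ φ<1
  rest = ΠF-lower b′ (s ∘ Fin.suc) (0≤b ∘ Fin.suc) (lower ∘ Fin.suc) φ 0<φ φ<1
  M₁ = proj₁ first
  M₂ = proj₁ rest
  lem : ∀ φ a b → φ * φ * (a * b) ≡ (φ * a) * (φ * b)
  lem = solve-∀ ℚ-ring
  θ≤φ² : θ ≤ φ * φ
  θ≤φ² = 0≤q-p⇒p≤q (subst (0ℚ ≤_) (sym (trans (square ½ θ) quarter)) (0≤-* 0≤½[1-θ] 0≤½[1-θ]))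
    where
    0≤½[1-θ] : 0ℚ ≤ ½ * (1ℚ - θ)
    0≤½[1-θ] = 0≤-* (nonNegative⁻¹ ½) (p≤q⇒0≤q-p (<⇒≤ θ<1))
    square : ∀ h θ → (h * (1ℚ + θ)) * (h * (1ℚ + θ)) - θ ≡ (h * (1ℚ - θ)) * (h * (1ℚ - θ)) + ((h + h) * (h + h) - 1ℚ) * θ
    square = solve-∀ ℚ-ring
    quarter : (½ * (1ℚ - θ)) * (½ * (1ℚ - θ)) + 0ℚ * θ ≡ (½ * (1ℚ - θ)) * (½ * (1ℚ - θ))
    quarter = trans (cong (_+_ ((½ * (1ℚ - θ)) * (½ * (1ℚ - θ)))) (*-zeroˡ θ)) (+-identityʳ _)

⟦⟧≤ᴿ-trans : ∀ {p q y} → p ≤ q → ⟦ q ⟧ ≤ᴿ y → ⟦ p ⟧ ≤ᴿ y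
⟦⟧≤ᴿ-trans p≤q q≤y ε 0<ε = let M , q≤ = q≤y ε 0<ε in M , λ n M≤n → ≤-trans p≤q (q≤ n M≤n)

seq-∏-exp : ∀ {r} (q h : Fin r → ℚ) (k : Fin r → ℕ) n →
  seq (∏ (λ j → ⟦ q j ^ k j * 1/[ k j ]! ⟧ *ᴿ exp (- h j))) n ≡ ΠF (λ j → expTerm (q j) (k j)) * ΠF (λ j → expSum (- h j) n)
seq-∏-exp {zero}  q h k n = refl
seq-∏-exp {suc r} q h k n = trans (cong (expTerm (q Fin.zero) (k Fin.zero) * expSum (- h Fin.zero) n *_) (seq-∏-exp (q ∘ Fin.suc) (h ∘ Fin.suc) (k ∘ Fin.suc) n))
  (lem (expTerm (q Fin.zero) (k Fin.zero)) (expSum (- h Fin.zero) n) (ΠF (λ j → expTerm (q (Fin.suc j)) (k (Fin.suc j)))) (ΠF (λ j → expSum (- h (Fin.suc j)) n)))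
  where
  lem : ∀ a b c d → a * b * (c * d) ≡ (a * c) * (b * d)
  lem = solve-∀ ℚ-ring

-- κ is the constant of the inequality with B = ∏ (1 - 1/p). Doubling it to c makes up for the ½ in
-- `E-lower`, so B can be replaced by the partial sums of the exponentials.
module Limit {r : ℕ} (P c κ B : ℚ) (q h : Fin r → ℚ) (k : Fin r → ℕ) (κ≡ : κ ≡ c * ½) (0≤c : 0ℚ ≤ c)
  (E-lower : ∃ λ M → ∀ n → M ℕ.≤ n → ½ * B ≤ ΠF (λ j → expSum (- h j) n)) where

  open ≤-Reasoning

  private
    E : ℕ → ℚ
    E n = ΠF (λ j → expSum (- h j) n)

    G : ℚ
    G = ΠF (λ j → expTerm (q j) (k j))

    replace-B : ∀ X n → 0ℚ ≤ X → ½ * B ≤ E n → κ * (B * X) ≤ c * (X * E n)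
    replace-B X n 0≤X ½B≤E = begin
      κ * (B * X)          ≡⟨ cong (_* (B * X)) κ≡ ⟩
      c * ½ * (B * X)      ≡⟨ lem c ½ B X ⟩
      c * (X * (½ * B))    ≤⟨ *-mono-≤ˡ c 0≤c (*-mono-≤ˡ X 0≤X ½B≤E) ⟩
      c * (X * E n)        ∎
      where
      lem : ∀ c h b x → c * h * (b * x) ≡ c * (x * (h * b))
      lem = solve-∀ ℚ-ring

  ≤ᴿ-∏ : 0ℚ ≤ ΠF (λ j → expTerm (q j) (k j)) → P ≤ κ * (B * ΠF (λ j → expTerm (q j) (k j))) →
    ⟦ P ⟧ ≤ᴿ ⟦ c ⟧ *ᴿ ∏ (λ j → ⟦ q j ^ k j * 1/[ k j ]! ⟧ *ᴿ exp (- h j))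
  ≤ᴿ-∏ 0≤G P≤ ε 0<ε = proj₁ E-lower , λ n M≤n →
    ≤-trans (bound n M≤n) (≤-reflexive (cong (λ z → c * z + ε) (sym (seq-∏-exp q h k n))))
    where
    bound : ∀ n → proj₁ E-lower ℕ.≤ n → P ≤ c * (G * E n) + ε
    bound n M≤n = begin
      P                    ≤⟨ P≤ ⟩
      κ * (B * G)          ≤⟨ replace-B G n 0≤G (proj₂ E-lower n M≤n) ⟩
      c * (G * E n)        ≤⟨ p≤p+q (<⇒≤ 0<ε) ⟩
      c * (G * E n) + ε    ∎

  ≤ᴿ-∏-+ : ∀ (η ξ : ℕ) (ρ : Fin r → ℚ) → 0ℚ ≤ ΠF (λ j → expTerm (q j) (k j)) * (fromℕ η + sum ρ) →
    P ≤ κ * (B * (ΠF (λ j → expTerm (q j) (k j)) * (fromℕ η + sum ρ))) + c * fromℕ ξ →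
    ⟦ P ⟧ ≤ᴿ ⟦ c ⟧ *ᴿ ∏ (λ j → ⟦ q j ^ k j * 1/[ k j ]! ⟧ *ᴿ exp (- h j)) *ᴿ ⟦ fromℕ η + sum ρ ⟧ +ᴿ ⟦ c ⟧ *ᴿ ⟦ fromℕ ξ ⟧
  ≤ᴿ-∏-+ η ξ ρ 0≤Gf P≤ ε 0<ε = proj₁ E-lower , λ n M≤n →
    ≤-trans (bound n M≤n) (≤-reflexive (cong (λ z → c * z * f + c * fromℕ ξ + ε) (sym (seq-∏-exp q h k n))))
    where
    f = fromℕ η + sum ρ
    t = c * fromℕ ξ
    lem : ∀ c g f e → c * (g * f * e) ≡ c * (g * e) * f
    lem = solve-∀ ℚ-ring
    bound : ∀ n → proj₁ E-lower ℕ.≤ n → P ≤ c * (G * E n) * f + t + ε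
    bound n M≤n = begin
      P                                ≤⟨ P≤ ⟩
      κ * (B * (G * f)) + t            ≤⟨ +-monoˡ-≤ t (replace-B (G * f) n 0≤Gf (proj₂ E-lower n M≤n)) ⟩
      c * (G * f * E n) + t            ≡⟨ cong (_+ t) (lem c G f (E n)) ⟩
      c * (G * E n) * f + t            ≤⟨ p≤p+q (<⇒≤ 0<ε) ⟩
      c * (G * E n) * f + t + ε        ∎

C : ℚ
C = fromℕ (2 ℕ.* K)

0≤C : 0ℚ ≤ C
0≤C = 0≤fromℕ (2 ℕ.* K)

K≡C*½ : fromℕ K ≡ C * ½
K≡C*½ = sym (trans (cong (_* ½) (fromℕ-* 2 K)) (trans (lem (fromℕ 2) (fromℕ K) ½) (*-identityˡ (fromℕ K))))
  where
  lem : ∀ a b c → a * b * c ≡ (a * c) * b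
  lem = solve-∀ ℚ-ring

-- x stays below N + 1 by some ε > 0. Reading p ≤ x with slack ε/2 then excludes p ≥ N + 1. In this
-- way conditions on x become decidable conditions on N.
≤⇒≤floor : ∀ {x N p} → N IsFloorOf x → ⟦ fromℕ p ⟧ ≤ᴿ x → p ℕ.≤ N
≤⇒≤floor {x} {N} {p} (_ , ε , 0<ε , M , x+ε≤) p≤x with p ℕₚ.≤? N
... | yes p≤N = p≤N
... | no  p≰N = contradiction (begin-strict
  fromℕ (suc N)                    ≤⟨ fromℕ-mono {suc N} {p} (ℕₚ.≰⇒> p≰N) ⟩
  fromℕ p                          ≤⟨ proj₂ near n (ℕₚ.m≤n⊔m M (proj₁ near)) ⟩
  seq x n + ½ * ε                  <⟨ +-monoʳ-< (seq x n) ½ε<ε ⟩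
  seq x n + ε                      ≤⟨ x+ε≤ n (ℕₚ.m≤m⊔n M (proj₁ near)) ⟩
  fromℕ (suc N)                    ∎) (<-irrefl refl)
  where
  open ≤-Reasoning
  ½ε<ε : ½ * ε < ε
  ½ε<ε = subst (½ * ε <_) (*-identityˡ ε) (*-monoˡ-<-pos ε {{positive 0<ε}} {½} {1ℚ} (*<* (ℤ.+<+ (s≤s (s≤s z≤n)))))
  near = p≤x (½ * ε) (0<-* (positive⁻¹ ½) 0<ε)
  n = M ℕ.⊔ proj₁ near

-- Comparison of the two bounds

^-mono-≤ : ∀ {x y} → 0ℚ ≤ x → x ≤ y → ∀ k → x ^ k ≤ y ^ k
^-mono-≤ 0≤x x≤y zero    = ≤-refl
^-mono-≤ 0≤x x≤y (suc k) = *-mono-≤-nonNeg 0≤x (^-nonNeg 0≤x k) x≤y (^-mono-≤ 0≤x x≤y k)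

-- With y = 1/x the left side is x^k + k x^(k-1), the two leading terms of the binomial expansion of
-- the right side.
[1+k/x]x^k≤[x+1]^k : ∀ {x} y → 0ℚ ≤ x → x * y ≡ 1ℚ → ∀ k → x ^ k * (1ℚ + fromℕ k * y) ≤ (x + 1ℚ) ^ k
[1+k/x]x^k≤[x+1]^k {x} y 0≤x xy≡1 zero = ≤-reflexive (trans (*-identityˡ _) (trans (cong (_+_ 1ℚ) (*-zeroˡ y)) (+-identityʳ 1ℚ)))
[1+k/x]x^k≤[x+1]^k {x} y 0≤x xy≡1 (suc k) = begin
  x * x ^ k * (1ℚ + fromℕ (suc k) * y)                   ≡⟨ cong (λ z → x * x ^ k * (1ℚ + z * y)) (fromℕ-suc k) ⟩
  x * x ^ k * (1ℚ + (1ℚ + fromℕ k) * y)                  ≡⟨ lem x (x ^ k) (fromℕ k) y ⟩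
  x * (x ^ k * (1ℚ + fromℕ k * y)) + x * y * x ^ k       ≤⟨ +-mono-≤ (*-mono-≤ˡ x 0≤x ([1+k/x]x^k≤[x+1]^k y 0≤x xy≡1 k))
                                                             (≤-trans (≤-reflexive (cong (_* x ^ k) xy≡1)) (*-mono-≤ˡ 1ℚ (0≤fromℕ 1) (^-mono-≤ 0≤x (p≤p+q (0≤fromℕ 1)) k))) ⟩
  x * (x + 1ℚ) ^ k + 1ℚ * (x + 1ℚ) ^ k                   ≡⟨ *-distribʳ-+ ((x + 1ℚ) ^ k) x 1ℚ ⟨
  (x + 1ℚ) * (x + 1ℚ) ^ k                                ∎
  where
  open ≤-Reasoning
  lem : ∀ x z k y → x * z * (1ℚ + (1ℚ + k) * y) ≡ x * (z * (1ℚ + k * y)) + x * y * z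
  lem = solve-∀ ℚ-ring

-- 1 + ∑ tⱼ ≤ ∏ (1 + tⱼ) for nonnegative tⱼ, after which each 1 + tⱼ is absorbed into its own factor
-- gⱼ.
ΠF*[1+sum]≤ : ∀ {r} (g t u : Fin r → ℚ) → (∀ j → 0ℚ ≤ g j) → (∀ j → 0ℚ ≤ t j) → (∀ j → g j * (1ℚ + t j) ≤ u j) →
  ΠF g * (1ℚ + sum t) ≤ ΠF u
ΠF*[1+sum]≤ {zero}  g t u 0≤g 0≤t g≤u = ≤-reflexive refl
ΠF*[1+sum]≤ {suc r} g t u 0≤g 0≤t g≤u = begin
  g₀ * ΠF g′ * (1ℚ + (t₀ + Σt))                          ≤⟨ p≤p+q (0≤-* (0≤-* (0≤g Fin.zero) 0≤Πg′) (0≤-* (0≤t Fin.zero) 0≤Σt)) ⟩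
  g₀ * ΠF g′ * (1ℚ + (t₀ + Σt)) + g₀ * ΠF g′ * (t₀ * Σt) ≡⟨ lem g₀ (ΠF g′) t₀ Σt ⟩
  (g₀ * (1ℚ + t₀)) * (ΠF g′ * (1ℚ + Σt))                 ≤⟨ *-mono-≤-nonNeg (0≤-* (0≤g Fin.zero) (0≤-+ (0≤fromℕ 1) (0≤t Fin.zero)))
                                                             (0≤-* 0≤Πg′ (0≤-+ (0≤fromℕ 1) 0≤Σt)) (g≤u Fin.zero)
                                                             (ΠF*[1+sum]≤ g′ (t ∘ Fin.suc) (u ∘ Fin.suc) (0≤g ∘ Fin.suc) (0≤t ∘ Fin.suc) (g≤u ∘ Fin.suc)) ⟩
  u Fin.zero * ΠF (u ∘ Fin.suc)                          ∎
  where
  open ≤-Reasoning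
  g₀ = g Fin.zero
  g′ = g ∘ Fin.suc
  t₀ = t Fin.zero
  Σt = sum (t ∘ Fin.suc)
  0≤Πg′ : 0ℚ ≤ ΠF g′
  0≤Πg′ = ΠF-nonNeg (0≤g ∘ Fin.suc)
  0≤Σt : 0ℚ ≤ Σt
  0≤Σt = sum-nonNeg (0≤t ∘ Fin.suc)
  lem : ∀ g p t s → g * p * (1ℚ + (t + s)) + g * p * (t * s) ≡ (g * (1ℚ + t)) * (p * (1ℚ + s))
  lem = solve-∀ ℚ-ring

-- Both bounds for given x, T and k, before the limit

module Proof
  (x : ℝ) (2≤x : ⟦ fromℕ 2 ⟧ ≤ᴿ x) (N : ℕ) (⌊x⌋≡N : N IsFloorOf x)
  (r : ℕ) (T : Fin r → PrimeSet) (T≤x : ∀ j p → p ∈ₚ T j → ⟦ fromℕ p ⟧ ≤ᴿ x)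
  (disjoint : ∀ i j → i ≢ j → Disjoint (T i) (T j))
  (k : Fin r → ℕ) (η ξ : ℕ)
  (covers⇒η≡0 : CoversPrimes≤ x T → η ≡ 0) (¬covers⇒η≡1 : ¬ CoversPrimes≤ x T → η ≡ 1)
  (ξ≡1 : η ≡ 0 × (∀ j → k j ≡ 0) → ξ ≡ 1)
  (P : ℚ) (P≡ : P ≡ fromℕ (length (filter (ω≡? T k) [1⋯ N ])) * inv N)
  (y : Fin r → ℚ) (H′*y : ∀ j → H′ (T j) * y j ≡ 1ℚ)
  (ρ : Fin r → ℚ) (ρ≡ : ∀ j → ρ j ≡ fromℕ (k j) * y j)
  where

  open ≤-Reasoning

  2≤N : 2 ℕ.≤ N
  2≤N = ≤⇒≤floor {x} ⌊x⌋≡N 2≤x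

  T≤N : ∀ j {p} → p ∈ₚ T j → p ℕ.≤ N
  T≤N j {p} p∈ = ≤⇒≤floor {x} ⌊x⌋≡N (T≤x j p p∈)

  Outside : ℕ → Set
  Outside p = Prime p × ¬ ∃ λ j → p ∈ₚ T j

  outside? : Decidable Outside
  outside? p = prime? p ×-dec ¬? (Finₚ.any? (λ j → p ∈? elements (T j)))

  ps₀ = filter outside? [1⋯ N ]

  ∈-ps₀⁻ : ∀ {p} → p ∈ ps₀ → p ∈ [1⋯ N ] × Outside p
  ∈-ps₀⁻ = ∈-filter⁻ outside? {xs = [1⋯ N ]}

  covered : ∀ {p} → Prime p → p ℕ.≤ N → p ∈ ps₀ ⊎ ∃ λ j → p ∈ₚ T j
  covered {p} pr p≤N = [ inj₂ , (λ p∉T → inj₁ (∈-filter⁺ outside? (∈-[1⋯]⁺ (ℕₚ.<⇒≤ (prime⇒1< pr)) p≤N) (pr , p∉T))) ]′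
    (toSum (Finₚ.any? (λ j → p ∈? elements (T j))))

  open Counting T disjoint y H′*y N 2≤N T≤N public

  P≤ : ∀ e → e ≡ 1 ⊎ (ps₀ ≡ [] × ∃ λ j → 1 ℕ.≤ k j) → P ≤ fromℕ K * (B * (G k * (fromℕ e + sum ρ)))
  P≤ e e-spec = begin
    P                                                          ≡⟨ P≡ ⟩
    fromℕ (length (filter (ω≡? T k) [1⋯ N ])) * inv N          ≡⟨ cong (λ l → fromℕ l * inv N) {x = length (filter (ω≡? T k) [1⋯ N ])} {y = length (A k)} refl ⟩
    fromℕ (length (A k)) * inv N      ≤⟨ ℙ≤ k ps₀ (Unique.filter⁺ outside? ([1⋯]-unique N))
      (All.tabulate (λ p∈ → proj₁ (proj₂ (∈-ps₀⁻ p∈)))) (λ p∈ j p∈T → proj₂ (proj₂ (∈-ps₀⁻ p∈)) (j , p∈T)) covered e e-spec ρ ρ≡ ⟩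
    fromℕ K * (B * (G k * (fromℕ e + sum ρ)))                        ∎

  E-lower : ∃ λ M → ∀ n → M ℕ.≤ n → ½ * B ≤ ΠF (λ j → expSum (- H (T j)) n)
  E-lower = ΠF-lower (λ j → Π (elements (T j)) (λ p → 1ℚ - inv p)) (λ j → expSum (- H (T j)))
    (λ j → Π[1-inv]-nonNeg (elements (T j)) (λ p∈ → ℕₚ.<⇒≤ (T≥2 (T j) p∈)))
    (λ j → subst (λ h → ∀ θ → 0ℚ < θ → θ < 1ℚ → ∃ λ M → ∀ n → M ℕ.≤ n → θ * Π (elements (T j)) (λ p → 1ℚ - inv p) ≤ expSum (- h) n)
      (sym (H≡∑ (T j))) (exp[-∑inv]-lower (elements (T j)) (λ p∈ → ℕₚ.<⇒≤ (T≥2 (T j) p∈))))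
    ½ (positive⁻¹ ½) (*<* (ℤ.+<+ (s≤s (s≤s z≤n))))

  0≤B : 0ℚ ≤ B
  0≤B = ΠF-nonNeg (λ j → Π[1-inv]-nonNeg (elements (T j)) (λ p∈ → ℕₚ.<⇒≤ (T≥2 (T j) p∈)))
  0≤Gk : 0ℚ ≤ G k
  0≤Gk = G-nonNeg k
  ρ-nonNeg : ∀ j → 0ℚ ≤ ρ j
  ρ-nonNeg j = subst (0ℚ ≤_) (sym (ρ≡ j)) (0≤-* (0≤fromℕ (k j)) (y-nonNeg j))
  0≤R : 0ℚ ≤ sum ρ
  0≤R = sum-nonNeg ρ-nonNeg
  0≤GkF : ∀ e → 0ℚ ≤ G k * (fromℕ e + sum ρ)
  0≤GkF e = 0≤-* 0≤Gk (0≤-+ (0≤fromℕ e) 0≤R)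

  GF≤Γ : G k * (fromℕ 1 + sum ρ) ≤ ΠF (λ j → expTerm (H (T j) + fromℕ 2) (k j))
  GF≤Γ = ΠF*[1+sum]≤ (λ j → expTerm (H′ (T j)) (k j)) ρ
    (λ j → expTerm (H (T j) + fromℕ 2) (k j)) (λ j → expTerm-nonNeg (H′-nonNeg (T j)) (k j)) ρ-nonNeg factor≤
    where
    lem : ∀ a b c → a * b * c ≡ (a * c) * b
    lem = solve-∀ ℚ-ring
    factor≤ : ∀ j → expTerm (H′ (T j)) (k j) * (1ℚ + ρ j) ≤ expTerm (H (T j) + fromℕ 2) (k j)
    factor≤ j = begin
      h ^ k j * 1/[ k j ]! * (1ℚ + ρ j)             ≡⟨ lem (h ^ k j) 1/[ k j ]! (1ℚ + ρ j) ⟩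
      h ^ k j * (1ℚ + ρ j) * 1/[ k j ]!             ≡⟨ cong (λ z → h ^ k j * (1ℚ + z) * 1/[ k j ]!) (ρ≡ j) ⟩
      h ^ k j * (1ℚ + fromℕ (k j) * y j) * 1/[ k j ]! ≤⟨ *-mono-≤ʳ 1/[ k j ]! (1/!-nonNeg (k j))
        (≤-trans ([1+k/x]x^k≤[x+1]^k (y j) (H′-nonNeg (T j)) (H′*y j) (k j))
          (^-mono-≤ (0≤-+ (H′-nonNeg (T j)) (0≤fromℕ 1)) h+1≤H+2 (k j))) ⟩
      (H (T j) + fromℕ 2) ^ k j * 1/[ k j ]!                             ∎
      where
      h = H′ (T j)
      -- The 2 of the second bound: one unit from H′ ≤ H + 1, one from absorbing 1 + kⱼ/H′(Tⱼ).
      h+1≤H+2 : h + 1ℚ ≤ H (T j) + fromℕ 2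
      h+1≤H+2 = ≤-trans (+-monoˡ-≤ 1ℚ (H′≤H+1 (T j))) (≤-reflexive (+-assoc (H (T j)) 1ℚ 1ℚ))

  second : P ≤ fromℕ K * (B * ΠF (λ j → expTerm (H (T j) + fromℕ 2) (k j)))
  second = ≤-trans (P≤ 1 (inj₁ refl)) (*-mono-≤ˡ (fromℕ K) (0≤fromℕ K) (*-mono-≤ˡ B 0≤B GF≤Γ))

  P≤1 : P ≤ 1ℚ
  P≤1 = begin
    P                                                     ≡⟨ P≡ ⟩
    fromℕ (length (filter (ω≡? T k) [1⋯ N ])) * inv N     ≤⟨ *-mono-≤ʳ (inv N) (inv-nonNeg N) (fromℕ-mono {length (filter (ω≡? T k) [1⋯ N ])} {N}
      (length-bounded (A-unique k) (A-bound k))) ⟩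
    fromℕ N * inv N                                       ≡⟨ fromℕ*inv N (ℕₚ.<⇒≤ 2≤N) ⟩
    1ℚ                                                    ∎

  0≤Cξ : 0ℚ ≤ C * fromℕ ξ
  0≤Cξ = 0≤-* 0≤C (0≤fromℕ ξ)

  first : P ≤ fromℕ K * (B * (G k * (fromℕ η + sum ρ))) + C * fromℕ ξ
  first = by-cases ps₀ refl
    where
    Goal = P ≤ fromℕ K * (B * (G k * (fromℕ η + sum ρ))) + C * fromℕ ξ
    -- The value of η is tied to a covering condition on real x. Emptiness of the list `ps₀` decides
    -- it: a member refutes the covering and forces η = 1.
    by-cases : ∀ qs → ps₀ ≡ qs → Goal
    by-cases (q ∷ qs) ps₀≡ = ≤-trans (P≤ η (inj₁ (¬covers⇒η≡1 ¬covers))) (p≤p+q 0≤Cξ)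
      where
      ¬covers : ¬ CoversPrimes≤ x T
      ¬covers covers = let q∈ , qr , q∉T = ∈-ps₀⁻ (subst (q ∈_) (sym ps₀≡) (here refl)) in
        q∉T (covers q qr (⟦⟧≤ᴿ-trans {y = x} (fromℕ-mono {q} {N} (proj₂ (∈-[1⋯]⁻ q∈))) (proj₁ ⌊x⌋≡N)))
    by-cases [] ps₀≡[] = [ nonzero , allZero ]′ (toSum (Finₚ.any? (λ j → 1 ℕₚ.≤? k j)))
      where
      nonzero : (∃ λ j → 1 ℕ.≤ k j) → Goal
      nonzero k≢0 = ≤-trans (P≤ η (inj₂ (ps₀≡[] , k≢0))) (p≤p+q 0≤Cξ)
      covers : CoversPrimes≤ x T
      covers p pr p≤x = [ (λ p∈ → contradiction (subst (p ∈_) ps₀≡[] p∈) λ ()) , (λ p∈T → p∈T) ]′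
        (covered pr (≤⇒≤floor {x} ⌊x⌋≡N p≤x))
      -- The exceptional case η = 0, k = 0: here ξ = 1, and P ≤ 1 ≤ C is all that is claimed.
      allZero : ¬ (∃ λ j → 1 ℕ.≤ k j) → Goal
      allZero k≡0 = begin
        P                                                  ≤⟨ P≤1 ⟩
        fromℕ 1                                            ≤⟨ fromℕ-mono {1} {2 ℕ.* K} (ℕₚ.≤-trans 1≤K (ℕₚ.m≤n*m K 2)) ⟩
        C                                                  ≡⟨ *-identityʳ C ⟨
        C * fromℕ 1                                        ≡⟨ cong (λ z → C * fromℕ z) (ξ≡1 (covers⇒η≡0 covers , kj≡0)) ⟨
        C * fromℕ ξ                                        ≤⟨ p≤q+p (0≤-* (0≤fromℕ K) (0≤-* 0≤B (0≤GkF η))) ⟩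
        fromℕ K * (B * (G k * (fromℕ η + sum ρ))) + C * fromℕ ξ  ∎
        where
        kj≡0 : ∀ j → k j ≡ 0
        kj≡0 j = ℕₚ.n≤0⇒n≡0 (ℕ.s≤s⁻¹ (ℕₚ.≰⇒> (λ 1≤kj → k≡0 (j , 1≤kj))))

ℙ≡ : ∀ N .{{_ : ℕ.NonZero N}} {A : Pred ℕ 0ℓ} (A? : Decidable A) → ℙ N A? ≡ fromℕ (length (filter A? [1⋯ N ])) * inv N
ℙ≡ N A? = m/n≡fromℕ*inv (length (filter A? [1⋯ N ])) N

÷≡*1/ : ∀ p q .{{_ : NonZero q}} → p ÷ q ≡ p * 1/ q
÷≡*1/ p q = refl

theorem2 : ∃ λ (C : ℝ) →
    (x : ℝ) (2≤x : ⟦ fromℕ 2 ⟧ ≤ᴿ x) (N : ℕ) (⌊x⌋≡N : N IsFloorOf x)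
    (r : ℕ) (T : Fin r → PrimeSet) →
    (∀ j p → p ∈ₚ T j → ⟦ fromℕ p ⟧ ≤ᴿ x) →
    (∀ i j → i ≢ j → Disjoint (T i) (T j)) →
    (T≢∅ : ∀ j → NonEmpty (T j)) →
    (k : Fin r → ℕ) (η ξ : ℕ) →
    (CoversPrimes≤ x T → η ≡ 0) →
    (¬ CoversPrimes≤ x T → η ≡ 1) →
    (η ≡ 0 × (∀ j → k j ≡ 0) → ξ ≡ 1) →
    (¬ (η ≡ 0 × (∀ j → k j ≡ 0)) → ξ ≡ 0) →
    let P = ℙ N {{floor-nonZero {x} {N} 2≤x ⌊x⌋≡N}} (ω≡? T k) in
    (⟦ P ⟧ ≤ᴿ
    C *ᴿ ∏ (λ j → ⟦ H′ (T j) ^ k j * 1/[ k j ]! ⟧ *ᴿ exp (- H (T j)))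
    *ᴿ ⟦ fromℕ η + sum (λ j → (fromℕ (k j) ÷ H′ (T j)) {{H′-nonZero (T j) (T≢∅ j)}}) ⟧
    +ᴿ C *ᴿ ⟦ fromℕ ξ ⟧)
    ×
    (⟦ P ⟧ ≤ᴿ
    C *ᴿ ∏ (λ j → ⟦ (H (T j) + fromℕ 2) ^ k j * 1/[ k j ]! ⟧ *ᴿ exp (- H (T j))))
theorem2 = ⟦ C ⟧ , λ x 2≤x N ⌊x⌋≡N r T T≤x disjoint T≢∅ k η ξ covers⇒η≡0 ¬covers⇒η≡1 ξ≡1 _ →
  let open Proof x 2≤x N ⌊x⌋≡N r T T≤x disjoint k η ξ covers⇒η≡0 ¬covers⇒η≡1 ξ≡1
             (ℙ N {{floor-nonZero {x} {N} 2≤x ⌊x⌋≡N}} (ω≡? T k)) (ℙ≡ N {{floor-nonZero {x} {N} 2≤x ⌊x⌋≡N}} (ω≡? T k))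
             (λ j → (1/ H′ (T j)) {{H′-nonZero (T j) (T≢∅ j)}}) (λ j → *-inverseʳ (H′ (T j)) {{H′-nonZero (T j) (T≢∅ j)}})
             (λ j → (fromℕ (k j) ÷ H′ (T j)) {{H′-nonZero (T j) (T≢∅ j)}}) (λ j → ÷≡*1/ (fromℕ (k j)) (H′ (T j)) {{H′-nonZero (T j) (T≢∅ j)}})
  in
  Limit.≤ᴿ-∏-+ (ℙ N {{floor-nonZero {x} {N} 2≤x ⌊x⌋≡N}} (ω≡? T k)) C (fromℕ K) B (λ j → H′ (T j)) (λ j → H (T j)) k K≡C*½ 0≤C E-lower
    η ξ (λ j → (fromℕ (k j) ÷ H′ (T j)) {{H′-nonZero (T j) (T≢∅ j)}}) (0≤GkF η) first ,
  Limit.≤ᴿ-∏ (ℙ N {{floor-nonZero {x} {N} 2≤x ⌊x⌋≡N}} (ω≡? T k)) C (fromℕ K) B (λ j → H (T j) + fromℕ 2) (λ j → H (T j)) k K≡C*½ 0≤C E-lower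
    (≤-trans (0≤GkF 1) GF≤Γ) second
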